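{- For every $\epsilon>0$, \texttt{CleverMaker} has a strategy in the $(1:(1-\epsilon)\frac{n}{2})$ half-random Hamiltonicity game on $E(K_n)$ against \texttt{RandomBreaker} which, asymptotically almost surely (i.e. with probability tending to $1$ as $n\to\infty$), is winning within $n+O(\log n)$ moves of \texttt{CleverMaker}. In particular, the sharp threshold bias for each of the $(1:b)$ half-random connectivity game, minimum-degree-$2$ game, and Hamiltonicity game between \texttt{CleverMaker} and \texttt{RandomBreaker} is $\frac{n}{2}$.
   Context: Maker-Breaker games on the board $E(K_n)$: two players alternately claim previously unclaimed (free) edges of the complete graph $K_n$; in a $(1:b)$-biased game Maker claims $1$ edge per turn and Breaker claims $b$ edges per turn, Maker moves first. Maker wins if his graph contains a member of the winning family, otherwise Breaker wins. The connectivity game: Maker wins if his graph is a connected spanning subgraph of $K_n$. The minimum-degree-$2$ game: Maker wins if every vertex has degree at least $2$ in his graph. The Hamiltonicity game: Maker wins if his graph contains a Hamilton cycle of $K_n$. In the half-random game between \texttt{CleverMaker} and \texttt{RandomBreaker}, Breaker (\texttt{RandomBreaker}) claims in each of her moves an edge chosen uniformly at random among all currently free edges, while Maker (\texttt{CleverMaker}) follows a strategy of his choice. A function $k:\mathbb{N}_0\to\mathbb{N}_0$ is a sharp threshold bias of the $(1:b)$ half-random game if for every $\epsilon>0$: (a) \texttt{RandomBreaker} wins the $(1:(1+\epsilon)k(n))$ game with probability tending to $1$ against any strategy of \texttt{CleverMaker}, and (b) \texttt{CleverMaker} has a strategy against which \texttt{RandomBreaker} loses the $(1:(1-\epsilon)k(n))$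 game with probability tending to $1$. Games and strategies are understood as sequences indexed by $n$; biases are rounded to integers.
   Formalization: The parameter ε>0, both in the bias (1-ε)n/2 of the first claim and in the definition of the sharp threshold bias, ranges over positive rational numbers rather than positive reals. -}

module Defs where

open import Data.Nat as ℕ using (ℕ; zero; suc; _%_)
open import Data.Integer as ℤ using (ℤ; +_; -[1+_])
open import Data.Rational as ℚ using (ℚ; 0ℚ; 1ℚ; floor)
open import Data.Fin as Fin using (Fin)
open import Data.Fin.Properties as FinP using ()
open import Data.List using (List; []; _∷_; _++_; [_]; map; concatMap; filter; length; cartesianProduct; allFin)
open import Data.List.Membership.Propositional using (_∈_)
open import Data.List.Membership.DecPropositional as DecMem using ()
open import Data.List.Relation.Unary.Unique.Propositional using (Unique)
open import Data.List.Relation.Unary.Linked using (Linked)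
open import Data.Product using (Σ; ∃; ∃-syntax; _×_; _,_; proj₁; proj₂)
open import Data.Product.Properties using (≡-dec)
open import Data.Sum using (_⊎_)
open import Data.Empty using (⊥)
open import Relation.Nullary using (¬_)
open import Relation.Nullary.Decidable using (¬?)
open import Relation.Binary.PropositionalEquality using (_≡_; _≢_)
open import Data.Nat.Logarithm using (⌊log₂_⌋)

Edge : ℕ → Set
Edge n = Fin n × Fin n

allEdges : (n : ℕ) → List (Edge n)
allEdges n = filter (λ p → proj₁ p FinP.<? proj₂ p) (cartesianProduct (allFin n) (allFin n))

private
  _≟E_ : ∀ {n} (e f : Edge n) → Relation.Nullary.Dec (e ≡ f)
  _≟E_ = ≡-dec FinP._≟_ FinP._≟_

freeEdges : ∀ {n} → List (Edge n) → List (Edge n) → List (Edge n)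
freeEdges {n} M B =
  filter (λ e → ¬? (DecMem._∈?_ _≟E_ e (M ++ B))) (allEdges n)

Adj : ∀ {n} → List (Edge n) → Fin n → Fin n → Set
Adj G u v = ((u , v) ∈ G) ⊎ ((v , u) ∈ G)

data Reach {n} (G : List (Edge n)) (u : Fin n) : Fin n → Set where
  here : Reach G u u
  step : ∀ {v w} → Reach G u v → Adj G v w → Reach G u w

Connected : ∀ {n} → List (Edge n) → Set
Connected {n} G = (u v : Fin n) → Reach G u v

MinDeg2 : ∀ {n} → List (Edge n) → Set
MinDeg2 {n} G = (v : Fin n) → Σ (Fin n) λ u → Σ (Fin n) λ w → u ≢ w × Adj G v u × Adj G v w

lastOr : ∀ {A : Set} → A → List A → A
lastOr x [] = x
lastOr x (y ∷ ys) = lastOr y ys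

Closes : ∀ {n} → List (Edge n) → List (Fin n) → Set
Closes G [] = ⊥
Closes G (x ∷ xs) = Adj G (lastOr x xs) x

Hamiltonian : ∀ {n} → List (Edge n) → Set
Hamiltonian {n} G = Σ (List (Fin n)) λ c →
  3 ℕ.≤ n × ((v : Fin n) → v ∈ c) × Unique c × Linked (Adj G) c × Closes G c

Dist : Set → Set
Dist X = List (ℚ × X)

scale : ∀ {X : Set} → ℚ → Dist X → Dist X
scale w = map (λ p → (w ℚ.* proj₁ p , proj₂ p))

uniform : ∀ {A X : Set} → A → List A → (A → Dist X) → Dist X
uniform x xs f = concatMap (λ e → scale ((+ 1) ℚ./ suc (length xs)) (f e)) (x ∷ xs)

data Mass {X : Set} (P : X → Set) : Dist X → ℚ → Set where
  nil : Mass P [] 0ℚ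
  yes : ∀ {w x d r} → P x → Mass P d r → Mass P ((w , x) ∷ d) (w ℚ.+ r)
  no  : ∀ {w x d r} → ¬ P x → Mass P d r → Mass P ((w , x) ∷ d) r

-- A (deterministic) Maker strategy sees Maker's and Breaker's claimed edges
-- (each in chronological order) and returns a number k; Maker then claims
-- the k-th free edge (index taken modulo the number of free edges).
Strategy : ℕ → Set
Strategy n = List (Edge n) → List (Edge n) → ℕ

nthOr : ∀ {A : Set} → A → List A → ℕ → A
nthOr d [] _ = d
nthOr d (x ∷ xs) zero = x
nthOr d (x ∷ xs) (suc k) = nthOr d xs k

choose : ∀ {A : Set} → A → List A → ℕ → A
choose x xs k = nthOr x (x ∷ xs) (k % suc (length xs))

-- play S b m M B : distribution of Maker's graph after at most m further
-- rounds (a round = one Maker edge, then b uniformly random Breaker edges,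
-- each uniform among the currently free edges); the game stops when the
-- board is exhausted.
mutual
  play : ∀ {n} → Strategy n → ℕ → ℕ → List (Edge n) → List (Edge n) → Dist (List (Edge n))
  play S b zero M B = [ (1ℚ , M) ]
  play S b (suc m) M B = makerMove S b m M B (freeEdges M B)

  makerMove : ∀ {n} → Strategy n → ℕ → ℕ → List (Edge n) → List (Edge n) →
              List (Edge n) → Dist (List (Edge n))
  makerMove S b m M B [] = [ (1ℚ , M) ]
  makerMove S b m M B (x ∷ xs) =
    breaker S b m b (M ++ [ choose x xs (S M B) ]) B

  breaker : ∀ {n} → Strategy n → ℕ → ℕ → ℕ → List (Edge n) → List (Edge n) →
            Dist (List (Edge n))
  breaker S b m zero M B = play S b m M B
  breaker S b m (suc k) M B = breakerPick S b m k M B (freeEdges M B)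

  breakerPick : ∀ {n} → Strategy n → ℕ → ℕ → ℕ → List (Edge n) → List (Edge n) →
                List (Edge n) → Dist (List (Edge n))
  breakerPick S b m k M B [] = play S b m M B
  breakerPick S b m k M B (x ∷ xs) =
    uniform x xs (λ e → breaker S b m k M (B ++ [ e ]))

-- Maker's final graph in the whole (1:b) game (each round claims at least
-- one edge, so |E(K_n)| rounds exhaust the board).
fullGame : ∀ {n} → Strategy n → ℕ → Dist (List (Edge n))
fullGame {n} S b = play S b (length (allEdges n)) [] []

gameWithin : ∀ {n} → Strategy n → ℕ → ℕ → Dist (List (Edge n))
gameWithin S b m = play S b m [] []

AAS : (P : (n : ℕ) → List (Edge n) → Set) → ((n : ℕ) → Dist (List (Edge n))) → Set
AAS P d = (δ : ℚ) → 0ℚ ℚ.< δ → ∃[ N ] ((n : ℕ) → N ℕ.≤ n →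
  Σ ℚ λ r → Mass (P n) (d n) r × (1ℚ ℚ.- δ) ℚ.≤ r)

toℕ⁺ : ℤ → ℕ
toℕ⁺ (+ k) = k
toℕ⁺ -[1+ _ ] = 0

bias : ℚ → (ℕ → ℚ) → ℕ → ℕ
bias c k n = toℕ⁺ (floor ((1ℚ ℚ.+ c) ℚ.* k n))

SharpThreshold : (P : ∀ {n} → List (Edge n) → Set) → (ℕ → ℚ) → Set
SharpThreshold P k = (ε : ℚ) → 0ℚ ℚ.< ε →
  ((S : (n : ℕ) → Strategy n) →
     AAS (λ n G → ¬ P G) (λ n → fullGame (S n) (bias ε k n)))
  × (Σ ((n : ℕ) → Strategy n) λ S →
     AAS (λ n G → P G) (λ n → fullGame (S n) (bias (ℚ.- ε) k n)))

half : ℕ → ℚ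
half n = (+ n) ℚ./ 2

{-# OPTIONS --safe #-}

-- Breaker's half: if b + 1 ≥ (1 + ε) n / 2, then the board is exhausted before Maker owns
-- n ∸ 1 edges, whatever she does.
--
-- Maker's half: for a suitable s of order log n, with high probability the following holds as
-- long as a positive fraction of the board is free: (i) Breaker does not own all edges between
-- two disjoint sets of s vertices, and (ii) every vertex has more than 6 s edges not owned by
-- Breaker. This is a union bound in the form of a supermartingale: with k picks of Breaker to
-- come and more than l + k free edges left, the sum over all dangerous edge sets X of
-- Π_{e ∈ X} (1 if Breaker owns e, else k / (l + 1 + k)) does not increase in expectation,
-- whatever Maker does. Given (i) and (ii), Maker builds a path by depth-first search, in which
-- every move visits a new vertex and at most s vertices die, closes it by an edge between its
-- first s and its last s vertices, and inserts each of the at most 4 s vertices left over into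
-- the cycle by three edges. Only the two postponed edges of an insertion are exposed to Breaker,
-- for at most two rounds each, which fails with probability O(log n / n) in total.
module Submission where

open import Defs hiding (here; yes; no)
open import Algebra.Solver.CommutativeMonoid as CMS using ()
open import Data.Empty using (⊥; ⊥-elim)
open import Data.Fin using (Fin)
import Data.Fin.Properties as FinP
open import Data.Integer as ℤ using (ℤ; -[1+_])
import Data.Integer.DivMod as ℤD
import Data.Integer.Properties as ℤP
open import Data.List using (List; []; _∷_; _++_; [_]; map; concatMap; filter; length; reverse; take; drop; cartesianProduct; cartesianProductWith; allFin)
import Data.List.Membership.DecPropositional as DecMem
open import Data.List.Membership.Propositional using (_∈_; _∉_; find; lose)
import Data.List.Membership.Propositional.Properties as ∈P
import Data.List.Properties as LP
open import Data.List.Relation.Binary.Permutation.Propositional using (_↭_; ↭-refl; ↭-reflexive; ↭-sym; ↭-trans; ↭⇒↭ₛ)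
import Data.List.Relation.Binary.Permutation.Propositional.Properties as ↭P
import Data.List.Relation.Binary.Permutation.Setoid.Properties as ↭ₛP
open import Data.List.Relation.Unary.All as All using (All; []; _∷_)
open import Data.List.Relation.Unary.All.Properties using (¬All⇒Any¬)
open import Data.List.Relation.Unary.AllPairs using ([]; _∷_)
open import Data.List.Relation.Unary.Any as Any using (Any; here; there)
open import Data.List.Relation.Unary.Linked as Linked using (Linked; []; [-]; _∷_)
open import Data.List.Relation.Unary.Unique.DecPropositional using (unique?)
open import Data.List.Relation.Unary.Unique.Propositional using (Unique)
import Data.List.Relation.Unary.Unique.Propositional.Properties as UP
open import Data.Nat as ℕ using (ℕ; zero; suc; s≤s; z≤n)
open import Data.Nat.DivMod using (m<n⇒m%n≡m)
open import Data.Nat.Induction using (<-rec)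
open import Data.Nat.Logarithm using (⌊log₂_⌋; ⌊log₂⌋-mono-≤; ⌊log₂⌊n/2⌋⌋≡⌊log₂n⌋∸1; ⌊log₂[2^n]⌋≡n)
import Data.Nat.Properties as ℕP
open import Data.Nat.Solver as ℕS using ()
open import Data.Product using (Σ; ∃; ∃₂; _×_; _,_; proj₁; proj₂; swap)
open import Data.Product.Properties using (≡-dec)
open import Data.Rational as ℚ using (ℚ; mkℚ; 0ℚ; 1ℚ)
import Data.Rational.Properties as ℚP
open import Data.Rational.Unnormalised as ℚᵘ using (ℚᵘ; mkℚᵘ; *≡*; *≤*)
import Data.Rational.Unnormalised.Properties as ℚᵘP
open import Data.Sum as Sum using (_⊎_; inj₁; inj₂)
open import Function using (_∘_)
open import Relation.Binary using (DecidableEquality; tri<; tri≈; tri>)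
open import Relation.Binary.PropositionalEquality hiding ([_])
open import Relation.Nullary using (Dec; yes; no; ¬_)
open import Relation.Nullary.Decidable using (map′; _×-dec_; _⊎-dec_; ¬?; decidable-stable)
open import Relation.Unary using (Decidable)

-- Maker's moves depend on the past, so Breaker's edges are not a uniformly random set and cannot be
-- exposed in advance. All probability is therefore backward induction along the game: the value
-- carried is `1 - risk`, and a position whose risk has reached 1 is simply given up. An edge of
-- Maker keeps its factor in the product, an overestimate that makes the sum insensitive to her
-- choices.
--
-- The size `s` balances the union bound: about `n ^ (7 s)` edge sets compete with `p ^ (s * s)`,
-- where `p` stays away from 1 because Maker's plan ends with a positive fraction of the board
-- unclaimed. Hence `s` is a multiple of `log n` that depends on `ε`.
--
-- Property (i) yields single edges between large sets; it does not join a given vertex to two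
-- consecutive vertices of the cycle. Extending and closing the path need one edge, claimed in the
-- move that finds it. An insertion is therefore a rotation with three new edges, and this is the
-- only reason why anything is exposed to Breaker. An edge exposed for one round is lost with
-- probability `O(1/n)`.

module Rationals where

  -- Natural numbers as rationals, and order arithmetic.

  open import Data.Rational using (_≤_; _<_; _+_; _*_; _-_; -_; _/_; toℚᵘ)
  open import Data.Integer using (+_)

  toℚᵘ-/ : ∀ i d → toℚᵘ (i / suc d) ℚᵘ.≃ mkℚᵘ i d
  toℚᵘ-/ i d = ℚP.toℚᵘ-fromℚᵘ (mkℚᵘ i d)

  /-mono : ∀ {i j d} → i ℤ.≤ j → i / suc d ≤ j / suc d
  /-mono {i} {j} {d} i≤j = ℚP.toℚᵘ-cancel-≤ (begin
    toℚᵘ (i / suc d) ≃⟨ toℚᵘ-/ i d ⟩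
    mkℚᵘ i d         ≤⟨ *≤* (ℤP.*-monoʳ-≤-nonNeg (+ suc d) i≤j) ⟩
    mkℚᵘ j d         ≃⟨ toℚᵘ-/ j d ⟨
    toℚᵘ (j / suc d) ∎)
    where open ℚᵘP.≤-Reasoning

  opaque
    ι : ℕ → ℚ
    ι k = (+ k) / 1

    ι-+ : ∀ a b → ι (a ℕ.+ b) ≡ ι a + ι b
    ι-+ a b = ℚP.toℚᵘ-injective (begin
      toℚᵘ (ι (a ℕ.+ b))            ≈⟨ toℚᵘ-/ _ 0 ⟩
      mkℚᵘ (+ (a ℕ.+ b)) 0           ≈⟨ *≡* (cong₂ (λ x y → (x ℤ.+ y) ℤ.* + 1) (sym (ℤP.*-identityʳ (+ a))) (sym (ℤP.*-identityʳ (+ b)))) ⟩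
      mkℚᵘ (+ a) 0 ℚᵘ.+ mkℚᵘ (+ b) 0 ≈⟨ ℚᵘP.+-cong (toℚᵘ-/ (+ a) 0) (toℚᵘ-/ (+ b) 0) ⟨
      toℚᵘ (ι a) ℚᵘ.+ toℚᵘ (ι b)     ≈⟨ ℚP.toℚᵘ-homo-+ (ι a) (ι b) ⟨
      toℚᵘ (ι a + ι b)               ∎)
      where open ℚᵘP.≃-Reasoning

    ι-* : ∀ a b → ι (a ℕ.* b) ≡ ι a * ι b
    ι-* a b = ℚP.toℚᵘ-injective (begin
      toℚᵘ (ι (a ℕ.* b))            ≈⟨ toℚᵘ-/ _ 0 ⟩
      mkℚᵘ (+ (a ℕ.* b)) 0           ≈⟨ *≡* (cong (ℤ._* + 1) (ℤP.pos-* a b)) ⟩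
      mkℚᵘ (+ a) 0 ℚᵘ.* mkℚᵘ (+ b) 0 ≈⟨ ℚᵘP.*-cong (toℚᵘ-/ (+ a) 0) (toℚᵘ-/ (+ b) 0) ⟨
      toℚᵘ (ι a) ℚᵘ.* toℚᵘ (ι b)     ≈⟨ ℚP.toℚᵘ-homo-* (ι a) (ι b) ⟨
      toℚᵘ (ι a * ι b)               ∎)
      where open ℚᵘP.≃-Reasoning

    ι-suc : ∀ a → ι (suc a) ≡ 1ℚ + ι a
    ι-suc = ι-+ 1

    ι-mono : ∀ {a b} → a ℕ.≤ b → ι a ≤ ι b
    ι-mono a≤b = /-mono (ℤ.+≤+ a≤b)

    ι-cancel : ∀ {a b} → ι a ≤ ι b → a ℕ.≤ b
    ι-cancel {a} {b} le with lem
      where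
      open ℚᵘP.≤-Reasoning
      lem : mkℚᵘ (+ a) 0 ℚᵘ.≤ mkℚᵘ (+ b) 0
      lem = begin
        mkℚᵘ (+ a) 0 ≃⟨ toℚᵘ-/ (+ a) 0 ⟨
        toℚᵘ (ι a)   ≤⟨ ℚP.toℚᵘ-mono-≤ le ⟩
        toℚᵘ (ι b)   ≃⟨ toℚᵘ-/ (+ b) 0 ⟩
        mkℚᵘ (+ b) 0 ∎
    ... | *≤* p = ℤP.drop‿+≤+ (subst₂ ℤ._≤_ (ℤP.*-identityʳ (+ a)) (ℤP.*-identityʳ (+ b)) p)

    0≤ι : ∀ k → 0ℚ ≤ ι k
    0≤ι k = ι-mono {0} {k} z≤n

    /-*-ι : ∀ i d → (i / suc d) * ι (suc d) ≡ i / 1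
    /-*-ι i d = ℚP.toℚᵘ-injective (begin
      toℚᵘ ((i / suc d) * ι (suc d))             ≈⟨ ℚP.toℚᵘ-homo-* (i / suc d) (ι (suc d)) ⟩
      toℚᵘ (i / suc d) ℚᵘ.* toℚᵘ (ι (suc d))     ≈⟨ ℚᵘP.*-cong (toℚᵘ-/ i d) (toℚᵘ-/ (+ suc d) 0) ⟩
      mkℚᵘ i d ℚᵘ.* mkℚᵘ (+ suc d) 0             ≈⟨ *≡* (trans (ℤP.*-identityʳ _) (cong (λ x → i ℤ.* + suc x) (sym (ℕP.*-identityʳ d)))) ⟩
      mkℚᵘ i 0                                   ≈⟨ toℚᵘ-/ i 0 ⟨
      toℚᵘ (i / 1)                               ∎)
      where open ℚᵘP.≃-Reasoning

    ratio-*-ι : ∀ k d → ((+ k) / suc d) * ι (suc d) ≡ ι k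
    ratio-*-ι k d = /-*-ι (+ k) d

    ι-0 : ι 0 ≡ 0ℚ
    ι-0 = refl

    ι-≡ : ∀ k → ι k ≡ (+ k) / 1
    ι-≡ k = refl

    ι-1 : ι 1 ≡ 1ℚ
    ι-1 = refl

  *-monoˡ : ∀ {r p q} → 0ℚ ≤ r → p ≤ q → r * p ≤ r * q
  *-monoˡ {r} 0≤r = ℚP.*-monoˡ-≤-nonNeg r {{ℚ.nonNegative 0≤r}}

  *-monoʳ : ∀ {r p q} → 0ℚ ≤ r → p ≤ q → p * r ≤ q * r
  *-monoʳ {r} 0≤r = ℚP.*-monoʳ-≤-nonNeg r {{ℚ.nonNegative 0≤r}}

  *-mono : ∀ {p q r s} → 0ℚ ≤ p → 0ℚ ≤ s → p ≤ q → r ≤ s → p * r ≤ q * s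
  *-mono 0≤p 0≤s p≤q r≤s = ℚP.≤-trans (*-monoˡ 0≤p r≤s) (*-monoʳ 0≤s p≤q)

  0≤* : ∀ {p q} → 0ℚ ≤ p → 0ℚ ≤ q → 0ℚ ≤ p * q
  0≤* {p} {q} 0≤p 0≤q = subst (_≤ p * q) (ℚP.*-zeroʳ p) (*-monoˡ 0≤p 0≤q)

  0≤+ : ∀ {p q} → 0ℚ ≤ p → 0ℚ ≤ q → 0ℚ ≤ p + q
  0≤+ = ℚP.+-mono-≤

  *-cancelˡ : ∀ {r p q} → 0ℚ < r → r * p ≤ r * q → p ≤ q
  *-cancelˡ {r} 0<r = ℚP.*-cancelˡ-≤-pos r {{ℚ.positive 0<r}}

  0<1ℚ : 0ℚ < 1ℚ
  0<1ℚ = ℚP.positive⁻¹ 1ℚ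

  0<ι : ∀ k → 0ℚ < ι (suc k)
  0<ι k = ℚP.<-≤-trans 0<1ℚ (subst (_≤ ι (suc k)) ι-1 (ι-mono (s≤s z≤n)))

  diff-≥0 : ∀ {p q} → p ≤ q → 0ℚ ≤ q - p
  diff-≥0 {p} {q} h = subst (_≤ q - p) (ℚP.+-inverseʳ p) (ℚP.+-monoˡ-≤ (- p) h)

  ≤+ʳ : ∀ {p q} → 0ℚ ≤ q → p ≤ p + q
  ≤+ʳ {p} {q} h = subst (_≤ p + q) (ℚP.+-identityʳ p) (ℚP.+-monoʳ-≤ p h)

  ≤+ˡ : ∀ {p q} → 0ℚ ≤ q → p ≤ q + p
  ≤+ˡ {p} {q} h = subst (_≤ q + p) (ℚP.+-identityˡ p) (ℚP.+-monoˡ-≤ p h)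

  1-‿≤0 : ∀ {p} → 1ℚ ≤ p → 1ℚ - p ≤ 0ℚ
  1-‿≤0 {p} h = subst (1ℚ - p ≤_) (ℚP.+-inverseʳ p) (ℚP.+-monoˡ-≤ (- p) h)

  1-‿≤1 : ∀ {p} → 0ℚ ≤ p → 1ℚ - p ≤ 1ℚ
  1-‿≤1 {p} h = subst (1ℚ - p ≤_) (ℚP.+-identityʳ 1ℚ) (ℚP.+-monoʳ-≤ 1ℚ (ℚP.neg-antimono-≤ h))

open Rationals

-- Finite sums, expectations and backward induction over the game.

module Expectation where

  open import Data.Rational using (_≤_; _+_; _*_; _/_)
  open import Data.Rational.Solver using (module +-*-Solver)

  Sum : {A : Set} → (A → ℚ) → List A → ℚ
  Sum f []       = 0ℚ
  Sum f (x ∷ xs) = f x + Sum f xs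

  module _ {A : Set} where

    Sum-mono : ∀ {f g : A → ℚ} xs → (∀ x → x ∈ xs → f x ≤ g x) → Sum f xs ≤ Sum g xs
    Sum-mono []       h = ℚP.≤-refl
    Sum-mono (x ∷ xs) h = ℚP.+-mono-≤ (h x (here refl)) (Sum-mono xs (λ y → h y ∘ there))

    Sum-cong : ∀ {f g : A → ℚ} xs → (∀ x → x ∈ xs → f x ≡ g x) → Sum f xs ≡ Sum g xs
    Sum-cong []       h = refl
    Sum-cong (x ∷ xs) h = cong₂ _+_ (h x (here refl)) (Sum-cong xs (λ y → h y ∘ there))

    Sum-+ : ∀ (f g : A → ℚ) xs → Sum (λ x → f x + g x) xs ≡ Sum f xs + Sum g xs
    Sum-+ f g []       = refl
    Sum-+ f g (x ∷ xs) = trans (cong (f x + g x +_) (Sum-+ f g xs))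
      (solve 4 (λ a b c d → a :+ b :+ (c :+ d) := a :+ c :+ (b :+ d)) refl (f x) (g x) _ _)
      where open +-*-Solver

    Sum-* : ∀ c (f : A → ℚ) xs → Sum (λ x → c * f x) xs ≡ c * Sum f xs
    Sum-* c f []       = sym (ℚP.*-zeroʳ c)
    Sum-* c f (x ∷ xs) = trans (cong (c * f x +_) (Sum-* c f xs)) (sym (ℚP.*-distribˡ-+ c (f x) _))

    Sum-const : ∀ c (xs : List A) → Sum (λ _ → c) xs ≡ ι (length xs) * c
    Sum-const c []       = sym (trans (cong (_* c) ι-0) (ℚP.*-zeroˡ c))
    Sum-const c (x ∷ xs) = begin
      c + Sum (λ _ → c) xs          ≡⟨ cong (c +_) (Sum-const c xs) ⟩
      c + ι (length xs) * c         ≡⟨ solve 2 (λ c l → c :+ l :* c := (con 1ℚ :+ l) :* c) refl c (ι (length xs)) ⟩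
      (1ℚ + ι (length xs)) * c      ≡⟨ cong (_* c) (ι-suc (length xs)) ⟨
      ι (suc (length xs)) * c       ∎
      where open ≡-Reasoning
            open +-*-Solver

    Sum-≥0 : ∀ {f : A → ℚ} xs → (∀ x → x ∈ xs → 0ℚ ≤ f x) → 0ℚ ≤ Sum f xs
    Sum-≥0 []       h = ℚP.≤-refl
    Sum-≥0 (x ∷ xs) h = 0≤+ (h x (here refl)) (Sum-≥0 xs (λ y → h y ∘ there))

    ∈⇒≤Sum : ∀ {f : A → ℚ} {x xs} → (∀ x → 0ℚ ≤ f x) → x ∈ xs → f x ≤ Sum f xs
    ∈⇒≤Sum {xs = _ ∷ xs} h (here refl) = ≤+ʳ (Sum-≥0 xs (λ y _ → h y))
    ∈⇒≤Sum {xs = y ∷ _}  h (there i)   = ℚP.≤-trans (∈⇒≤Sum h i) (≤+ˡ (h y))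

    Sum-++ : ∀ (f : A → ℚ) xs ys → Sum f (xs ++ ys) ≡ Sum f xs + Sum f ys
    Sum-++ f []       ys = sym (ℚP.+-identityˡ _)
    Sum-++ f (x ∷ xs) ys = trans (cong (f x +_) (Sum-++ f xs ys)) (sym (ℚP.+-assoc (f x) _ _))

  Sum-swap : ∀ {A C : Set} (f : A → C → ℚ) xs ys →
             Sum (λ x → Sum (f x) ys) xs ≡ Sum (λ y → Sum (λ x → f x y) xs) ys
  Sum-swap f xs []       = trans (Sum-const 0ℚ xs) (ℚP.*-zeroʳ (ι (length xs)))
  Sum-swap f xs (y ∷ ys) = trans (Sum-+ (λ x → f x y) _ xs) (cong (Sum (λ x → f x y) xs +_) (Sum-swap f xs ys))

  𝔼 : {X : Set} → (X → ℚ) → Dist X → ℚ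
  𝔼 g = Sum (λ p → proj₁ p * g (proj₂ p))

  module _ {X : Set} where

    𝔼-scale : ∀ (g : X → ℚ) w d → 𝔼 g (scale w d) ≡ w * 𝔼 g d
    𝔼-scale g w []            = sym (ℚP.*-zeroʳ w)
    𝔼-scale g w ((v , x) ∷ d) = trans (cong₂ _+_ (ℚP.*-assoc w v (g x)) (𝔼-scale g w d))
                                      (sym (ℚP.*-distribˡ-+ w (v * g x) _))

    𝔼-point : ∀ (g : X → ℚ) x → 𝔼 g [ (1ℚ , x) ] ≡ g x
    𝔼-point g x = trans (ℚP.+-identityʳ _) (ℚP.*-identityˡ (g x))

    -- Multiplied by the number of outcomes, so that the induction over the game needs no division.
    𝔼-uniform : ∀ {A : Set} (g : X → ℚ) x xs (f : A → Dist X) →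
                ι (suc (length xs)) * 𝔼 g (uniform x xs f) ≡ Sum (λ e → 𝔼 g (f e)) (x ∷ xs)
    𝔼-uniform g x xs f = begin
      N * 𝔼 g (uniform x xs f)     ≡⟨ cong (N *_) (weighted (x ∷ xs)) ⟩
      N * (w * T)                  ≡⟨ solve 3 (λ a b c → a :* (b :* c) := b :* a :* c) refl N w T ⟩
      w * N * T                    ≡⟨ cong (_* T) (/-*-ι (ℤ.+ 1) (length xs)) ⟩
      1ℚ * T                       ≡⟨ ℚP.*-identityˡ T ⟩
      T                            ∎
      where
      open ≡-Reasoning
      open +-*-Solver
      N w T : ℚ
      N = ι (suc (length xs))
      w = (ℤ.+ 1) / suc (length xs)
      T = Sum (λ e → 𝔼 g (f e)) (x ∷ xs)
      weighted : ∀ es → 𝔼 g (concatMap (λ e → scale w (f e)) es) ≡ w * Sum (λ e → 𝔼 g (f e)) es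
      weighted []       = sym (ℚP.*-zeroʳ w)
      weighted (e ∷ es) = trans (Sum-++ _ (scale w (f e)) _)
        (trans (cong₂ _+_ (𝔼-scale g w (f e)) (weighted es)) (sym (ℚP.*-distribˡ-+ w _ _)))

  indicator : {P : Set} → Dec P → ℚ
  indicator (yes _) = 1ℚ
  indicator (no _)  = 0ℚ

  indicator-yes : ∀ {P : Set} (P? : Dec P) → P → indicator P? ≡ 1ℚ
  indicator-yes (yes _) p = refl
  indicator-yes (no ¬p) p with () ← ¬p p

  0≤indicator : ∀ {P : Set} (P? : Dec P) → 0ℚ ≤ indicator P?
  0≤indicator (yes _) = ℚP.<⇒≤ 0<1ℚ
  0≤indicator (no _)  = ℚP.≤-refl

  -- A derivation of `Mass` settles `P` at every outcome. This is why the three graph properties are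
  -- shown to be decidable.
  mass : ∀ {X : Set} {P : X → Set} (P? : Decidable P) d → Mass P d (𝔼 (indicator ∘ P?) d)
  mass P? [] = nil
  mass P? ((w , x) ∷ d) with P? x
  ... | yes p = subst (λ v → Mass _ ((w , x) ∷ d) (v + 𝔼 (indicator ∘ P?) d)) (sym (ℚP.*-identityʳ w)) (Mass.yes p (mass P? d))
  ... | no ¬p = subst (Mass _ _) (sym (trans (cong (_+ _) (ℚP.*-zeroʳ w)) (ℚP.+-identityˡ _))) (Mass.no ¬p (mass P? d))

  -- 𝒱 m M B v and 𝒲 m k M B v are read as: v is a lower bound for the expectation
  -- of g when m rounds (and k picks of Breaker in the running round) are left.
  module LowerBound {n} (S : Strategy n) (b : ℕ) (g : List (Edge n) → ℚ)
    (𝒱 : ℕ → List (Edge n) → List (Edge n) → ℚ → Set)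
    (𝒲 : ℕ → ℕ → List (Edge n) → List (Edge n) → ℚ → Set)
    (leaf  : ∀ {M B v} → 𝒱 0 M B v → v ≤ g M)
    (stuck : ∀ {m M B v} → freeEdges M B ≡ [] → 𝒱 (suc m) M B v → v ≤ g M)
    (maker : ∀ {m M B v x xs} → freeEdges M B ≡ x ∷ xs → 𝒱 (suc m) M B v →
             𝒲 m b (M ++ [ choose x xs (S M B) ]) B v)
    (turn  : ∀ {m M B v} → 𝒲 m 0 M B v → 𝒱 m M B v)
    (full  : ∀ {m k M B v} → freeEdges M B ≡ [] → 𝒲 m (suc k) M B v → 𝒱 m M B v)
    (pick  : ∀ {m k M B v x xs} → freeEdges M B ≡ x ∷ xs → 𝒲 m (suc k) M B v →
             Σ (Edge n → ℚ) λ w → (∀ e → e ∈ x ∷ xs → 𝒲 m k M (B ++ [ e ]) (w e)) ×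
               ι (suc (length xs)) * v ≤ Sum w (x ∷ xs))
    where

    mutual
      play-bound : ∀ {m M B v} → 𝒱 m M B v → v ≤ 𝔼 g (play S b m M B)
      play-bound {zero} {M} h = subst (_ ≤_) (sym (𝔼-point g M)) (leaf h)
      play-bound {suc m} {M} {B} h with freeEdges M B in eq
      ... | []     = subst (_ ≤_) (sym (𝔼-point g M)) (stuck eq h)
      ... | x ∷ xs = breaker-bound b (maker eq h)

      breaker-bound : ∀ {m M B v} k → 𝒲 m k M B v → v ≤ 𝔼 g (breaker S b m k M B)
      breaker-bound zero h = play-bound (turn h)
      breaker-bound {m} {M} {B} {v} (suc k) h with freeEdges M B in eq
      ... | []     = play-bound (full eq h)
      ... | x ∷ xs with pick eq h
      ...   | w , hw , le = *-cancelˡ (0<ι (length xs)) (begin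
        ι (suc (length xs)) * v ≤⟨ le ⟩
        Sum w (x ∷ xs)          ≤⟨ Sum-mono (x ∷ xs) (λ e i → breaker-bound k (hw e i)) ⟩
        Sum (λ e → 𝔼 g (breaker S b m k M (B ++ [ e ]))) (x ∷ xs)
                                ≡⟨ 𝔼-uniform g x xs (λ e → breaker S b m k M (B ++ [ e ])) ⟨
        ι (suc (length xs)) * 𝔼 g (uniform x xs (λ e → breaker S b m k M (B ++ [ e ]))) ∎)
        where open ℚP.≤-Reasoning

open Expectation

-- Counting by inclusion, the free edges, and the number of edges of the board.

module Edges where

  open import Data.Nat using (_≤_; _<_; _+_; _*_; _%_)

  module _ {A : Set} where

    unique-head : ∀ {x : A} {xs} → Unique (x ∷ xs) → x ∉ xs
    unique-head = UP.Unique[x∷xs]⇒x∉xs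

    unique-∷ : ∀ {x : A} {xs} → x ∉ xs → Unique xs → Unique (x ∷ xs)
    unique-∷ {x} {xs} x∉ u = All.tabulate (λ i x≡y → x∉ (subst (_∈ xs) (sym x≡y) i)) ∷ u

    -- The pigeonhole principle. The counts of edges and vertices below are reduced to inclusions of
    -- repetition-free lists.
    unique-⊆⇒length≤ : ∀ {xs ys : List A} → Unique xs → (∀ {x} → x ∈ xs → x ∈ ys) → length xs ≤ length ys
    unique-⊆⇒length≤ {[]}     _ _ = z≤n
    unique-⊆⇒length≤ {x ∷ xs} u@(_ ∷ u′) sub with ∈P.∈-∃++ (sub (here refl))
    ... | as , bs , refl = begin
      suc (length xs)              ≤⟨ s≤s (unique-⊆⇒length≤ u′ sub′) ⟩
      suc (length (as ++ bs))      ≡⟨ cong suc (LP.length-++ as) ⟩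
      suc (length as + length bs)  ≡⟨ ℕP.+-suc (length as) (length bs) ⟨
      length as + suc (length bs)  ≡⟨ LP.length-++ as ⟨
      length (as ++ x ∷ bs)        ∎
      where
      open ℕP.≤-Reasoning
      sub′ : ∀ {y} → y ∈ xs → y ∈ as ++ bs
      sub′ i with ∈P.∈-++⁻ as (sub (there i))
      ... | inj₁ j           = ∈P.∈-++⁺ˡ j
      ... | inj₂ (here refl) = ⊥-elim (unique-head u i)
      ... | inj₂ (there j)   = ∈P.∈-++⁺ʳ as j

  length-++-∷ʳ : ∀ {A : Set} (xs : List A) x → length (xs ++ [ x ]) ≡ suc (length xs)
  length-++-∷ʳ xs x = trans (LP.length-++ xs) (ℕP.+-comm (length xs) 1)

  length-cartesianProductWith : ∀ {A B C : Set} (f : A → B → C) xs ys →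
    length (cartesianProductWith f xs ys) ≡ length xs * length ys
  length-cartesianProductWith f []       ys = refl
  length-cartesianProductWith f (x ∷ xs) ys = trans (LP.length-++ (map (f x) ys))
    (cong₂ _+_ (LP.length-map (f x) ys) (length-cartesianProductWith f xs ys))

  module _ {A : Set} (_≟_ : DecidableEquality A) where

    position : A → List A → ℕ
    position e [] = 0
    position e (x ∷ xs) with x ≟ e
    ... | yes _ = 0
    ... | no _  = suc (position e xs)

    position-< : ∀ {e xs} → e ∈ xs → position e xs < length xs
    position-< {e} {x ∷ xs} i with x ≟ e
    position-<              i         | yes _   = s≤s z≤n
    position-<              (here p)  | no x≢e = ⊥-elim (x≢e (sym p))
    position-<              (there i) | no _   = s≤s (position-< i)

    nthOr-position : ∀ {d e xs} → e ∈ xs → nthOr d xs (position e xs) ≡ e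
    nthOr-position {d} {e} {x ∷ xs} i with x ≟ e
    nthOr-position i         | yes p   = p
    nthOr-position (here p)  | no x≢e = ⊥-elim (x≢e (sym p))
    nthOr-position (there i) | no _   = nthOr-position i

    choose-position : ∀ {e x xs} → e ∈ x ∷ xs → choose x xs (position e (x ∷ xs)) ≡ e
    choose-position {e} {x} {xs} i = trans
      (cong (nthOr x (x ∷ xs)) (m<n⇒m%n≡m (position-< i)))
      (nthOr-position i)

  nthOr-∈ : ∀ {A : Set} {d : A} {ys} xs k → d ∈ ys → (∀ {y} → y ∈ xs → y ∈ ys) → nthOr d xs k ∈ ys
  nthOr-∈ []       k       d∈ sub = d∈
  nthOr-∈ (x ∷ xs) zero    d∈ sub = sub (here refl)
  nthOr-∈ (x ∷ xs) (suc k) d∈ sub = nthOr-∈ xs k d∈ (sub ∘ there)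

  choose-∈ : ∀ {A : Set} (x : A) xs k → choose x xs k ∈ x ∷ xs
  choose-∈ x xs k = nthOr-∈ (x ∷ xs) (k % suc (length xs)) (here refl) (λ i → i)

  module _ {n : ℕ} where

    _≟ₑ_ : DecidableEquality (Edge n)
    _≟ₑ_ = ≡-dec FinP._≟_ FinP._≟_

    _∈ₑ?_ : ∀ (e : Edge n) G → Dec (e ∈ G)
    _∈ₑ?_ = DecMem._∈?_ _≟ₑ_

    unused? : ∀ (M B : List (Edge n)) e → Dec (e ∉ M ++ B)
    unused? M B e = ¬? (e ∈ₑ? (M ++ B))

    free⁺ : ∀ {M B} {e : Edge n} → e ∈ allEdges n → e ∉ M → e ∉ B → e ∈ freeEdges M B
    free⁺ {M} {B} {e} e∈ ∉M ∉B = ∈P.∈-filter⁺ (unused? M B) e∈ ∉MB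
      where
      ∉MB : e ∉ M ++ B
      ∉MB i with ∈P.∈-++⁻ M i
      ... | inj₁ j = ∉M j
      ... | inj₂ j = ∉B j

    free⁻ : ∀ M B {e : Edge n} → e ∈ freeEdges M B → e ∈ allEdges n × e ∉ M × e ∉ B
    free⁻ M B i with ∈P.∈-filter⁻ (unused? M B) {xs = allEdges n} i
    ... | e∈ , ∉MB = e∈ , (∉MB ∘ ∈P.∈-++⁺ˡ) , (∉MB ∘ ∈P.∈-++⁺ʳ M)

    allEdges-unique : Unique (allEdges n)
    allEdges-unique = UP.filter⁺ (λ p → proj₁ p FinP.<? proj₂ p)
      (UP.cartesianProduct⁺ (UP.allFin⁺ n) (UP.allFin⁺ n))

    free-unique : ∀ M B → Unique (freeEdges {n} M B)
    free-unique M B = UP.filter⁺ (unused? M B) allEdges-unique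

    free-shrinks : ∀ M B M′ B′ {e : Edge n} → e ∈ freeEdges M B →
                   (∀ {x} → x ∈ M → x ∈ M′) → (∀ {x} → x ∈ B → x ∈ B′) → e ∈ M′ ⊎ e ∈ B′ →
                   suc (length (freeEdges M′ B′)) ≤ length (freeEdges M B)
    free-shrinks M B M′ B′ {e} e∈ M⊆ B⊆ used = unique-⊆⇒length≤ (unique-∷ e∉ (free-unique M′ B′)) sub
      where
      e∉ : e ∉ freeEdges M′ B′
      e∉ i = Sum.[ proj₁ (proj₂ (free⁻ M′ B′ i)) , proj₂ (proj₂ (free⁻ M′ B′ i)) ]′ used
      sub : ∀ {x} → x ∈ e ∷ freeEdges M′ B′ → x ∈ freeEdges M B
      sub (here refl) = e∈
      sub (there i) with free⁻ M′ B′ i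
      ... | x∈ , ∉M , ∉B = free⁺ x∈ (∉M ∘ M⊆) (∉B ∘ B⊆)

    -- Holds for arbitrary `M` and `B`, since repetitions only enlarge the right side. It shows that
    -- the board is not exhausted while Maker's budget lasts.
    free-lower : ∀ M B → length (allEdges n) ≤ length (freeEdges M B) + (length M + length B)
    free-lower M B = ℕP.≤-trans (unique-⊆⇒length≤ {ys = freeEdges M B ++ M ++ B} allEdges-unique sub)
      (ℕP.≤-reflexive (trans (LP.length-++ (freeEdges M B)) (cong (length (freeEdges M B) +_) (LP.length-++ M))))
      where
      sub : ∀ {x} → x ∈ allEdges n → x ∈ freeEdges M B ++ M ++ B
      sub {x} i with x ∈ₑ? (M ++ B)
      ... | yes j = ∈P.∈-++⁺ʳ (freeEdges M B) j
      ... | no ∉MB = ∈P.∈-++⁺ˡ (free⁺ i (∉MB ∘ ∈P.∈-++⁺ˡ) (∉MB ∘ ∈P.∈-++⁺ʳ M))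

    -- The orientation in which the board lists the edge. For `u` equal to `v` it is a loop, which
    -- is not on the board, so legality always needs `u ≢ v`.
    edge : Fin n → Fin n → Edge n
    edge u v with u FinP.<? v
    ... | yes _ = u , v
    ... | no _  = v , u

    edge-cases : ∀ u v → edge u v ≡ (u , v) ⊎ edge u v ≡ (v , u)
    edge-cases u v with u FinP.<? v
    ... | yes _ = inj₁ refl
    ... | no _  = inj₂ refl

    edge-∈ : ∀ {u v} → u ≢ v → edge u v ∈ allEdges n
    edge-∈ {u} {v} u≢v with u FinP.<? v
    ... | yes u<v = ∈P.∈-filter⁺ (λ p → proj₁ p FinP.<? proj₂ p)
                      (∈P.∈-cartesianProduct⁺ (∈P.∈-allFin u) (∈P.∈-allFin v)) u<v
    ... | no u≮v with FinP.<-cmp u v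
    ...   | tri< u<v _ _ = ⊥-elim (u≮v u<v)
    ...   | tri≈ _ u≡v _ = ⊥-elim (u≢v u≡v)
    ...   | tri> _ _ v<u = ∈P.∈-filter⁺ (λ p → proj₁ p FinP.<? proj₂ p)
                      (∈P.∈-cartesianProduct⁺ (∈P.∈-allFin v) (∈P.∈-allFin u)) v<u

    edge-injective : ∀ {u v u′ v′} → edge u v ≡ edge u′ v′ → (u ≡ u′ × v ≡ v′) ⊎ (u ≡ v′ × v ≡ u′)
    edge-injective {u} {v} {u′} {v′} eq with edge-cases u v | edge-cases u′ v′
    ... | inj₁ p | inj₁ q with refl ← trans (sym p) (trans eq q) = inj₁ (refl , refl)
    ... | inj₁ p | inj₂ q with refl ← trans (sym p) (trans eq q) = inj₂ (refl , refl)
    ... | inj₂ p | inj₁ q with refl ← trans (sym p) (trans eq q) = inj₂ (refl , refl)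
    ... | inj₂ p | inj₂ q with refl ← trans (sym p) (trans eq q) = inj₁ (refl , refl)

    edge-adj : ∀ {G u v} → edge u v ∈ G → Adj G u v
    edge-adj {G} {u} {v} i with edge-cases u v
    ... | inj₁ p = inj₁ (subst (_∈ G) p i)
    ... | inj₂ p = inj₂ (subst (_∈ G) p i)

    adj-sym : ∀ {G : List (Edge n)} {u v} → Adj G u v → Adj G v u
    adj-sym (inj₁ i) = inj₂ i
    adj-sym (inj₂ i) = inj₁ i

    adj-mono : ∀ {G H : List (Edge n)} → (∀ {e} → e ∈ G → e ∈ H) → ∀ {u v} → Adj G u v → Adj H u v
    adj-mono s (inj₁ i) = inj₁ (s i)
    adj-mono s (inj₂ i) = inj₂ (s i)

  module _ (n : ℕ) where

    private
      E = allEdges n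
      diagonal : List (Edge n)
      diagonal = map (λ v → v , v) (allFin n)
      split = E ++ map swap E ++ diagonal

      length-split : length split ≡ length E + (length E + n)
      length-split = begin
        length split                                          ≡⟨ LP.length-++ E ⟩
        length E + length (map swap E ++ diagonal)            ≡⟨ cong (length E +_) (LP.length-++ (map swap E)) ⟩
        length E + (length (map swap E) + length diagonal)    ≡⟨ cong₂ (λ a c → length E + (a + c)) (LP.length-map swap E)
                                                                   (trans (LP.length-map _ (allFin n)) (LP.length-tabulate {n = n} (λ i → i))) ⟩
        length E + (length E + n)                             ∎
        where open ≡-Reasoning

      length-pairs : length (cartesianProduct (allFin n) (allFin n)) ≡ n * n
      length-pairs = trans (length-cartesianProductWith _,_ (allFin n) (allFin n))
        (cong₂ _*_ (LP.length-tabulate {n = n} (λ i → i)) (LP.length-tabulate {n = n} (λ i → i)))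

      <-of : ∀ {u v} → (u , v) ∈ E → u Data.Fin.< v
      <-of i = proj₂ (∈P.∈-filter⁻ (λ p → proj₁ p FinP.<? proj₂ p) {xs = cartesianProduct (allFin n) (allFin n)} i)

    -- An ordered pair is an edge, a reversed edge or on the diagonal. The additive form avoids
    -- halving `n * (n ∸ 1)`.
    edge-count-lower : n * n ≤ length (allEdges n) + (length (allEdges n) + n)
    edge-count-lower = subst₂ _≤_ length-pairs length-split
      (unique-⊆⇒length≤ (UP.cartesianProduct⁺ (UP.allFin⁺ n) (UP.allFin⁺ n)) (λ {p} _ → cover p))
      where
      cover : ∀ p → p ∈ split
      cover (u , v) with FinP.<-cmp u v
      ... | tri< u<v _ _ = ∈P.∈-++⁺ˡ (∈P.∈-filter⁺ _ (∈P.∈-cartesianProduct⁺ (∈P.∈-allFin u) (∈P.∈-allFin v)) u<v)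
      ... | tri≈ _ refl _ = ∈P.∈-++⁺ʳ E (∈P.∈-++⁺ʳ (map swap E) (∈P.∈-map⁺ _ (∈P.∈-allFin u)))
      ... | tri> _ _ v<u = ∈P.∈-++⁺ʳ E (∈P.∈-++⁺ˡ (∈P.∈-map⁺ swap
                             (∈P.∈-filter⁺ _ (∈P.∈-cartesianProduct⁺ (∈P.∈-allFin v) (∈P.∈-allFin u)) v<u)))

    edge-count-upper : length (allEdges n) + (length (allEdges n) + n) ≤ n * n
    edge-count-upper = subst₂ _≤_ length-split length-pairs
      (unique-⊆⇒length≤ {ys = cartesianProduct (allFin n) (allFin n)} unique-split
        (λ {p} _ → ∈P.∈-cartesianProduct⁺ (∈P.∈-allFin (proj₁ p)) (∈P.∈-allFin (proj₂ p))))
      where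
      unique-split : Unique split
      unique-split = UP.++⁺ allEdges-unique
        (UP.++⁺ (UP.map⁺ (λ { refl → refl }) allEdges-unique) (UP.map⁺ (λ { refl → refl }) (UP.allFin⁺ n)) disj₂) disj₁
        where
        disj₂ : ∀ {p} → ¬ (p ∈ map swap E × p ∈ diagonal)
        disj₂ (i , j) with ∈P.∈-map⁻ swap i | ∈P.∈-map⁻ _ j
        ... | _ , k , refl | _ , _ , refl = FinP.<-irrefl refl (<-of k)
        disj₁ : ∀ {p} → ¬ (p ∈ E × p ∈ map swap E ++ diagonal)
        disj₁ (i , j) with ∈P.∈-++⁻ (map swap E) j
        ... | inj₁ k with ∈P.∈-map⁻ swap k
        ...   | _ , l , refl = FinP.<-asym (<-of i) (<-of l)
        disj₁ (i , j) | inj₂ k with ∈P.∈-map⁻ _ k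
        ...   | _ , _ , refl = FinP.<-irrefl refl (<-of i)

open Edges

-- The supermartingale for sets of edges occupied by Breaker.

module Potential where

  open import Data.Rational using (_≤_; _+_; _*_; _-_; _/_)
  open import Data.Rational.Solver using (module +-*-Solver)

  infixr 8 _^ℚ_
  _^ℚ_ : ℚ → ℕ → ℚ
  q ^ℚ zero  = 1ℚ
  q ^ℚ suc k = q * q ^ℚ k

  module _ {n : ℕ} where

    weight : List (Edge n) → ℚ → Edge n → ℚ
    weight B q e with e ∈ₑ? B
    ... | yes _ = 1ℚ
    ... | no _  = q

    -- An estimate, as if edges were independent, of the probability that Breaker will own all of
    -- `X`. Maker's edges do not enter: one of them in `X` would make the true probability 0, but it
    -- keeps the factor `q`.
    Ψ : List (Edge n) → ℚ → List (Edge n) → ℚ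
    Ψ B q []      = 1ℚ
    Ψ B q (e ∷ X) = weight B q e * Ψ B q X

    weight-∈ : ∀ {B q e} → e ∈ B → weight B q e ≡ 1ℚ
    weight-∈ {B} {q} {e} i with e ∈ₑ? B
    ... | yes _ = refl
    ... | no e∉ = ⊥-elim (e∉ i)

    weight-∉ : ∀ {B q e} → e ∉ B → weight B q e ≡ q
    weight-∉ {B} {q} {e} e∉ with e ∈ₑ? B
    ... | yes i = ⊥-elim (e∉ i)
    ... | no _  = refl

    weight-mono : ∀ B {p q} e → p ≤ q → weight B p e ≤ weight B q e
    weight-mono B e p≤q with e ∈ₑ? B
    ... | yes _ = ℚP.≤-refl
    ... | no _  = p≤q

    0≤weight : ∀ B {q} e → 0ℚ ≤ q → 0ℚ ≤ weight B q e
    0≤weight B e 0≤q with e ∈ₑ? B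
    ... | yes _ = ℚP.<⇒≤ 0<1ℚ
    ... | no _  = 0≤q

    0≤Ψ : ∀ B {q} X → 0ℚ ≤ q → 0ℚ ≤ Ψ B q X
    0≤Ψ B []      0≤q = ℚP.<⇒≤ 0<1ℚ
    0≤Ψ B (e ∷ X) 0≤q = 0≤* (0≤weight B e 0≤q) (0≤Ψ B X 0≤q)

    Ψ-mono : ∀ B {p q} X → 0ℚ ≤ p → p ≤ q → Ψ B p X ≤ Ψ B q X
    Ψ-mono B []      0≤p p≤q = ℚP.≤-refl
    Ψ-mono B (e ∷ X) 0≤p p≤q =
      *-mono (0≤weight B e 0≤p) (0≤Ψ B X (ℚP.≤-trans 0≤p p≤q)) (weight-mono B e p≤q) (Ψ-mono B X 0≤p p≤q)

    Ψ-claimed : ∀ {B q} X → (∀ {e} → e ∈ X → e ∈ B) → Ψ B q X ≡ 1ℚ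
    Ψ-claimed []      h = refl
    Ψ-claimed (e ∷ X) h = trans (cong₂ _*_ (weight-∈ (h (here refl))) (Ψ-claimed X (h ∘ there))) (ℚP.*-identityˡ 1ℚ)

    Ψ-empty : ∀ q X → Ψ [] q X ≡ q ^ℚ length X
    Ψ-empty q []      = refl
    Ψ-empty q (e ∷ X) = cong₂ _*_ (weight-∉ {[]} {q} {e} λ ()) (Ψ-empty q X)

    Ψ-∷ʳ : ∀ B q {x} X → x ∉ X → Ψ (B ++ [ x ]) q X ≡ Ψ B q X
    Ψ-∷ʳ B q []      x∉ = refl
    Ψ-∷ʳ B q {x} (e ∷ X) x∉ = cong₂ _*_ same (Ψ-∷ʳ B q X (x∉ ∘ there))
      where
      same : weight (B ++ [ x ]) q e ≡ weight B q e
      same with e ∈ₑ? B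
      ... | yes i = weight-∈ (∈P.∈-++⁺ˡ i)
      ... | no e∉ = weight-∉ e∉′
        where
        e∉′ : e ∉ B ++ [ x ]
        e∉′ i with ∈P.∈-++⁻ B i
        ... | inj₁ j           = e∉ j
        ... | inj₂ (here refl) = x∉ (here refl)

    -- Only an inequality: `x` may be an edge of Maker, and then it is not among the free edges `F`.
    Sum-indicator≤1 : ∀ (x : Edge n) {F} → Unique F → Sum (λ e → indicator (e ≟ₑ x)) F ≤ 1ℚ
    Sum-indicator≤1 x {[]}    u = ℚP.<⇒≤ 0<1ℚ
    Sum-indicator≤1 x {y ∷ F} u@(_ ∷ u′) with y ≟ₑ x
    ... | no _     = subst (_≤ 1ℚ) (sym (ℚP.+-identityˡ _)) (Sum-indicator≤1 x u′)
    ... | yes refl = ℚP.≤-reflexive (trans (cong (1ℚ +_) (zeros F (unique-head u))) (ℚP.+-identityʳ 1ℚ))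
      where
      zeros : ∀ G → x ∉ G → Sum (λ e → indicator (e ≟ₑ x)) G ≡ 0ℚ
      zeros []      x∉ = refl
      zeros (z ∷ G) x∉ with z ≟ₑ x
      ... | yes refl = ⊥-elim (x∉ (here refl))
      ... | no _     = trans (ℚP.+-identityˡ _) (zeros G (x∉ ∘ there))

    module _ (B F : List (Edge n)) (uF : Unique F) {p q : ℚ} (0≤p : 0ℚ ≤ p) (p≤1 : p ≤ 1ℚ) (p≤q : p ≤ q)
             -- The claim for a single edge, cleared of the denominator: one of the picks raises its
             -- factor from `p` to 1, and the average must stay below `q`.
             (step : ι (length F) * p + (1ℚ - p) ≤ ι (length F) * q) where

      private
        f = ι (length F)
        0≤q = ℚP.≤-trans 0≤p p≤q

      -- The factors of Ψ are negatively correlated: one pick of Breaker raises at most one of them.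
      Ψ-step : ∀ X → Unique X → Sum (λ e → Ψ (B ++ [ e ]) p X) F ≤ f * Ψ B q X
      Ψ-step [] _ = ℚP.≤-reflexive (Sum-const 1ℚ F)
      Ψ-step (x ∷ X) u@(_ ∷ u′) with x ∈ₑ? B
      ... | yes x∈B = begin
        Sum (λ e → Ψ (B ++ [ e ]) p (x ∷ X)) F ≡⟨ Sum-cong F (λ e _ → trans (cong (_* Ψ (B ++ [ e ]) p X) (weight-∈ (∈P.∈-++⁺ˡ x∈B))) (ℚP.*-identityˡ _)) ⟩
        Sum (λ e → Ψ (B ++ [ e ]) p X) F       ≤⟨ Ψ-step X u′ ⟩
        f * Ψ B q X                            ≡⟨ cong (f *_) (ℚP.*-identityˡ _) ⟨
        f * (1ℚ * Ψ B q X)                     ∎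
        where open ℚP.≤-Reasoning
      ... | no x∉B = begin
        Sum (λ e → Ψ (B ++ [ e ]) p (x ∷ X)) F
          ≤⟨ Sum-mono F (λ e _ → split e) ⟩
        Sum (λ e → p * Ψ (B ++ [ e ]) p X + c * indicator (e ≟ₑ x)) F
          ≡⟨ trans (Sum-+ _ _ F) (cong₂ _+_ (Sum-* p _ F) (Sum-* c _ F)) ⟩
        p * Sum (λ e → Ψ (B ++ [ e ]) p X) F + c * Sum (λ e → indicator (e ≟ₑ x)) F
          ≤⟨ ℚP.+-mono-≤ (*-monoˡ 0≤p (Ψ-step X u′)) (*-monoˡ 0≤c (Sum-indicator≤1 x uF)) ⟩
        p * (f * Y) + c * 1ℚ
          ≡⟨ solve 3 (λ p f y → p :* (f :* y) :+ (con 1ℚ :- p) :* y :* con 1ℚ := (f :* p :+ (con 1ℚ :- p)) :* y) refl p f Y ⟩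
        (f * p + (1ℚ - p)) * Y
          ≤⟨ *-monoʳ 0≤Y step ⟩
        f * q * Y
          ≡⟨ ℚP.*-assoc f q Y ⟩
        f * (q * Y) ∎
        where
        open ℚP.≤-Reasoning
        open +-*-Solver
        Y = Ψ B q X
        0≤Y : 0ℚ ≤ Y
        0≤Y = 0≤Ψ B X 0≤q
        c = (1ℚ - p) * Y
        0≤c : 0ℚ ≤ c
        0≤c = 0≤* (diff-≥0 p≤1) 0≤Y
        -- The excess of the first factor over `p` is charged to the pick `x` alone. As `x` is not
        -- in `X`, this pick leaves the other factors as they were, so `Y` bounds their product.
        split : ∀ e → Ψ (B ++ [ e ]) p (x ∷ X) ≤ p * Ψ (B ++ [ e ]) p X + c * indicator (e ≟ₑ x)
        split e with e ≟ₑ x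
        ... | yes refl = begin
          weight (B ++ [ x ]) p x * Z ≡⟨ cong (_* Z) (weight-∈ (∈P.∈-++⁺ʳ B (here refl))) ⟩
          1ℚ * Z                      ≡⟨ solve 2 (λ p z → con 1ℚ :* z := p :* z :+ (con 1ℚ :- p) :* z :* con 1ℚ) refl p Z ⟩
          p * Z + (1ℚ - p) * Z * 1ℚ   ≤⟨ ℚP.+-monoʳ-≤ (p * Z) (*-monoʳ (ℚP.<⇒≤ 0<1ℚ) (*-monoˡ (diff-≥0 p≤1) Z≤Y)) ⟩
          p * Z + c * 1ℚ              ∎
          where
          Z = Ψ (B ++ [ x ]) p X
          Z≤Y : Z ≤ Y
          Z≤Y = subst (_≤ Y) (sym (Ψ-∷ʳ B p X (unique-head u))) (Ψ-mono B X 0≤p p≤q)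
        ... | no e≢x = ℚP.≤-reflexive (trans
          (cong (_* Ψ (B ++ [ e ]) p X) (weight-∉ x∉))
          (trans (sym (ℚP.+-identityʳ _)) (cong (p * Ψ (B ++ [ e ]) p X +_) (sym (ℚP.*-zeroʳ c)))))
          where
          x∉ : x ∉ B ++ [ e ]
          x∉ i with ∈P.∈-++⁻ B i
          ... | inj₁ j           = x∉B j
          ... | inj₂ (here refl) = e≢x refl

    ΣΨ : List (List (Edge n)) → List (Edge n) → ℚ → ℚ
    ΣΨ 𝓕 B q = Sum (Ψ B q) 𝓕

    0≤ΣΨ : ∀ 𝓕 B {q} → 0ℚ ≤ q → 0ℚ ≤ ΣΨ 𝓕 B q
    0≤ΣΨ 𝓕 B 0≤q = Sum-≥0 𝓕 (λ X _ → 0≤Ψ B X 0≤q)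

    1≤ΣΨ : ∀ {𝓕 B q X} → 0ℚ ≤ q → X ∈ 𝓕 → (∀ {e} → e ∈ X → e ∈ B) → 1ℚ ≤ ΣΨ 𝓕 B q
    1≤ΣΨ {𝓕} {B} {q} {X} 0≤q i h = subst (_≤ ΣΨ 𝓕 B q) (Ψ-claimed X h) (∈⇒≤Sum (λ Y → 0≤Ψ B Y 0≤q) i)

  -- The probability that an edge is among the next k of l + 1 + k equally likely edges.
  opaque
    odds : ℕ → ℕ → ℚ
    odds l k = (ℤ.+ k) / suc (l ℕ.+ k)

    odds-* : ∀ l k → odds l k * ι (suc (l ℕ.+ k)) ≡ ι k
    odds-* l k = ratio-*-ι k (l ℕ.+ k)

    0≤odds : ∀ l k → 0ℚ ≤ odds l k
    0≤odds l k = subst (_≤ odds l k) (ℚP.0/n≡0 (suc (l ℕ.+ k))) (/-mono {ℤ.+ 0} {ℤ.+ k} {l ℕ.+ k} (ℤ.+≤+ z≤n))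

  odds-≤ : ∀ l k {c} → ι k ≤ c * ι (suc (l ℕ.+ k)) → odds l k ≤ c
  odds-≤ l k {c} h = *-cancelˡ (0<ι (l ℕ.+ k)) (subst₂ _≤_
    (trans (sym (odds-* l k)) (ℚP.*-comm (odds l k) _)) (ℚP.*-comm c _) h)

  odds≤1 : ∀ l k → odds l k ≤ 1ℚ
  odds≤1 l k = odds-≤ l k (subst (ι k ≤_) (sym (ℚP.*-identityˡ _)) (ι-mono (ℕP.≤-trans (ℕP.m≤n+m k l) (ℕP.n≤1+n _))))

  odds-mono : ∀ l k → odds l k ≤ odds l (suc k)
  odds-mono l k = odds-≤ l k (*-cancelˡ (0<ι (l ℕ.+ suc k)) (begin
    ι (suc (l ℕ.+ suc k)) * ι k                          ≡⟨ ι-* (suc (l ℕ.+ suc k)) k ⟨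
    ι (suc (l ℕ.+ suc k) ℕ.* k)                          ≤⟨ ι-mono nat ⟩
    ι (suc k ℕ.* suc (l ℕ.+ k))                          ≡⟨ ι-* (suc k) _ ⟩
    ι (suc k) * ι (suc (l ℕ.+ k))                        ≡⟨ cong (_* ι (suc (l ℕ.+ k))) (odds-* l (suc k)) ⟨
    odds l (suc k) * ι (suc (l ℕ.+ suc k)) * ι (suc (l ℕ.+ k)) ≡⟨ solve 3 (λ a b c → a :* b :* c := b :* (a :* c)) refl (odds l (suc k)) (ι (suc (l ℕ.+ suc k))) (ι (suc (l ℕ.+ k))) ⟩
    ι (suc (l ℕ.+ suc k)) * (odds l (suc k) * ι (suc (l ℕ.+ k))) ∎))
    where
    open ℚP.≤-Reasoning
    open +-*-Solver
    nat : suc (l ℕ.+ suc k) ℕ.* k ℕ.≤ suc k ℕ.* suc (l ℕ.+ k)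
    nat = ℕP.≤-trans (ℕP.m≤m+n _ (suc l)) (ℕP.≤-reflexive (S.solve 2 (λ l k →
        (S.con 1 S.:+ (l S.:+ (S.con 1 S.:+ k))) S.:* k S.:+ (S.con 1 S.:+ l) S.:= (S.con 1 S.:+ k) S.:* (S.con 1 S.:+ (l S.:+ k))) refl l k))
      where module S = ℕS.+-*-Solver

  -- With exactly `l + 2 + k` free edges both sides equal `k + 1`. Each further free edge adds
  -- `odds l k` on the left and the larger `odds l (suc k)` on the right.
  odds-step : ∀ l k {f} → suc (l ℕ.+ suc k) ℕ.≤ f → ι f * odds l k + (1ℚ - odds l k) ≤ ι f * odds l (suc k)
  odds-step l k {f} h = begin
    ι f * p + (1ℚ - p)                ≡⟨ cong (λ x → x * p + (1ℚ - p)) f≡ ⟩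
    (1ℚ + D + g) * p + (1ℚ - p)       ≡⟨ solve 3 (λ D g p → (con 1ℚ :+ D :+ g) :* p :+ (con 1ℚ :- p) := con 1ℚ :+ p :* D :+ g :* p) refl D g p ⟩
    1ℚ + p * D + g * p                ≡⟨ cong (λ x → 1ℚ + x + g * p) (odds-* l k) ⟩
    1ℚ + ι k + g * p                  ≡⟨ cong (_+ g * p) (ι-suc k) ⟨
    ι (suc k) + g * p                 ≤⟨ ℚP.+-monoʳ-≤ (ι (suc k)) (*-monoˡ (0≤ι _) (odds-mono l k)) ⟩
    ι (suc k) + g * q                 ≡⟨ cong (_+ g * q) (trans (sym (odds-* l (suc k))) (cong (q *_) D+1)) ⟩
    q * (1ℚ + D) + g * q              ≡⟨ solve 3 (λ D g q → q :* (con 1ℚ :+ D) :+ g :* q := (con 1ℚ :+ D :+ g) :* q) refl D g q ⟩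
    (1ℚ + D + g) * q                  ≡⟨ cong (_* q) f≡ ⟨
    ι f * q                           ∎
    where
    open ℚP.≤-Reasoning
    open +-*-Solver
    p = odds l k
    q = odds l (suc k)
    D = ι (suc (l ℕ.+ k))
    g = ι (f ℕ.∸ suc (l ℕ.+ suc k))
    D+1 : ι (suc (l ℕ.+ suc k)) ≡ 1ℚ + D
    D+1 = trans (cong (ι ∘ suc) (ℕP.+-suc l k)) (ι-suc _)
    f≡ : ι f ≡ 1ℚ + D + g
    f≡ = trans (cong ι (sym (ℕP.m+[n∸m]≡n h))) (trans (ι-+ (suc (l ℕ.+ suc k)) _) (cong (_+ g) D+1))

  module _ {n} (𝓕 : List (List (Edge n))) (unique-𝓕 : ∀ {X} → X ∈ 𝓕 → Unique X) where

    ΣΨ-step : ∀ {B F : List (Edge n)} l k → Unique F → suc (l ℕ.+ suc k) ℕ.≤ length F →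
              Sum (λ e → ΣΨ 𝓕 (B ++ [ e ]) (odds l k)) F ≤ ι (length F) * ΣΨ 𝓕 B (odds l (suc k))
    ΣΨ-step {B} {F} l k uF h = begin
      Sum (λ e → Sum (Ψ (B ++ [ e ]) (odds l k)) 𝓕) F  ≡⟨ Sum-swap (λ e → Ψ (B ++ [ e ]) (odds l k)) F 𝓕 ⟩
      Sum (λ X → Sum (λ e → Ψ (B ++ [ e ]) (odds l k) X) F) 𝓕
        ≤⟨ Sum-mono 𝓕 (λ X i → Ψ-step B F uF (0≤odds l k) (odds≤1 l k) (odds-mono l k) (odds-step l k h) X (unique-𝓕 i)) ⟩
      Sum (λ X → ι (length F) * Ψ B (odds l (suc k)) X) 𝓕  ≡⟨ Sum-* (ι (length F)) _ 𝓕 ⟩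
      ι (length F) * ΣΨ 𝓕 B (odds l (suc k)) ∎
      where open ℚP.≤-Reasoning

open Potential

-- Decidability of the graph properties, and their implications and edge counts.

module Graphs where

  open import Data.Nat using (_≤_; _+_; _*_; _^_)

  module _ {A : Set} where

    lastOr-∈ : ∀ (x : A) xs → lastOr x xs ∈ x ∷ xs
    lastOr-∈ x []       = here refl
    lastOr-∈ x (y ∷ ys) = there (lastOr-∈ y ys)

    lastOr-++ : ∀ (x : A) xs {y ys} → lastOr x (xs ++ y ∷ ys) ≡ lastOr y ys
    lastOr-++ x []       = refl
    lastOr-++ x (z ∷ xs) = lastOr-++ z xs

    module _ {R : A → A → Set} where

      linked-++⁻ˡ : ∀ xs {ys} → Linked R (xs ++ ys) → Linked R xs
      linked-++⁻ˡ []           l       = []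
      linked-++⁻ˡ (x ∷ [])     l       = [-]
      linked-++⁻ˡ (x ∷ y ∷ xs) (r ∷ l) = r ∷ linked-++⁻ˡ (y ∷ xs) l

      linked-++⁻ʳ : ∀ xs {ys} → Linked R (xs ++ ys) → Linked R ys
      linked-++⁻ʳ []       l = l
      linked-++⁻ʳ (x ∷ xs) l = linked-++⁻ʳ xs (Linked.tail l)

      linked-junction : ∀ x xs {y ys} → Linked R (x ∷ xs ++ y ∷ ys) → R (lastOr x xs) y
      linked-junction x []       (r ∷ _) = r
      linked-junction x (z ∷ xs) (_ ∷ l) = linked-junction z xs l

      linked-++ : ∀ x xs {y ys} → Linked R (x ∷ xs) → R (lastOr x xs) y → Linked R (y ∷ ys) →
                  Linked R (x ∷ xs ++ y ∷ ys)
      linked-++ x []       _        r l′ = r ∷ l′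
      linked-++ x (z ∷ xs) (r′ ∷ l) r l′ = r′ ∷ linked-++ z xs l r l′

    unique-disjoint : ∀ (xs : List A) {ys x} → Unique (xs ++ ys) → x ∈ xs → x ∉ ys
    unique-disjoint (x ∷ xs) u         (here refl) j = unique-head u (∈P.∈-++⁺ʳ xs j)
    unique-disjoint (x ∷ xs) (_ ∷ u)   (there i)   j = unique-disjoint xs u i j

  module _ {n : ℕ} where

    private
      infix 4 _∈ᵥ?_
      _∈ᵥ?_ : ∀ (v : Fin n) c → Dec (v ∈ c)
      _∈ᵥ?_ = DecMem._∈?_ FinP._≟_

    length-allFin : length (allFin n) ≡ n
    length-allFin = LP.length-tabulate {n = n} (λ i → i)

    unique⇒length≤ : ∀ {c : List (Fin n)} → Unique c → length c ≤ n
    unique⇒length≤ {c} u = subst (length c ≤_) length-allFin (unique-⊆⇒length≤ u (λ {v} _ → ∈P.∈-allFin v))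

    covering⇒length≥ : ∀ {c : List (Fin n)} → (∀ v → v ∈ c) → n ≤ length c
    covering⇒length≥ {c} h = subst (_≤ length c) length-allFin (unique-⊆⇒length≤ (UP.allFin⁺ n) (λ {v} _ → h v))

    -- Serves twice: as the search space for Hamilton cycles and as the index set of the union
    -- bound, where the number of its entries matters.
    lists≤ : ℕ → List (List (Fin n))
    lists≤ zero    = [ [] ]
    lists≤ (suc k) = [] ∷ cartesianProductWith _∷_ (allFin n) (lists≤ k)

    ∈-lists≤ : ∀ {k} c → length c ≤ k → c ∈ lists≤ k
    ∈-lists≤ {zero}  []      _        = here refl
    ∈-lists≤ {suc k} []      _        = here refl
    ∈-lists≤ {suc k} (v ∷ c) (s≤s le) = there (∈P.∈-cartesianProductWith⁺ _∷_ (∈P.∈-allFin v) (∈-lists≤ c le))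

    length-lists≤ : ∀ k → length (lists≤ k) ≤ suc n ^ k
    length-lists≤ zero    = ℕP.≤-refl
    length-lists≤ (suc k) = begin
      suc (length (cartesianProductWith _∷_ (allFin n) (lists≤ k)))
                                       ≡⟨ cong suc (trans (length-cartesianProductWith _∷_ (allFin n) (lists≤ k)) (cong (_* length (lists≤ k)) length-allFin)) ⟩
      suc (n * length (lists≤ k))      ≤⟨ ℕP.+-mono-≤ (ℕP.m^n>0 (suc n) k) (ℕP.*-monoʳ-≤ n (length-lists≤ k)) ⟩
      suc n ^ k + n * suc n ^ k        ∎
      where open ℕP.≤-Reasoning

    adj? : ∀ (G : List (Edge n)) u v → Dec (Adj G u v)
    adj? G u v = ((u , v) ∈ₑ? G) ⊎-dec ((v , u) ∈ₑ? G)

    closes? : ∀ (G : List (Edge n)) c → Dec (Closes G c)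
    closes? G []      = no λ ()
    closes? G (x ∷ c) = adj? G (lastOr x c) x

    -- A cycle has no repetitions, so it is among the finitely many lists of at most `n` vertices.
    hamiltonian? : ∀ (G : List (Edge n)) → Dec (Hamiltonian G)
    hamiltonian? G = map′ from to (Any.any? cycle? (lists≤ n))
      where
      IsCycle : List (Fin n) → Set
      IsCycle c = 3 ≤ n × ((v : Fin n) → v ∈ c) × Unique c × Linked (Adj G) c × Closes G c
      cycle? : ∀ c → Dec (IsCycle c)
      cycle? c = (3 ℕ.≤? n) ×-dec FinP.all? (_∈ᵥ? c) ×-dec unique? FinP._≟_ c ×-dec
                 Linked.linked? (adj? G) c ×-dec closes? G c
      from : Any IsCycle (lists≤ n) → Hamiltonian G
      from a with find a
      ... | c , _ , h = c , h
      to : Hamiltonian G → Any IsCycle (lists≤ n)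
      to (c , h@(_ , _ , u , _)) = lose (∈-lists≤ c (unique⇒length≤ u)) h

    hamiltonian-mono : ∀ {G H : List (Edge n)} → (∀ {e} → e ∈ G → e ∈ H) → Hamiltonian G → Hamiltonian H
    hamiltonian-mono s (c , 3≤n , cov , u , l , cl) = c , 3≤n , cov , u , Linked.map (adj-mono s) l , closes c cl
      where
      closes : ∀ c → Closes _ c → Closes _ c
      closes (x ∷ c) = adj-mono s

    minDeg2? : ∀ (G : List (Edge n)) → Dec (MinDeg2 G)
    minDeg2? G = FinP.all? λ v → FinP.any? λ u → FinP.any? λ w →
      ¬? (u FinP.≟ w) ×-dec adj? G v u ×-dec adj? G v w

    reach-trans : ∀ {G : List (Edge n)} {u v w} → Reach G u v → Reach G v w → Reach G u w
    reach-trans p Reach.here       = p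
    reach-trans p (Reach.step q a) = Reach.step (reach-trans p q) a

    reach-sym : ∀ {G : List (Edge n)} {u v} → Reach G u v → Reach G v u
    reach-sym Reach.here       = Reach.here
    reach-sym (Reach.step p a) = reach-trans (Reach.step Reach.here (adj-sym a)) (reach-sym p)

    reach-mono : ∀ {G H : List (Edge n)} → (∀ {e} → e ∈ G → e ∈ H) → ∀ {u v} → Reach G u v → Reach H u v
    reach-mono s Reach.here       = Reach.here
    reach-mono s (Reach.step p a) = Reach.step (reach-mono s p) (adj-mono s a)

    -- One crossing of the new edge is enough: a walk that crosses it back has returned to an end
    -- that it had already reached without it. This gives the recursion that decides reachability.
    reach-∷⁻ : ∀ {G : List (Edge n)} {a b u v} → Reach ((a , b) ∷ G) u v →
               Reach G u v ⊎ (Reach G u a × Reach G b v) ⊎ (Reach G u b × Reach G a v)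
    reach-∷⁻ Reach.here = inj₁ Reach.here
    reach-∷⁻ {G} {a} {b} {u} (Reach.step {v} {w} p x) = extend (reach-∷⁻ p) (split x)
      where
      split : Adj ((a , b) ∷ G) v w → Adj G v w ⊎ (v ≡ a × w ≡ b) ⊎ (v ≡ b × w ≡ a)
      split (inj₁ (here refl)) = inj₂ (inj₁ (refl , refl))
      split (inj₁ (there i))   = inj₁ (inj₁ i)
      split (inj₂ (here refl)) = inj₂ (inj₂ (refl , refl))
      split (inj₂ (there i))   = inj₁ (inj₂ i)
      extend : Reach G u v ⊎ (Reach G u a × Reach G b v) ⊎ (Reach G u b × Reach G a v) →
               Adj G v w ⊎ (v ≡ a × w ≡ b) ⊎ (v ≡ b × w ≡ a) →
               Reach G u w ⊎ (Reach G u a × Reach G b w) ⊎ (Reach G u b × Reach G a w)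
      extend (inj₁ q)              (inj₁ y)                    = inj₁ (Reach.step q y)
      extend (inj₂ (inj₁ (q , r))) (inj₁ y)                    = inj₂ (inj₁ (q , Reach.step r y))
      extend (inj₂ (inj₂ (q , r))) (inj₁ y)                    = inj₂ (inj₂ (q , Reach.step r y))
      extend (inj₁ q)              (inj₂ (inj₁ (refl , refl))) = inj₂ (inj₁ (q , Reach.here))
      extend (inj₂ (inj₁ (q , _))) (inj₂ (inj₁ (refl , refl))) = inj₂ (inj₁ (q , Reach.here))
      extend (inj₂ (inj₂ (q , _))) (inj₂ (inj₁ (refl , refl))) = inj₁ q
      extend (inj₁ q)              (inj₂ (inj₂ (refl , refl))) = inj₂ (inj₂ (q , Reach.here))
      extend (inj₂ (inj₁ (q , _))) (inj₂ (inj₂ (refl , refl))) = inj₁ q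
      extend (inj₂ (inj₂ (q , _))) (inj₂ (inj₂ (refl , refl))) = inj₂ (inj₂ (q , Reach.here))

    reach? : ∀ (G : List (Edge n)) u v → Dec (Reach G u v)
    reach? [] u v = map′ (λ { refl → Reach.here }) from (u FinP.≟ v)
      where
      from : Reach [] u v → u ≡ v
      from Reach.here = refl
      from (Reach.step _ (inj₁ ()))
      from (Reach.step _ (inj₂ ()))
    reach? ((a , b) ∷ G) u v = map′ to reach-∷⁻
      (reach? G u v ⊎-dec (reach? G u a ×-dec reach? G b v) ⊎-dec (reach? G u b ×-dec reach? G a v))
      where
      to : Reach G u v ⊎ (Reach G u a × Reach G b v) ⊎ (Reach G u b × Reach G a v) → Reach ((a , b) ∷ G) u v
      to (inj₁ p)              = reach-mono there p
      to (inj₂ (inj₁ (p , q))) = reach-trans (Reach.step (reach-mono there p) (inj₁ (here refl))) (reach-mono there q)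
      to (inj₂ (inj₂ (p , q))) = reach-trans (Reach.step (reach-mono there p) (inj₂ (here refl))) (reach-mono there q)

    connected? : ∀ (G : List (Edge n)) → Dec (Connected G)
    connected? G = FinP.all? λ u → FinP.all? λ v → reach? G u v

    linked⇒reach : ∀ {G : List (Edge n)} {x c} → Linked (Adj G) (x ∷ c) → ∀ {v} → v ∈ x ∷ c → Reach G x v
    linked⇒reach l       (here refl) = Reach.here
    linked⇒reach (a ∷ l) (there i)   = reach-trans (Reach.step Reach.here a) (linked⇒reach l i)

    hamiltonian⇒connected : ∀ {G : List (Edge n)} → Hamiltonian G → Connected G
    hamiltonian⇒connected (x ∷ c , _ , cov , _ , l , _) u v =
      reach-trans (reach-sym (linked⇒reach l (cov u))) (linked⇒reach l (cov v))

    -- The two neighbours on the cycle. At either end of the list one of them comes from the closing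
    -- edge, and the two differ because the cycle has at least three vertices.
    hamiltonian⇒minDeg2 : ∀ {G : List (Edge n)} → Hamiltonian G → MinDeg2 G
    hamiltonian⇒minDeg2 {G} (c , 3≤n , cov , u , l , cl) v with ∈P.∈-∃++ (cov v)
    ... | pre , post , refl = neighbours pre post u l cl (ℕP.≤-trans 3≤n (covering⇒length≥ cov))
      where
      neighbours : ∀ pre post → Unique (pre ++ v ∷ post) → Linked (Adj G) (pre ++ v ∷ post) →
        Closes G (pre ++ v ∷ post) → 3 ≤ length (pre ++ v ∷ post) →
        Σ (Fin n) λ u → Σ (Fin n) λ w → u ≢ w × Adj G v u × Adj G v w
      neighbours [] (p ∷ q ∷ r) (_ ∷ u) (a ∷ _) cl _ =
        p , lastOr q r , (λ eq → unique-head u (subst (_∈ q ∷ r) (sym eq) (lastOr-∈ q r))) , a , adj-sym cl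
      neighbours [] (p ∷ []) _ _ _ (s≤s (s≤s ()))
      neighbours [] [] _ _ _ (s≤s ())
      neighbours (x ∷ []) [] _ _ _ (s≤s (s≤s ()))
      neighbours (x ∷ y ∷ pre) [] u l cl _ =
        lastOr y pre , x ,
        (λ eq → unique-head u (subst (_∈ y ∷ pre ++ [ v ]) eq (∈P.∈-++⁺ˡ (lastOr-∈ y pre)))) ,
        adj-sym (linked-junction x (y ∷ pre) l) , subst (λ z → Adj G z x) (lastOr-++ y pre) cl
      neighbours (x ∷ pre) (p ∷ post) u l cl _ =
        lastOr x pre , p ,
        (λ eq → unique-disjoint (x ∷ pre) u (lastOr-∈ x pre) (there (here eq))) ,
        adj-sym (linked-junction x pre l) , Linked.head (linked-++⁻ʳ (x ∷ pre) l)

    -- The fibres of the map are unions of components, and each edge merges at most two of them.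
    components : ∀ (G : List (Edge n)) → Σ (Fin n → Fin n) λ c → (∀ {u v} → Adj G u v → c u ≡ c v) ×
      Σ (List (Fin n)) λ l → Unique l × n ≤ length l + length G × (∀ {x} → x ∈ l → ∃ λ v → c v ≡ x)
    components [] = (λ v → v) , (λ { (inj₁ ()) ; (inj₂ ()) }) , allFin n , UP.allFin⁺ n ,
      ℕP.≤-reflexive (sym (trans (ℕP.+-identityʳ _) length-allFin)) , (λ {x} _ → x , refl)
    components ((a , b) ∷ G) with components G
    ... | c , same , l , ul , le , fibre = c′ , same′ , l′ , UP.filter⁺ keep? ul , le′ , fibre′
      where
      merge : Fin n → Fin n
      merge x with x FinP.≟ c b
      ... | yes _ = c a
      ... | no _  = x
      merge-cb : merge (c b) ≡ c a
      merge-cb with c b FinP.≟ c b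
      ... | yes _ = refl
      ... | no ne = ⊥-elim (ne refl)
      merge-≢ : ∀ {x} → x ≢ c b → merge x ≡ x
      merge-≢ {x} ne with x FinP.≟ c b
      ... | yes eq = ⊥-elim (ne eq)
      ... | no _   = refl
      merge-ca : merge (c a) ≡ c a
      merge-ca with c a FinP.≟ c b
      ... | yes _ = refl
      ... | no _  = refl
      c′ : Fin n → Fin n
      c′ = merge ∘ c
      same′ : ∀ {u v} → Adj ((a , b) ∷ G) u v → c′ u ≡ c′ v
      same′ (inj₁ (here refl)) = trans merge-ca (sym merge-cb)
      same′ (inj₁ (there i))   = cong merge (same (inj₁ i))
      same′ (inj₂ (here refl)) = trans merge-cb (sym merge-ca)
      same′ (inj₂ (there i))   = cong merge (same (inj₂ i))
      keep? : ∀ x → Dec (x ≢ c b)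
      keep? x = ¬? (x FinP.≟ c b)
      l′ = filter keep? l
      drop≤1 : length l ≤ suc (length l′)
      drop≤1 = unique-⊆⇒length≤ ul sub
        where
        sub : ∀ {x} → x ∈ l → x ∈ c b ∷ l′
        sub {x} i with x FinP.≟ c b
        ... | yes eq = here eq
        ... | no ne  = there (∈P.∈-filter⁺ keep? i ne)
      le′ : n ≤ length l′ + suc (length G)
      le′ = ℕP.≤-trans le (ℕP.≤-trans (ℕP.+-monoˡ-≤ (length G) drop≤1)
              (ℕP.≤-reflexive (sym (ℕP.+-suc (length l′) (length G)))))
      fibre′ : ∀ {x} → x ∈ l′ → ∃ λ v → c′ v ≡ x
      fibre′ i with ∈P.∈-filter⁻ keep? {xs = l} i
      ... | j , ne with fibre j
      ...   | v , refl = v , merge-≢ ne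

    -- Connectedness makes the map of `components` constant, so its list of values has at most one
    -- entry.
    connected⇒edges : ∀ {G : List (Edge n)} → Connected G → n ≤ suc (length G)
    connected⇒edges {G} con with components G
    ... | c , same , [] , _ , le , _ = ℕP.≤-trans le (ℕP.n≤1+n _)
    ... | c , same , x ∷ [] , _ , le , _ = le
    ... | c , same , x ∷ y ∷ _ , u , _ , fibre with fibre (here refl) | fibre (there (here refl))
    ...   | v , refl | w , refl = ⊥-elim (unique-head u (here (constant (con v w))))
      where
      constant : ∀ {u v} → Reach G u v → c u ≡ c v
      constant Reach.here       = refl
      constant (Reach.step p a) = trans (constant p) (same a)

    -- Double counting of arcs: two arcs out of every vertex, all distinct, among the `2 * length G`
    -- orientations of edges of `G`.
    minDeg2⇒edges : ∀ {G : List (Edge n)} → MinDeg2 G → n ≤ length G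
    minDeg2⇒edges {G} d = ℕP.*-cancelˡ-≤ 2 (subst₂ _≤_ (double length-map-allFin length-map-allFin)
      (double refl (LP.length-map swap G)) (subst₂ _≤_ (LP.length-++ (map f (allFin n))) (LP.length-++ G)
        (unique-⊆⇒length≤ {ys = G ++ map swap G} u sub)))
      where
      f g : Fin n → Edge n
      f v = v , proj₁ (d v)
      g v = v , proj₁ (proj₂ (d v))
      double : ∀ {x y k} → x ≡ k → y ≡ k → x + y ≡ 2 * k
      double {k = k} refl refl = cong (k +_) (sym (ℕP.+-identityʳ k))
      length-map-allFin : ∀ {h : Fin n → Edge n} → length (map h (allFin n)) ≡ n
      length-map-allFin {h} = trans (LP.length-map h (allFin n)) length-allFin
      disj : ∀ {e} → ¬ (e ∈ map f (allFin n) × e ∈ map g (allFin n))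
      disj (i , j) with ∈P.∈-map⁻ f i | ∈P.∈-map⁻ g j
      ... | v , _ , refl | w , _ , eq with cong proj₁ eq
      ...   | refl = proj₁ (proj₂ (proj₂ (d v))) (cong proj₂ eq)
      u : Unique (map f (allFin n) ++ map g (allFin n))
      u = UP.++⁺ (UP.map⁺ (cong proj₁) (UP.allFin⁺ n)) (UP.map⁺ (cong proj₁) (UP.allFin⁺ n)) disj
      arc : ∀ {v w} → Adj G v w → (v , w) ∈ G ++ map swap G
      arc (inj₁ i) = ∈P.∈-++⁺ˡ i
      arc (inj₂ i) = ∈P.∈-++⁺ʳ G (∈P.∈-map⁺ swap i)
      sub : ∀ {e} → e ∈ map f (allFin n) ++ map g (allFin n) → e ∈ G ++ map swap G
      sub i with ∈P.∈-++⁻ (map f (allFin n)) i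
      sub i | inj₁ j with ∈P.∈-map⁻ f j
      ... | v , _ , refl = arc (proj₁ (proj₂ (proj₂ (proj₂ (d v)))))
      sub i | inj₂ j with ∈P.∈-map⁻ g j
      ... | v , _ , refl = arc (proj₂ (proj₂ (proj₂ (proj₂ (d v)))))

open Graphs

-- Breaker's half: too few rounds for `n ∸ 1` edges; bounds for the bias.

module BreakerWins where

  open import Data.Rational using (_≤_; _<_; _+_; _*_; _-_; -_; _/_; floor; ↥_; ↧_)
  open import Data.Rational.Solver using (module +-*-Solver)

  module FewEdges {n} (S : Strategy n) (b : ℕ) (1<n : 1 ℕ.< n)
    -- If the board is not exhausted by `r` full rounds, then Maker owns at most `n ∸ 2` edges even
    -- after her next move.
    (rounds : ∀ r → suc b ℕ.* r ℕ.< length (allEdges n) → suc (suc r) ℕ.< n)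
    (P : List (Edge n) → Set) (P? : ∀ G → Dec (P G)) (large : ∀ {G} → P G → n ℕ.≤ suc (length G))
    where

    private
      total : List (Edge n) → List (Edge n) → Set
      total M B = length (freeEdges M B) ℕ.+ (length M ℕ.+ length B) ℕ.≤ length (allEdges n)

      -- Here `k` is the number of picks still due in the running round, and `v` never has to drop
      -- below 1, since the claim holds surely. The second case of `pace` is a round cut short by
      -- the end of the board, after which Maker has no move.
      record Few (k : ℕ) (M B : List (Edge n)) (v : ℚ) : Set where
        constructor few
        field
          v≤1     : v ≤ 1ℚ
          size    : suc (length M) ℕ.< n
          balance : total M B
          pace    : length M ℕ.* b ℕ.≤ length B ℕ.+ k ⊎ freeEdges M B ≡ []

      𝒱 : ℕ → List (Edge n) → List (Edge n) → ℚ → Set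
      𝒱 m = Few 0

      𝒲 : ℕ → ℕ → List (Edge n) → List (Edge n) → ℚ → Set
      𝒲 m k = Few k

      g : List (Edge n) → ℚ
      g G = indicator (¬? (P? G))

      final : ∀ {M B v} m → 𝒱 m M B v → v ≤ g M
      final {M} m (few v≤1 size _ _) = subst (_ ≤_)
        (sym (indicator-yes (¬? (P? M)) (λ p → ℕP.<-irrefl refl (ℕP.<-≤-trans size (large p))))) v≤1

      maker : ∀ {m M B v x xs} → freeEdges M B ≡ x ∷ xs → 𝒱 (suc m) M B v →
              𝒲 m b (M ++ [ choose x xs (S M B) ]) B v
      maker eq (few _ _ _ (inj₂ eq′)) with () ← trans (sym eq) eq′
      maker {m} {M} {B} {v} {x} {xs} eq (few v≤1 size tot (inj₁ le)) = few v≤1 size′ tot′ (inj₁ le′)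
        where
        open ℕP.≤-Reasoning
        e = choose x xs (S M B)
        M′ = M ++ [ e ]
        e∈ : e ∈ freeEdges M B
        e∈ = subst (e ∈_) (sym eq) (choose-∈ x xs (S M B))
        shrinks = free-shrinks M B M′ B e∈ ∈P.∈-++⁺ˡ (λ i → i) (inj₁ (∈P.∈-++⁺ʳ M (here refl)))
        size′ : suc (length M′) ℕ.< n
        size′ = subst (λ z → suc z ℕ.< n) (sym (length-++-∷ʳ M e)) (rounds (length M) (begin-strict
          suc b ℕ.* length M           ≡⟨ cong (length M ℕ.+_) (ℕP.*-comm b (length M)) ⟩
          length M ℕ.+ length M ℕ.* b  ≤⟨ ℕP.+-monoʳ-≤ (length M) (subst (_ ℕ.≤_) (ℕP.+-identityʳ _) le) ⟩
          length M ℕ.+ length B        <⟨ ℕP.+-monoˡ-≤ (length M ℕ.+ length B) (s≤s (z≤n {length (freeEdges M′ B)})) ⟩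
          suc (length (freeEdges M′ B)) ℕ.+ (length M ℕ.+ length B) ≤⟨ ℕP.+-monoˡ-≤ _ shrinks ⟩
          length (freeEdges M B) ℕ.+ (length M ℕ.+ length B) ≤⟨ tot ⟩
          length (allEdges n) ∎))
        tot′ : total M′ B
        tot′ = begin
          length (freeEdges M′ B) ℕ.+ (length M′ ℕ.+ length B)     ≡⟨ cong (λ z → length (freeEdges M′ B) ℕ.+ (z ℕ.+ length B)) (length-++-∷ʳ M e) ⟩
          length (freeEdges M′ B) ℕ.+ suc (length M ℕ.+ length B)  ≡⟨ ℕP.+-suc _ _ ⟩
          suc (length (freeEdges M′ B)) ℕ.+ (length M ℕ.+ length B) ≤⟨ ℕP.+-monoˡ-≤ _ shrinks ⟩
          length (freeEdges M B) ℕ.+ (length M ℕ.+ length B)       ≤⟨ tot ⟩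
          length (allEdges n)                                      ∎
        le′ : length M′ ℕ.* b ℕ.≤ length B ℕ.+ b
        le′ = begin
          length M′ ℕ.* b       ≡⟨ cong (ℕ._* b) (length-++-∷ʳ M e) ⟩
          b ℕ.+ length M ℕ.* b  ≤⟨ ℕP.+-monoʳ-≤ b (subst (_ ℕ.≤_) (ℕP.+-identityʳ _) le) ⟩
          b ℕ.+ length B        ≡⟨ ℕP.+-comm b _ ⟩
          length B ℕ.+ b        ∎

      pick : ∀ {m k M B v x xs} → freeEdges M B ≡ x ∷ xs → 𝒲 m (suc k) M B v →
             Σ (Edge n → ℚ) λ w → (∀ e → e ∈ x ∷ xs → 𝒲 m k M (B ++ [ e ]) (w e)) ×
               ι (suc (length xs)) * v ≤ Sum w (x ∷ xs)
      pick eq (few _ _ _ (inj₂ eq′)) with () ← trans (sym eq) eq′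
      pick {m} {k} {M} {B} {v} {x} {xs} eq (few v≤1 size tot (inj₁ le)) =
        (λ _ → v) , child , ℚP.≤-reflexive (sym (Sum-const v (x ∷ xs)))
        where
        open ℕP.≤-Reasoning
        child : ∀ e → e ∈ x ∷ xs → 𝒲 m k M (B ++ [ e ]) v
        child e i = few v≤1 size tot′ (inj₁ (subst (length M ℕ.* b ℕ.≤_)
            (trans (ℕP.+-suc _ k) (cong (ℕ._+ k) (sym (length-++-∷ʳ B e)))) le))
          where
          B′ = B ++ [ e ]
          tot′ : total M B′
          tot′ = begin
            length (freeEdges M B′) ℕ.+ (length M ℕ.+ length B′)     ≡⟨ cong (λ z → length (freeEdges M B′) ℕ.+ z)
                                                                         (trans (cong (length M ℕ.+_) (length-++-∷ʳ B e)) (ℕP.+-suc _ _)) ⟩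
            length (freeEdges M B′) ℕ.+ suc (length M ℕ.+ length B)  ≡⟨ ℕP.+-suc _ _ ⟩
            suc (length (freeEdges M B′)) ℕ.+ (length M ℕ.+ length B) ≤⟨ ℕP.+-monoˡ-≤ _ (free-shrinks M B M B′ (subst (e ∈_) (sym eq) i) (λ j → j) ∈P.∈-++⁺ˡ (inj₂ (∈P.∈-++⁺ʳ B (here refl)))) ⟩
            length (freeEdges M B) ℕ.+ (length M ℕ.+ length B)       ≤⟨ tot ⟩
            length (allEdges n)                                      ∎

    never : ∀ m → 1ℚ ≤ 𝔼 g (play S b m [] [])
    never m = LowerBound.play-bound S b g 𝒱 𝒲 (final 0) (λ {m} _ → final (suc m)) (λ {m} → maker {m}) (λ h → h)
      (λ { eq (few v≤1 size tot _) → few v≤1 size tot (inj₂ eq) }) (λ {m} → pick {m})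
      {m = m} (few ℚP.≤-refl 1<n start (inj₁ z≤n))
      where
      start : total [] []
      start = subst (ℕ._≤ length (allEdges n)) (sym (ℕP.+-identityʳ _))
        (unique-⊆⇒length≤ (free-unique [] []) (λ {e} i → proj₁ (free⁻ {n} [] [] {e} i)))

  floor-≤ : ∀ x → floor x / 1 ≤ x
  floor-≤ x@record{} = ℚP.toℚᵘ-cancel-≤ (begin
    ℚ.toℚᵘ (floor x / 1)  ≃⟨ toℚᵘ-/ (floor x) 0 ⟩
    mkℚᵘ (floor x) 0      ≤⟨ *≤* (subst (floor x ℤ.* ↧ x ℤ.≤_) (sym (ℤP.*-identityʳ (↥ x))) (ℤD.[n/d]*d≤n (↥ x) (↧ x))) ⟩
    ℚ.toℚᵘ x              ∎)
    where open import Data.Rational.Unnormalised.Properties using (module ≤-Reasoning)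
          open ≤-Reasoning

  ≤-floor+1 : ∀ x → x ≤ (ℤ.+ 1 ℤ.+ floor x) / 1
  ≤-floor+1 x@record{} = ℚP.toℚᵘ-cancel-≤ (begin
    ℚ.toℚᵘ x                      ≤⟨ *≤* le ⟩
    mkℚᵘ (ℤ.+ 1 ℤ.+ floor x) 0    ≃⟨ toℚᵘ-/ (ℤ.+ 1 ℤ.+ floor x) 0 ⟨
    ℚ.toℚᵘ ((ℤ.+ 1 ℤ.+ floor x) / 1) ∎)
    where
    open import Data.Rational.Unnormalised.Properties using (module ≤-Reasoning)
    open ≤-Reasoning
    r = ↥ x ℤD.% ↧ x
    le : ↥ x ℤ.* ℤ.+ 1 ℤ.≤ (ℤ.+ 1 ℤ.+ floor x) ℤ.* ↧ x
    le = subst₂ ℤ._≤_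
      (sym (trans (ℤP.*-identityʳ (↥ x)) (ℤD.a≡a%n+[a/n]*n (↥ x) (↧ x))))
      (sym (trans (ℤP.*-distribʳ-+ (↧ x) (ℤ.+ 1) (floor x)) (cong (ℤ._+ floor x ℤ.* ↧ x) (ℤP.*-identityˡ (↧ x)))))
      (ℤP.+-monoˡ-≤ (floor x ℤ.* ↧ x) (ℤ.+≤+ (ℕP.<⇒≤ (ℤD.n%d<d (↥ x) (↧ x)))))

  i≤toℕ⁺ : ∀ i → i ℤ.≤ ℤ.+ toℕ⁺ i
  i≤toℕ⁺ (ℤ.+ k)   = ℤP.≤-refl
  i≤toℕ⁺ -[1+ k ] = ℤ.-≤+

  0≤half : ∀ n → 0ℚ ≤ half n
  0≤half n = subst (_≤ half n) (ℚP.0/n≡0 2) (/-mono {ℤ.+ 0} {ℤ.+ n} {1} (ℤ.+≤+ z≤n))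

  half-*2 : ∀ n → half n * ι 2 ≡ ι n
  half-*2 n = ratio-*-ι n 1

  -- Both biases are monotone in `ε`, so `ε` may be replaced by a unit fraction below it, and the
  -- rest is arithmetic of natural numbers.
  unit-below : ∀ ε → 0ℚ < ε → Σ ℕ λ q → (ℤ.+ 1) / suc q ≤ ε
  unit-below ε@(mkℚ (ℤ.+ zero) q _) (ℚ.*<* (ℤ.+<+ ()))
  unit-below ε@(mkℚ (ℤ.+ suc p) q _) _ = q , subst ((ℤ.+ 1) / suc q ≤_) (ℚP.↥p/↧p≡p ε) (/-mono {ℤ.+ 1} {ℤ.+ suc p} {q} (ℤ.+≤+ (s≤s z≤n)))
  unit-below ε@(mkℚ -[1+ p ] q _) (ℚ.*<* ())

  unit-* : ∀ q → ((ℤ.+ 1) / suc q) * ι (suc q) ≡ 1ℚ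
  unit-* q = trans (ratio-*-ι 1 q) ι-1

  module _ (q : ℕ) {ε : ℚ} (unit≤ε : (ℤ.+ 1) / suc q ≤ ε) (n : ℕ) where

    private
      w h Q : ℚ
      w = (ℤ.+ 1) / suc q
      h = half n
      Q = ι (suc q)

    -- The bound `(1 + 1 / (q + 1)) * n / 2 ≤ b + 1` cleared of denominators. The floor loses less
    -- than 1, and `b + 1` is just the number of edges claimed in a full round.
    bias-lower : suc (suc q) ℕ.* n ℕ.≤ 2 ℕ.* suc q ℕ.* suc (bias ε half n)
    bias-lower = ι-cancel (begin
      ι (suc (suc q) ℕ.* n)             ≡⟨ trans (ι-* (suc (suc q)) n) (cong₂ _*_ (ι-suc (suc q)) (sym (half-*2 n))) ⟩
      (1ℚ + Q) * (h * ι 2)              ≡⟨ cong (λ u → (u + Q) * (h * ι 2)) (unit-* q) ⟨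
      (w * Q + Q) * (h * ι 2)           ≡⟨ solve 4 (λ w Q h t → (w :* Q :+ Q) :* (h :* t) := t :* Q :* ((con 1ℚ :+ w) :* h)) refl w Q h (ι 2) ⟩
      ι 2 * Q * ((1ℚ + w) * h)          ≤⟨ *-monoˡ (0≤* (0≤ι 2) (0≤ι (suc q))) (ℚP.≤-trans (*-monoʳ (0≤half n) (ℚP.+-monoʳ-≤ 1ℚ unit≤ε)) x≤b+1) ⟩
      ι 2 * Q * ι (suc (bias ε half n)) ≡⟨ cong (_* ι (suc (bias ε half n))) (ι-* 2 (suc q)) ⟨
      ι (2 ℕ.* suc q) * ι (suc (bias ε half n)) ≡⟨ ι-* (2 ℕ.* suc q) _ ⟨
      ι (2 ℕ.* suc q ℕ.* suc (bias ε half n)) ∎)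
      where
      open ℚP.≤-Reasoning
      open +-*-Solver
      x = (1ℚ + ε) * h
      x≤b+1 : x ≤ ι (suc (bias ε half n))
      x≤b+1 = ℚP.≤-trans (≤-floor+1 x) (ι-of (/-mono {d = 0} (ℤP.+-monoʳ-≤ (ℤ.+ 1) (i≤toℕ⁺ (floor x)))))
        where
        ι-of : ∀ {y k} → y ≤ (ℤ.+ k) / 1 → y ≤ ι k
        ι-of {y} {k} = subst (y ≤_) (sym (ι-≡ k))

    bias-upper : 2 ℕ.* suc q ℕ.* bias (- ε) half n ℕ.≤ q ℕ.* n
    bias-upper = ι-cancel (begin
      ι (2 ℕ.* suc q ℕ.* b)    ≡⟨ trans (ι-* (2 ℕ.* suc q) b) (cong (_* ι b) (ι-* 2 (suc q))) ⟩
      ι 2 * Q * ι b            ≤⟨ *-monoˡ (0≤* (0≤ι 2) (0≤ι (suc q))) b≤y ⟩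
      ι 2 * Q * y              ≡⟨ solve 4 (λ w Q h t → t :* Q :* ((con 1ℚ :- w) :* h) := (Q :- w :* Q) :* (h :* t)) refl w Q h (ι 2) ⟩
      (Q - w * Q) * (h * ι 2)  ≡⟨ cong₂ _*_ Q-1 (half-*2 n) ⟩
      ι q * ι n                ≡⟨ ι-* q n ⟨
      ι (q ℕ.* n)              ∎)
      where
      open ℚP.≤-Reasoning
      open +-*-Solver
      b = bias (- ε) half n
      x = (1ℚ + - ε) * h
      y = (1ℚ - w) * h
      Q-1 : Q - w * Q ≡ ι q
      Q-1 = trans (cong₂ _-_ (ι-suc q) (unit-* q)) (solve 1 (λ a → con 1ℚ :+ a :- con 1ℚ := a) refl (ι q))
      w≤1 : w ≤ 1ℚ
      w≤1 = *-cancelˡ (0<ι q) (subst₂ _≤_ (trans (sym (unit-* q)) (ℚP.*-comm w Q)) (sym (ℚP.*-identityʳ Q))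
              (subst (_≤ Q) ι-1 (ι-mono (s≤s z≤n))))
      x≤y : x ≤ y
      x≤y = *-monoʳ (0≤half n) (ℚP.+-monoʳ-≤ 1ℚ (ℚP.neg-antimono-≤ unit≤ε))
      toℕ⁺-floor : ∀ i → i / 1 ≤ y → ι (toℕ⁺ i) ≤ y
      toℕ⁺-floor (ℤ.+ k)  le = subst (_≤ y) (sym (ι-≡ k)) le
      -- For `ε` above 1 the floor may be negative, and the bias is then 0. The bound survives
      -- because `y` uses the unit fraction `w ≤ 1` instead of `ε`.
      toℕ⁺-floor -[1+ k ] le = subst (_≤ y) (sym ι-0) (0≤* (diff-≥0 w≤1) (0≤half n))
      b≤y : ι b ≤ y
      b≤y = toℕ⁺-floor (floor x) (ℚP.≤-trans (floor-≤ x) x≤y)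

  aas : ∀ {P : (n : ℕ) → List (Edge n) → Set} {d} (P? : ∀ n G → Dec (P n G)) →
        (∀ δ → 0ℚ < δ → Σ ℕ λ N → ∀ n → N ℕ.≤ n → 1ℚ - δ ≤ 𝔼 (indicator ∘ P? n) (d n)) → AAS P d
  aas {d = d} P? h δ 0<δ with h δ 0<δ
  ... | N , bound = N , λ n N≤n → _ , mass (P? n) (d n) , bound n N≤n

  -- Put `Q = suc q`. If `r ≥ n - 2`, the hypotheses combine to
  -- `(Q + 1) n (n - 2) + Q n + 2 Q ≤ Q n²`. The left side is `Q n² + n (n - Q - 2) + 2 Q`, so this
  -- fails as soon as `n ≥ Q + 2`.
  rounds-bound : ∀ {q n b E} r → suc q ℕ.+ 2 ℕ.≤ n → suc (suc q) ℕ.* n ℕ.≤ 2 ℕ.* suc q ℕ.* suc b →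
                 E ℕ.+ (E ℕ.+ n) ℕ.≤ n ℕ.* n → suc b ℕ.* r ℕ.< E → suc (suc r) ℕ.< n
  rounds-bound {q} {n} {b} {E} r large bias≥ count few with suc (suc r) ℕ.<? n
  ... | yes lt = lt
  ... | no ≮n with ℕP.m≤n⇒∃[o]m+o≡n large
  ...   | d , refl = ⊥-elim (ℕP.<-irrefl refl (begin-strict
    suc (suc q) ℕ.* n ℕ.* k ℕ.+ suc q ℕ.* n                 <⟨ ℕP.m<m+n _ (s≤s z≤n) ⟩
    suc (suc q) ℕ.* n ℕ.* k ℕ.+ suc q ℕ.* n ℕ.+ 2 ℕ.* suc q ≤⟨ ℕP.+-monoˡ-≤ (2 ℕ.* suc q) (ℕP.+-monoˡ-≤ (suc q ℕ.* n) (ℕP.*-mono-≤ bias≥ k≤r)) ⟩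
    2 ℕ.* suc q ℕ.* suc b ℕ.* r ℕ.+ suc q ℕ.* n ℕ.+ 2 ℕ.* suc q
        ≡⟨ solve 4 (λ Q b r n → con 2 :* Q :* b :* r :+ Q :* n :+ con 2 :* Q := Q :* ((con 1 :+ b :* r) :+ ((con 1 :+ b :* r) :+ n))) refl (suc q) (suc b) r n ⟩
    suc q ℕ.* (suc (suc b ℕ.* r) ℕ.+ (suc (suc b ℕ.* r) ℕ.+ n)) ≤⟨ ℕP.*-monoʳ-≤ (suc q) (ℕP.≤-trans (ℕP.+-mono-≤ few (ℕP.+-monoˡ-≤ n few)) count) ⟩
    suc q ℕ.* (n ℕ.* n)                                      ≤⟨ ℕP.m≤m+n _ (d ℕ.* suc q ℕ.+ d ℕ.* d ℕ.+ 2 ℕ.* d) ⟩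
    suc q ℕ.* (n ℕ.* n) ℕ.+ (d ℕ.* suc q ℕ.+ d ℕ.* d ℕ.+ 2 ℕ.* d) ≡⟨ solve 2 (λ Q d → let n = Q :+ con 2 :+ d ; k = Q :+ d in
        Q :* (n :* n) :+ (d :* Q :+ d :* d :+ con 2 :* d) := (con 1 :+ Q) :* n :* k :+ Q :* n) refl (suc q) d ⟩
    suc (suc q) ℕ.* n ℕ.* k ℕ.+ suc q ℕ.* n                 ∎))
    where
    open ℕP.≤-Reasoning
    open ℕS.+-*-Solver
    k = suc q ℕ.+ d
    k≤r : k ℕ.≤ r
    k≤r = ℕP.≤-pred (ℕP.≤-pred (subst (ℕ._≤ suc (suc r)) (trans (ℕP.+-assoc (suc q) 2 d) (trans (ℕP.+-suc (suc q) (suc d)) (cong suc (ℕP.+-suc (suc q) d)))) (ℕP.≮⇒≥ ≮n)))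

  module _ (P : ∀ {n} → List (Edge n) → Set) (P? : ∀ {n} (G : List (Edge n)) → Dec (P G))
           (large : ∀ {n} {G : List (Edge n)} → P G → n ℕ.≤ suc (length G)) where

    breaker-wins : ∀ ε → 0ℚ < ε → (S : (n : ℕ) → Strategy n) →
                   AAS (λ n G → ¬ P G) (λ n → fullGame (S n) (bias ε half n))
    breaker-wins ε 0<ε S with unit-below ε 0<ε
    ... | q , unit≤ε = aas (λ n G → ¬? (P? G)) λ δ 0<δ → suc q ℕ.+ 2 , λ n N≤n →
      ℚP.≤-trans (1-‿≤1 (ℚP.<⇒≤ 0<δ))
        (FewEdges.never (S n) (bias ε half n) (ℕP.≤-trans (ℕP.m≤n+m 2 (suc q)) N≤n)
          (λ r → rounds-bound r N≤n (bias-lower q unit≤ε n) (edge-count-upper n)) P P? large (length (allEdges n)))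

open BreakerWins

-- Maker's plan: searching for sites of extension, closure and insertion.

module Planning where

  open import Data.Nat using (_≤_; _<_)

  module _ {A : Set} where

    -- A strategy has to be computed, so each kind of site is found by trying all ways to cut the
    -- path or the cycle.
    split? : {Q : List A → List A → Set} → (∀ pre post → Dec (Q pre post)) →
             ∀ c → Dec (∃₂ λ pre post → c ≡ pre ++ post × Q pre post)
    split? Q? [] = map′ (λ q → [] , [] , refl , q) (λ { ([] , [] , refl , q) → q }) (Q? [] [])
    split? {Q} Q? (x ∷ c) with Q? [] (x ∷ c) | split? (Q? ∘ (x ∷_)) c
    ... | yes q | _                            = yes ([] , x ∷ c , refl , q)
    ... | no _  | yes (pre , post , refl , q)  = yes (x ∷ pre , post , refl , q)
    ... | no ¬q | no ¬qs                       = no λ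
      { ([] , _ , refl , q)         → ¬q q
      ; (_ ∷ pre , post , refl , q) → ¬qs (pre , post , refl , q) }

    split-length : ∀ k (xs : List A) → k ≤ length xs → ∃₂ λ ys zs → xs ≡ ys ++ zs × length ys ≡ k
    split-length k xs le = take k xs , drop k xs , sym (LP.take++drop≡id k xs) ,
      trans (LP.length-take k xs) (ℕP.m≤n⇒m⊓n≡m le)

    unique-++⁻ˡ : ∀ (xs : List A) {ys} → Unique (xs ++ ys) → Unique xs
    unique-++⁻ˡ xs {ys} u = unique-of xs u
      where
      unique-of : ∀ xs → Unique (xs ++ ys) → Unique xs
      unique-of []       _         = []
      unique-of (x ∷ xs) u@(_ ∷ u′) = unique-∷ (unique-head u ∘ ∈P.∈-++⁺ˡ) (unique-of xs u′)

    unique-++⁻ʳ : ∀ (xs : List A) {ys} → Unique (xs ++ ys) → Unique ys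
    unique-++⁻ʳ []       u       = u
    unique-++⁻ʳ (x ∷ xs) (_ ∷ u) = unique-++⁻ʳ xs u

    unique-↭ : ∀ {xs ys : List A} → xs ↭ ys → Unique xs → Unique ys
    unique-↭ p = ↭ₛP.Unique-resp-↭ (setoid A) (↭⇒↭ₛ p)

    module _ {R : A → A → Set} where

      linked-reverse : (∀ {x y} → R x y → R y x) → ∀ {xs} → Linked R xs → Linked R (reverse xs)
      linked-reverse s []  = []
      linked-reverse s [-] = [-]
      linked-reverse s {x ∷ y ∷ xs} (r ∷ l) = subst (Linked R) eq
        (append (reverse xs) (subst (Linked R) (LP.unfold-reverse y xs) (linked-reverse s l)) (s r))
        where
        append : ∀ zs {y x} → Linked R (zs ++ [ y ]) → R y x → Linked R (zs ++ y ∷ [ x ])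
        append []            _       r = r ∷ [-]
        append (z ∷ [])      (q ∷ _) r = q ∷ r ∷ [-]
        append (z ∷ w ∷ zs)  (q ∷ l) r = q ∷ append (w ∷ zs) l r
        eq : reverse xs ++ y ∷ [ x ] ≡ reverse (x ∷ y ∷ xs)
        eq = sym (trans (LP.reverse-++ (x ∷ y ∷ []) xs) refl)

      linked-replace : ∀ α {a xs ys} → Linked R (α ++ a ∷ xs) → Linked R (a ∷ ys) → Linked R (α ++ a ∷ ys)
      linked-replace []           _       l′ = l′
      linked-replace (z ∷ [])     (r ∷ _) l′ = r ∷ l′
      linked-replace (z ∷ w ∷ α)  (r ∷ l) l′ = r ∷ linked-replace (w ∷ α) l l′

  module _ {A : Set} {Q : A → Set} (Q? : ∀ x → Dec (Q x)) where

    split-count : ∀ k (c : List A) → k ≤ length (filter Q? c) →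
                  ∃₂ λ c₁ c₂ → c ≡ c₁ ++ c₂ × length (filter Q? c₁) ≡ k
    split-count zero    c le = [] , c , refl , refl
    split-count (suc k) (x ∷ c) le with Q? x in eq
    split-count (suc k) (x ∷ c) (s≤s le) | yes q with split-count k c le
    ... | c₁ , c₂ , refl , len = x ∷ c₁ , c₂ , refl , trans (cong length (LP.filter-accept Q? q)) (cong suc len)
    split-count (suc k) (x ∷ c) le | no ¬q with split-count (suc k) c le
    ... | c₁ , c₂ , refl , len = x ∷ c₁ , c₂ , refl , trans (cong length (LP.filter-reject Q? ¬q)) len

    successorsFrom : A → List A → List A
    successorsFrom x []      = []
    successorsFrom x (y ∷ c) with Q? x
    ... | yes _ = y ∷ successorsFrom y c
    ... | no _  = successorsFrom y c

    successors : List A → List A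
    successors []      = []
    successors (x ∷ c) = successorsFrom x c

    -- Only the last vertex of a list lacks a successor in it. So neither the closing edge of the
    -- cycle nor the edge at a cut is ever used for an insertion.
    successors-length : ∀ c → length (filter Q? c) ≤ suc (length (successors c))
    successors-length []      = z≤n
    successors-length (x ∷ c) = from x c
      where
      from : ∀ x c → length (filter Q? (x ∷ c)) ≤ suc (length (successorsFrom x c))
      from x [] with Q? x
      ... | yes _ = s≤s z≤n
      ... | no _  = z≤n
      from x (y ∷ c) with Q? x
      ... | yes _ = s≤s (from y c)
      ... | no _  = from y c

    successorsFrom-⊆ : ∀ x c {y} → y ∈ successorsFrom x c → y ∈ c
    successorsFrom-⊆ x (y ∷ c) i with Q? x
    successorsFrom-⊆ x (y ∷ c) (here refl) | yes _ = here refl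
    successorsFrom-⊆ x (y ∷ c) (there i)   | yes _ = there (successorsFrom-⊆ y c i)
    successorsFrom-⊆ x (y ∷ c) i           | no _  = there (successorsFrom-⊆ y c i)

    successors-∈ : ∀ c {y} → y ∈ successors c → y ∈ c
    successors-∈ (x ∷ c) i = there (successorsFrom-⊆ x c i)

    successors-unique : ∀ c → Unique c → Unique (successors c)
    successors-unique []      u = []
    successors-unique (x ∷ c) u = from x c u
      where
      from : ∀ x c → Unique (x ∷ c) → Unique (successorsFrom x c)
      from x []      u = []
      from x (y ∷ c) (_ ∷ u) with Q? x
      ... | yes _ = unique-∷ (unique-head u ∘ successorsFrom-⊆ y c) (from y c u)
      ... | no _  = from y c u

    predecessor : ∀ c {y} → y ∈ successors c → ∃₂ λ α x → ∃ λ γ → c ≡ α ++ x ∷ y ∷ γ × Q x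
    predecessor (x ∷ c) i = from x c i
      where
      from : ∀ x c {y} → y ∈ successorsFrom x c → ∃₂ λ α z → ∃ λ γ → x ∷ c ≡ α ++ z ∷ y ∷ γ × Q z
      from x (y ∷ c) i with Q? x
      from x (y ∷ c) (here refl) | yes q = [] , x , c , refl , q
      from x (y ∷ c) (there i)   | yes _ with from y c i
      ... | α , z , γ , eq , q = x ∷ α , z , γ , cong (x ∷_) eq , q
      from x (y ∷ c) i           | no _ with from y c i
      ... | α , z , γ , eq , q = x ∷ α , z , γ , cong (x ∷_) eq , q

  -- The closing edge depends only on the first and the last vertex, and both stay in place.
  closes-replace : ∀ {n} {G : List (Edge n)} α {a ys b γ zs b′ γ′} → lastOr b γ ≡ lastOr b′ γ′ →
                   Closes G (α ++ a ∷ ys ++ b ∷ γ) → Closes G (α ++ a ∷ zs ++ b′ ∷ γ′)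
  closes-replace {G = G} [] {a} {ys} {zs = zs} eq = subst (λ z → Adj G z a)
    (trans (lastOr-++ a ys) (trans eq (sym (lastOr-++ a zs))))
  closes-replace {G = G} (x ∷ α) {a} {ys} {b} {γ} {zs} {b′} {γ′} eq = subst (λ z → Adj G z x) (begin
    lastOr x (α ++ a ∷ ys ++ b ∷ γ)   ≡⟨ lastOr-++ x α ⟩
    lastOr a (ys ++ b ∷ γ)            ≡⟨ lastOr-++ a ys ⟩
    lastOr b γ                        ≡⟨ eq ⟩
    lastOr b′ γ′                      ≡⟨ lastOr-++ a zs ⟨
    lastOr a (zs ++ b′ ∷ γ′)          ≡⟨ lastOr-++ x α ⟨
    lastOr x (α ++ a ∷ zs ++ b′ ∷ γ′) ∎)
    where open ≡-Reasoning

  -- P is the path, headed by its growing end, U are the vertices not visited yet and D the dead ones.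
  data Stage (n : ℕ) : Set where
    path  : (P U D : List (Fin n)) → Stage n
    cycle : (c left : List (Fin n)) → Stage n

  -- The edges are those still to be claimed before the structure of the stage is in Maker's graph.
  State : ℕ → Set
  State n = List (Edge n) × Stage n

  module _ {n : ℕ} where

    private
      -- Available means not Breaker's: an edge that Maker owns already is as good as a free one,
      -- and the properties to be exploited speak of Breaker's edges only.
      avail? : ∀ (B : List (Edge n)) u v → Dec (edge u v ∉ B)
      avail? B u v = ¬? (edge u v ∈ₑ? B)

    ExtendSite : List (Edge n) → Fin n → List (Fin n) → List (Fin n) → Set
    ExtendSite B p pre []         = ⊥
    ExtendSite B p pre (u ∷ post) = edge p u ∉ B

    extendSite? : ∀ B p pre post → Dec (ExtendSite B p pre post)
    extendSite? B p pre []         = no λ ()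
    extendSite? B p pre (u ∷ post) = avail? B p u

    CloseEnd : ℕ → List (Edge n) → Fin n → List (Fin n) → List (Fin n) → Set
    CloseEnd s B a β []      = ⊥
    CloseEnd s B a β (z ∷ γ) = length γ < s × edge a z ∉ B

    closeEnd? : ∀ s B a β γ → Dec (CloseEnd s B a β γ)
    closeEnd? s B a β []      = no λ ()
    closeEnd? s B a β (z ∷ γ) = (length γ ℕ.<? s) ×-dec avail? B a z

    CloseSite : ℕ → List (Edge n) → List (Fin n) → List (Fin n) → Set
    CloseSite s B α []      = ⊥
    CloseSite s B α (a ∷ r) = length α < s × (∃₂ λ β γ → r ≡ β ++ γ × CloseEnd s B a β γ)

    closeSite? : ∀ s B α r → Dec (CloseSite s B α r)
    closeSite? s B α []      = no λ ()
    closeSite? s B α (a ∷ r) = (length α ℕ.<? s) ×-dec split? (closeEnd? s B a) r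

    InsertEnd : List (Edge n) → Fin n → Fin n → List (Fin n) → List (Fin n) → Set
    InsertEnd B y a′ β []           = ⊥
    InsertEnd B y a′ β (b ∷ [])     = ⊥
    InsertEnd B y a′ β (b ∷ b′ ∷ γ) = edge y b ∉ B × edge a′ b′ ∉ B

    insertEnd? : ∀ B y a′ β γ → Dec (InsertEnd B y a′ β γ)
    insertEnd? B y a′ β []           = no λ ()
    insertEnd? B y a′ β (b ∷ [])     = no λ ()
    insertEnd? B y a′ β (b ∷ b′ ∷ γ) = avail? B y b ×-dec avail? B a′ b′

    InsertSite : List (Edge n) → Fin n → List (Fin n) → List (Fin n) → Set
    InsertSite B y α []           = ⊥
    InsertSite B y α (a ∷ [])     = ⊥
    InsertSite B y α (a ∷ a′ ∷ r) = edge y a ∉ B × (∃₂ λ β γ → r ≡ β ++ γ × InsertEnd B y a′ β γ)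

    insertSite? : ∀ B y α r → Dec (InsertSite B y α r)
    insertSite? B y α []           = no λ ()
    insertSite? B y α (a ∷ [])     = no λ ()
    insertSite? B y α (a ∷ a′ ∷ r) = avail? B y a ×-dec split? (insertEnd? B y a′) r

    -- Depth-first search: an end of the path without an available edge to U is dead and is
    -- moved to D. If the path is used up, the returned move is arbitrary.
    extend : List (Edge n) → (P U D : List (Fin n)) → State n
    extend B []      []      D = [] , path [] [] D
    extend B []      (u ∷ U) D = [] , path [ u ] U D
    extend B (p ∷ P) U       D with split? (extendSite? B p) U
    ... | yes (pre , [] , _ , ())
    ... | yes (pre , u ∷ post , _ , _) = [ edge p u ] , path (u ∷ p ∷ P) (pre ++ post) D
    ... | no _                         = extend B P U (p ∷ D)

    close : ℕ → List (Edge n) → (P left : List (Fin n)) → State n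
    close s B P left with split? (closeSite? s B) P
    ... | yes (α , [] , _ , ())
    ... | yes (α , a ∷ r , _ , _ , β , [] , _ , ())
    ... | yes (α , a ∷ r , _ , _ , β , z ∷ γ , _ , _) = [ edge a z ] , cycle (a ∷ β ++ [ z ]) (left ++ α ++ γ)
    ... | no _ = [] , path P [] left

    -- α a a′ β b b′ γ becomes α a y b (reverse β) a′ b′ γ.
    insert : List (Edge n) → Fin n → (c left : List (Fin n)) → State n
    insert B y c left with split? (insertSite? B y) c
    ... | yes (α , [] , _ , ())
    ... | yes (α , a ∷ [] , _ , ())
    ... | yes (α , a ∷ a′ ∷ r , _ , _ , β , [] , _ , ())
    ... | yes (α , a ∷ a′ ∷ r , _ , _ , β , b ∷ [] , _ , ())
    ... | yes (α , a ∷ a′ ∷ r , _ , _ , β , b ∷ b′ ∷ γ , _ , _) =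
      -- The head of the list is claimed in the same move; the other two wait one and two rounds.
      edge y a ∷ edge y b ∷ edge a′ b′ ∷ [] ,
      cycle (α ++ a ∷ y ∷ b ∷ reverse β ++ a′ ∷ b′ ∷ γ) left
    ... | no _ = [] , cycle c left

    plan : ℕ → List (Edge n) → Stage n → State n
    plan s B (path P U D) with s ℕ.≤? length U
    ... | yes _ = extend B P U D
    ... | no _  = close s B P (U ++ D)
    plan s B (cycle c [])         = [] , cycle c []
    plan s B (cycle c (y ∷ left)) = insert B y c left

    expand : ℕ → List (Edge n) → State n → State n
    expand s B ([] , st)     = plan s B st
    expand s B (e ∷ es , st) = e ∷ es , st

open Planning

-- Every move of the plan succeeds and decreases the count of rounds and the debt.

module Progress where

  open import Data.Nat using (_≤_; _<_; _+_; _*_)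
  open import Data.Nat.Solver using (module +-*-Solver)

  -- The total exposure of `k` planned edges claimed one per move: `k - 1` of them wait through the
  -- first round, `k - 2` through the next, and so on.
  tri : ℕ → ℕ
  tri zero    = 0
  tri (suc k) = k + tri k

  module Strategic {n : ℕ} (s : ℕ) (1≤s : 1 ≤ s) (4s≤n : 4 * s ≤ n) where

    record Good (B : List (Edge n)) : Set where
      field
        pairs : ∀ S T → s ≤ length S → s ≤ length T → Unique S → Unique T → (∀ {x} → x ∈ S → x ∉ T) →
                ∃₂ λ u v → u ∈ S × v ∈ T × edge u v ∉ B
        -- The bound `6 * s + 1` is `2 * s + 1`, one less than the number of available neighbours
        -- wanted on the cycle, plus `4 * s` vertices not on the cycle.
        star  : ∀ y A → y ∈ A → length A ≤ 6 * s + 1 → ∃ λ v → v ∉ A × edge y v ∉ B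

    data Sound (G B : List (Edge n)) : Stage n → Set where
      path  : ∀ {P U D} → P ++ U ++ D ↭ allFin n → Linked (Adj G) P → length D ≤ s →
              (∀ {d u} → d ∈ D → u ∈ U → edge d u ∈ B) → Sound G B (path P U D)
      cycle : ∀ {c left} → c ++ left ↭ allFin n → Linked (Adj G) c → Closes G c →
              length left ≤ 4 * s → Sound G B (cycle c left)

    -- A bound for Maker's remaining moves: one for each planned edge and each unvisited vertex, one
    -- to close the cycle, and three for each of at most `4 * s` insertions.
    rounds : State n → ℕ
    rounds (es , path P U D)    = length es + (length U + suc (12 * s))
    rounds (es , cycle c left)  = length es + 3 * length left

    -- An edge that has to survive i rounds of Breaker contributes i; the 3 = 2 + 1 per vertex left over
    -- and the 12 s = 3 · 4 s are the insertions to come.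
    debt : State n → ℕ
    debt (es , path P U D)    = tri (length es) + 12 * s
    debt (es , cycle c left)  = tri (length es) + 3 * length left

    settle : State n → State n
    settle (es , st) = drop 1 es , st

    -- Soundness refers to the graph with all planned edges already in it. After the move, `settle`
    -- removes the edge just claimed; those that remain wait through the coming round of Breaker,
    -- and `cheaper` pays for this round out of the debt.
    record Progress (M B : List (Edge n)) (σ σ′ : State n) : Set where
      constructor progress
      field
        sound   : Sound (M ++ proj₁ σ′) B (proj₂ σ′)
        legal   : ∀ {e} → e ∈ proj₁ σ′ → e ∈ allEdges n × e ∉ B
        faster  : suc (rounds (settle σ′)) ≤ rounds σ
        cheaper : length (drop 1 (proj₁ σ′)) + debt (settle σ′) ≤ debt σ

    private
      module ↭S = CMS (↭P.++-commutativeMonoid {A = Fin n})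

      unique-of : ∀ {l : List (Fin n)} → l ↭ allFin n → Unique l
      unique-of p = unique-↭ (↭-sym p) (UP.allFin⁺ n)

      covers : ∀ {l : List (Fin n)} → l ↭ allFin n → ∀ v → v ∈ l
      covers p v = ↭P.∈-resp-↭ (↭-sym p) (∈P.∈-allFin v)

      length-of : ∀ {l : List (Fin n)} → l ↭ allFin n → length l ≡ n
      length-of p = trans (↭P.↭-length p) length-allFin

      linked-mono : ∀ {M N : List (Edge n)} {c} → Linked (Adj M) c → Linked (Adj (M ++ N)) c
      linked-mono = Linked.map (adj-mono ∈P.∈-++⁺ˡ)

      last-adj : ∀ M {u v : Fin n} {es} → edge u v ∈ es → Adj (M ++ es) u v
      last-adj M i = edge-adj (∈P.∈-++⁺ʳ M i)

    module _ {M B : List (Edge n)} (good : Good B) where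

      open Good good

      extend-progress : ∀ P U D → Sound M B (path P U D) → s ≤ length U →
                        Progress M B ([] , path P U D) (extend B P U D)
      extend-progress [] [] D _ s≤U = ⊥-elim (ℕP.<-irrefl refl (ℕP.≤-trans 1≤s s≤U))
      extend-progress [] (u ∷ U) D (path p l d dead) s≤U = progress
        (path p [-] d (λ i j → dead i (there j))) (λ ()) ℕP.≤-refl ℕP.≤-refl
      extend-progress (p ∷ P) U D (path perm l d dead) s≤U with split? (extendSite? B p) U
      ... | yes (pre , [] , _ , ())
      ... | yes (pre , u ∷ post , refl , avail) = progress
        (path (↭-trans (↭S.solve 6 (λ u p P a b D → (u ↭S.⊕ p ↭S.⊕ P) ↭S.⊕ (a ↭S.⊕ b) ↭S.⊕ D ↭S.⊜ (p ↭S.⊕ P) ↭S.⊕ (a ↭S.⊕ u ↭S.⊕ b) ↭S.⊕ D)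
                 ↭-refl [ u ] [ p ] P pre post D) perm)
              (adj-sym (last-adj M (here refl)) ∷ linked-mono l) d
              (λ i j → dead i (old j)))
        (λ { (here refl) → edge-∈ p≢u , avail })
        (ℕP.≤-reflexive (cong (_+ suc (12 * s)) (sym (LP.length-++-sucʳ pre u post)))) ℕP.≤-refl
        where
        old : ∀ {x} → x ∈ pre ++ post → x ∈ pre ++ u ∷ post
        old j with ∈P.∈-++⁻ pre j
        ... | inj₁ k = ∈P.∈-++⁺ˡ k
        ... | inj₂ k = ∈P.∈-++⁺ʳ pre (there k)
        p≢u : p ≢ u
        p≢u refl = unique-head (unique-of perm) (∈P.∈-++⁺ʳ P (∈P.∈-++⁺ˡ (∈P.∈-insert pre)))
      ... | no none with length (p ∷ D) ℕ.≤? s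
      ...   | yes d′ = extend-weaken (extend-progress P U (p ∷ D) (path
                (↭-trans (↭S.solve 4 (λ p P U D → P ↭S.⊕ U ↭S.⊕ p ↭S.⊕ D ↭S.⊜ (p ↭S.⊕ P) ↭S.⊕ U ↭S.⊕ D) ↭-refl [ p ] P U D) perm)
                (Linked.tail l) d′ dead′) s≤U)
        where
        dead′ : ∀ {d u} → d ∈ p ∷ D → u ∈ U → edge d u ∈ B
        dead′ (there i)   j = dead i j
        dead′ {u = u} (here refl) j with ∈P.∈-∃++ j
        ... | pre , post , refl = decidable-stable (edge p u ∈ₑ? B) (λ a → none (pre , u ∷ post , refl , a))
        extend-weaken : ∀ {σ} → Progress M B ([] , path P U (p ∷ D)) σ → Progress M B ([] , path (p ∷ P) U D) σ
        extend-weaken (progress a b c d) = progress a b c d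
      -- More than `s` dead vertices facing at least `s` unvisited ones would have an available edge
      -- between them. It cannot start at an old dead vertex, nor at `p`, where none was found.
      ...   | no d≰s with pairs (p ∷ D) U (ℕP.<⇒≤ (ℕP.≰⇒> d≰s)) s≤U uD uU disj
        where
        u₀ : Unique ((p ∷ P) ++ U ++ D)
        u₀ = unique-of perm
        u₁ : Unique (U ++ D)
        u₁ = unique-++⁻ʳ (p ∷ P) u₀
        uU : Unique U
        uU = unique-++⁻ˡ U u₁
        uD : Unique (p ∷ D)
        uD = unique-∷ (λ i → unique-head u₀ (∈P.∈-++⁺ʳ P (∈P.∈-++⁺ʳ U i))) (unique-++⁻ʳ U u₁)
        disj : ∀ {x} → x ∈ p ∷ D → x ∉ U
        disj (here refl) j = unique-head u₀ (∈P.∈-++⁺ʳ P (∈P.∈-++⁺ˡ j))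
        disj (there i)   j = unique-disjoint U u₁ j i
      ...     | _ , v , there i   , j , a = ⊥-elim (a (dead i j))
      ...     | _ , v , here refl , j , a with ∈P.∈-∃++ j
      ...       | pre , post , refl = ⊥-elim (none (pre , v ∷ post , refl , a))

      private
        ends : ∀ (P : List (Fin n)) → 2 * s ≤ length P →
               Σ (List (Fin n)) λ A → ∃₂ λ R Z → P ≡ A ++ R ++ Z × length A ≡ s × length Z ≡ s
        ends P P≥2s with split-length s P (ℕP.≤-trans (ℕP.m≤n*m s 2) P≥2s)
        ... | A , rest , refl , lenA with split-length (length rest ℕ.∸ s) rest (ℕP.m∸n≤m _ s)
        ...   | R , Z , eq , lenR = A , R , Z , cong (A ++_) eq , lenA ,
          ℕP.+-cancelˡ-≡ (length R) _ _ (trans (sym (LP.length-++ R))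
            (trans (cong length (sym eq)) (trans (sym (ℕP.m∸n+n≡m s≤rest)) (cong (_+ s) (sym lenR)))))
          where
          s≤rest : s ≤ length rest
          s≤rest = ℕP.+-cancelˡ-≤ s _ _ (subst₂ _≤_ (cong (s +_) (ℕP.+-identityʳ s))
            (trans (LP.length-++ A) (cong (_+ length rest) lenA)) P≥2s)

        -- Fewer than `s` vertices are unvisited and at most `s` are dead, so `4 * s ≤ n` leaves
        -- `2 * s` on the path: its first `s` and last `s` vertices are disjoint.
        close-site : ∀ {P U D} → Sound M B (path P U D) → length U < s →
                     ∃₂ λ α r → P ≡ α ++ r × CloseSite s B α r
        close-site {P} {U} {D} (path perm l d dead) U<s with ends P P≥2s
          where
          P≥2s : 2 * s ≤ length P
          P≥2s = ℕP.+-cancelʳ-≤ (2 * s) _ _ (begin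
            2 * s + 2 * s                        ≡⟨ solve 1 (λ s → con 2 :* s :+ con 2 :* s := con 4 :* s) refl s ⟩
            4 * s                                ≤⟨ 4s≤n ⟩
            n                                    ≡⟨ length-of perm ⟨
            length (P ++ U ++ D)                 ≡⟨ trans (LP.length-++ P) (cong (length P +_) (LP.length-++ U)) ⟩
            length P + (length U + length D)     ≤⟨ ℕP.+-monoʳ-≤ (length P) (ℕP.+-mono-≤ (ℕP.<⇒≤ U<s) d) ⟩
            length P + (s + s)                   ≡⟨ cong (λ z → length P + (s + z)) (ℕP.+-identityʳ s) ⟨
            length P + 2 * s                     ∎)
            where open ℕP.≤-Reasoning
                  open +-*-Solver
        ... | A , R , Z , refl , lenA , lenZ
          with pairs A Z (ℕP.≤-reflexive (sym lenA)) (ℕP.≤-reflexive (sym lenZ)) uA uZ disj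
          where
          u₀ : Unique (A ++ R ++ Z)
          u₀ = unique-++⁻ˡ (A ++ R ++ Z) (unique-of perm)
          uA : Unique A
          uA = unique-++⁻ˡ A u₀
          uZ : Unique Z
          uZ = unique-++⁻ʳ R (unique-++⁻ʳ A u₀)
          disj : ∀ {x} → x ∈ A → x ∉ Z
          disj i j = unique-disjoint A u₀ i (∈P.∈-++⁺ʳ R j)
        ...   | a , z , i , j , avail with ∈P.∈-∃++ i | ∈P.∈-∃++ j
        ...     | α , α′ , refl | ζ , γ , refl =
          α , a ∷ α′ ++ R ++ ζ ++ z ∷ γ , LP.++-assoc α (a ∷ α′) _ ,
          subst (suc (length α) ≤_) (trans (sym (LP.length-++-sucʳ α a α′)) lenA) (s≤s (LP.length-++-≤ˡ α)) ,
          α′ ++ R ++ ζ , z ∷ γ ,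
          trans (cong (α′ ++_) (sym (LP.++-assoc R ζ (z ∷ γ)))) (sym (LP.++-assoc α′ (R ++ ζ) (z ∷ γ))) ,
          subst (suc (length γ) ≤_) lenZ (LP.length-++-≤ʳ (z ∷ γ) {xs = ζ}) , avail

      close-progress : ∀ P U D → Sound M B (path P U D) → length U < s →
                       Progress M B ([] , path P U D) (close s B P (U ++ D))
      close-progress P U D sound U<s with split? (closeSite? s B) P
      ... | no none = ⊥-elim (none (close-site sound U<s))
      ... | yes (α , [] , _ , ())
      ... | yes (α , a ∷ r , _ , _ , β , [] , _ , ())
      close-progress P U D (path perm l d _) U<s | yes (α , a ∷ _ , refl , α<s , β , z ∷ γ , refl , γ<s , avail) = progress
        (cycle (↭-trans (↭S.solve 7 (λ a β z U D α γ → (a ↭S.⊕ β ↭S.⊕ z) ↭S.⊕ (U ↭S.⊕ D) ↭S.⊕ α ↭S.⊕ γ ↭S.⊜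
                    (α ↭S.⊕ a ↭S.⊕ β ↭S.⊕ z ↭S.⊕ γ) ↭S.⊕ U ↭S.⊕ D) ↭-refl [ a ] β [ z ] U D α γ) perm)
               (linked-mono (linked-++⁻ˡ (a ∷ β ++ [ z ]) (subst (Linked (Adj M)) (sym (LP.++-assoc (a ∷ β) [ z ] γ)) (linked-++⁻ʳ α l))))
               (subst (λ v → Adj (M ++ [ edge a z ]) v a) (sym (lastOr-++ a β)) (adj-sym (last-adj M (here refl))))
               left≤)
        (λ { (here refl) → edge-∈ a≢z , avail })
        (begin
          suc (3 * length left)   ≤⟨ s≤s (ℕP.*-monoʳ-≤ 3 left≤) ⟩
          suc (3 * (4 * s))       ≡⟨ cong suc (sym (ℕP.*-assoc 3 4 s)) ⟩
          suc (12 * s)            ≤⟨ ℕP.m≤n+m _ (length U) ⟩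
          length U + suc (12 * s) ∎)
        (begin
          3 * length left         ≤⟨ ℕP.*-monoʳ-≤ 3 left≤ ⟩
          3 * (4 * s)             ≡⟨ ℕP.*-assoc 3 4 s ⟨
          12 * s                  ∎)
        where
        open ℕP.≤-Reasoning
        left = (U ++ D) ++ α ++ γ
        left≤ : length left ≤ 4 * s
        left≤ = begin
          length left                                       ≡⟨ trans (LP.length-++ (U ++ D)) (cong₂ _+_ (LP.length-++ U) (LP.length-++ α)) ⟩
          length U + length D + (length α + length γ)       ≤⟨ ℕP.+-mono-≤ (ℕP.+-mono-≤ (ℕP.<⇒≤ U<s) d) (ℕP.+-mono-≤ (ℕP.<⇒≤ α<s) (ℕP.<⇒≤ γ<s)) ⟩
          s + s + (s + s)                                   ≡⟨ solve 1 (λ s → s :+ s :+ (s :+ s) := con 4 :* s) refl s ⟩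
          4 * s                                             ∎
          where open +-*-Solver
        a≢z : a ≢ z
        a≢z refl = unique-head (unique-++⁻ʳ α (unique-++⁻ˡ (α ++ a ∷ β ++ z ∷ γ) (unique-of perm))) (∈P.∈-insert β)

      private
        available? : ∀ y v → Dec (edge y v ∉ B)
        available? y v = ¬? (edge y v ∈ₑ? B)

        -- Otherwise the available neighbours of `y` on the cycle, together with all vertices off
        -- the cycle, form a set small enough for `star`, which then gives an available neighbour
        -- that is nowhere.
        many-available : ∀ {y c left} → Sound M B (cycle c (y ∷ left)) → suc s + suc s ≤ length (filter (available? y) c)
        many-available {y} {c} {left} (cycle perm _ _ left≤) with suc s + suc s ℕ.≤? length (filter (available? y) c)
        ... | yes le = le
        ... | no ≰ with star y (filter (available? y) c ++ y ∷ left) (∈P.∈-++⁺ʳ (filter (available? y) c) (here refl)) (begin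
            length (filter (available? y) c ++ y ∷ left)         ≡⟨ LP.length-++ (filter (available? y) c) ⟩
            length (filter (available? y) c) + length (y ∷ left) ≤⟨ ℕP.+-mono-≤ (ℕP.≤-pred (ℕP.≰⇒> ≰)) left≤ ⟩
            s + suc s + 4 * s                        ≡⟨ solve 1 (λ s → s :+ (con 1 :+ s) :+ con 4 :* s := con 6 :* s :+ con 1) refl s ⟩
            6 * s + 1                                ∎)
            where open ℕP.≤-Reasoning
                  open +-*-Solver
        ...   | v , v∉ , avail with ∈P.∈-++⁻ c (covers perm v)
        ...     | inj₁ i = ⊥-elim (v∉ (∈P.∈-++⁺ˡ (∈P.∈-filter⁺ (available? y) i avail)))
        ...     | inj₂ i = ⊥-elim (v∉ (∈P.∈-++⁺ʳ (filter (available? y) c) i))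

        -- The cycle is cut into two parts, each with at least `s + 1` available neighbours of `y`.
        -- Applying `pairs` not to these but to their successors yields the chord from `a′` to `b′`
        -- of the rotation, and the cut ensures that `a` and `a′` come before `b` and `b′`.
        insert-site : ∀ {y c left} → Sound M B (cycle c (y ∷ left)) → ∃₂ λ α r → c ≡ α ++ r × InsertSite B y α r
        insert-site {y} {c} {left} sound@(cycle perm _ _ _)
          with split-count (available? y) (suc s) c (ℕP.≤-trans (ℕP.m≤m+n (suc s) (suc s)) (many-available sound))
        ... | c₁ , c₂ , refl , count₁
          with pairs (successors (available? y) c₁) (successors (available? y) c₂) s≤₁ s≤₂
                (successors-unique (available? y) c₁ (unique-++⁻ˡ c₁ u₀)) (successors-unique (available? y) c₂ (unique-++⁻ʳ c₁ u₀))
                (λ i j → unique-disjoint c₁ u₀ (successors-∈ (available? y) c₁ i) (successors-∈ (available? y) c₂ j))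
          where
          u₀ : Unique (c₁ ++ c₂)
          u₀ = unique-++⁻ˡ (c₁ ++ c₂) (unique-of perm)
          count₂ : suc s ≤ length (filter (available? y) c₂)
          count₂ = ℕP.+-cancelˡ-≤ (suc s) _ _ (subst (suc s + suc s ≤_)
            (trans (cong length (LP.filter-++ (available? y) c₁ c₂))
              (trans (LP.length-++ (filter (available? y) c₁)) (cong (_+ length (filter (available? y) c₂)) count₁)))
            (many-available sound))
          s≤₁ : s ≤ length (successors (available? y) c₁)
          s≤₁ = ℕP.≤-pred (subst (_≤ suc (length (successors (available? y) c₁))) count₁ (successors-length (available? y) c₁))
          s≤₂ : s ≤ length (successors (available? y) c₂)
          s≤₂ = ℕP.≤-pred (ℕP.≤-trans count₂ (successors-length (available? y) c₂))
        ...   | a′ , b′ , i , j , avail with predecessor (available? y) c₁ i | predecessor (available? y) c₂ j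
        ...     | α , a , β₁ , refl , ya | β₂ , b , γ , refl , yb =
          α , a ∷ a′ ∷ β₁ ++ β₂ ++ b ∷ b′ ∷ γ , LP.++-assoc α (a ∷ a′ ∷ β₁) _ ,
          ya , β₁ ++ β₂ , b ∷ b′ ∷ γ , sym (LP.++-assoc β₁ β₂ _) , yb , avail

      insert-progress : ∀ y c left → Sound M B (cycle c (y ∷ left)) →
                        Progress M B ([] , cycle c (y ∷ left)) (insert B y c left)
      insert-progress y c left sound with split? (insertSite? B y) c
      ... | no none = ⊥-elim (none (insert-site sound))
      ... | yes (α , [] , _ , ())
      ... | yes (α , a ∷ [] , _ , ())
      ... | yes (α , a ∷ a′ ∷ r , _ , _ , β , [] , _ , ())
      ... | yes (α , a ∷ a′ ∷ r , _ , _ , β , b ∷ [] , _ , ())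
      insert-progress y c left (cycle perm l cl left≤)
        | yes (α , a ∷ a′ ∷ _ , refl , ya , β , b ∷ b′ ∷ γ , refl , yb , a′b′) = progress
        (cycle (↭-trans (↭-trans (↭P.++⁺ʳ left (↭P.++⁺ˡ α (↭P.++⁺ˡ (a ∷ y ∷ b ∷ []) (↭P.++⁺ʳ (a′ ∷ b′ ∷ γ) (↭P.↭-reverse β)))))
                  (↭S.solve 9 (λ α a y b β a′ b′ γ left →
                    (α ↭S.⊕ a ↭S.⊕ y ↭S.⊕ b ↭S.⊕ β ↭S.⊕ a′ ↭S.⊕ b′ ↭S.⊕ γ) ↭S.⊕ left ↭S.⊜
                    (α ↭S.⊕ a ↭S.⊕ a′ ↭S.⊕ β ↭S.⊕ b ↭S.⊕ b′ ↭S.⊕ γ) ↭S.⊕ y ↭S.⊕ left)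
                    ↭-refl α [ a ] [ y ] [ b ] β [ a′ ] [ b′ ] γ left)) perm)
               (linked-replace α (linked-mono l)
                 (adj-sym (last-adj M (here refl)) ∷ last-adj M (there (here refl)) ∷
                   linked-replace (b ∷ reverse β) reversed (last-adj M (there (there (here refl))) ∷ Linked.tail tail-b)))
               (subst (Closes _) (cong (λ z → α ++ a ∷ y ∷ b ∷ z) (LP.++-assoc (reverse β) [ a′ ] (b′ ∷ γ)))
                 (closes-replace α {a} {a′ ∷ β} {b} {b′ ∷ γ} {y ∷ b ∷ reverse β ++ [ a′ ]} {b′} {γ} refl (closes-mono c₀ cl)))
               (ℕP.≤-trans (ℕP.n≤1+n _) left≤))
        legal
        (ℕP.≤-reflexive (sym (ℕP.*-suc 3 (length left))))
        (ℕP.≤-reflexive (sym (ℕP.*-suc 3 (length left))))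
        where
        new = edge y a ∷ edge y b ∷ edge a′ b′ ∷ []
        c₀ = α ++ a ∷ a′ ∷ β ++ b ∷ b′ ∷ γ
        u₀ : Unique (c₀ ++ y ∷ left)
        u₀ = unique-of perm
        y∉ : y ∉ c₀
        y∉ i = unique-disjoint c₀ u₀ i (here refl)
        closes-mono : ∀ c → Closes M c → Closes (M ++ new) c
        closes-mono (x ∷ c) = adj-mono ∈P.∈-++⁺ˡ
        l₁ : Linked (Adj (M ++ new)) (a′ ∷ β ++ b ∷ b′ ∷ γ)
        l₁ = Linked.tail (linked-++⁻ʳ α (linked-mono l))
        tail-b : Linked (Adj (M ++ new)) (b ∷ b′ ∷ γ)
        tail-b = linked-++⁻ʳ (a′ ∷ β) l₁
        reversed : Linked (Adj (M ++ new)) (b ∷ reverse β ++ [ a′ ])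
        reversed = subst (Linked (Adj (M ++ new)))
          (trans (LP.reverse-++ (a′ ∷ β) [ b ]) (cong (b ∷_) (LP.unfold-reverse a′ β)))
          (linked-reverse adj-sym (linked-++⁻ˡ (a′ ∷ β ++ [ b ])
            (subst (Linked (Adj (M ++ new))) (sym (LP.++-assoc (a′ ∷ β) [ b ] (b′ ∷ γ))) l₁)))
        legal : ∀ {e} → e ∈ new → e ∈ allEdges n × e ∉ B
        legal (here refl) = edge-∈ (λ { refl → y∉ (∈P.∈-insert α) }) , ya
        legal (there (here refl)) = edge-∈ (λ { refl → y∉ (∈P.∈-++⁺ʳ α (there (there (∈P.∈-insert β)))) }) , yb
        legal (there (there (here refl))) = edge-∈ (λ { refl → unique-head
          (unique-++⁻ʳ (α ++ [ a ]) (subst Unique (sym (LP.++-assoc α [ a ] _)) (unique-++⁻ˡ c₀ u₀)))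
          (∈P.∈-++⁺ʳ β (there (here refl))) }) , a′b′

      Finished : State n → Set
      Finished σ = ∃ λ c → σ ≡ ([] , cycle c [])

      expand-progress : ∀ pend st → Sound (M ++ pend) B st → (∀ {e} → e ∈ pend → e ∈ allEdges n × e ∉ B) →
                        Finished (pend , st) ⊎ Progress M B (pend , st) (expand s B (pend , st))
      expand-progress (e ∷ pend) (path P U D)   sound legal = inj₂ (progress sound legal ℕP.≤-refl
        (ℕP.≤-reflexive (sym (ℕP.+-assoc (length pend) (tri (length pend)) (12 * s)))))
      expand-progress (e ∷ pend) (cycle c left) sound legal = inj₂ (progress sound legal ℕP.≤-refl
        (ℕP.≤-reflexive (sym (ℕP.+-assoc (length pend) (tri (length pend)) (3 * length left)))))
      expand-progress [] (cycle c [])         sound legal = inj₁ (c , refl)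
      expand-progress [] (cycle c (y ∷ left)) sound legal =
        inj₂ (insert-progress y c left (subst (λ G → Sound G B _) (LP.++-identityʳ M) sound))
      expand-progress [] (path P U D)         sound legal with s ℕ.≤? length U
      ... | yes s≤U = inj₂ (extend-progress P U D (subst (λ G → Sound G B _) (LP.++-identityʳ M) sound) s≤U)
      ... | no s≰U  = inj₂ (close-progress P U D (subst (λ G → Sound G B _) (LP.++-identityʳ M) sound) (ℕP.≰⇒> s≰U))

    sound-mono : ∀ {G H B C st} → (∀ {e} → e ∈ G → e ∈ H) → (∀ {e} → e ∈ B → e ∈ C) → Sound G B st → Sound H C st
    sound-mono G⊆H B⊆C (path p l d dead) = path p (Linked.map (adj-mono G⊆H) l) d (λ i j → B⊆C (dead i j))
    sound-mono G⊆H B⊆C (cycle {c} p l cl left≤) = cycle p (Linked.map (adj-mono G⊆H) l) (closes c cl) left≤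
      where
      closes : ∀ c → Closes _ c → Closes _ c
      closes (x ∷ c) = adj-mono G⊆H

    finished⇒hamiltonian : ∀ {G B c} → 3 ≤ n → Sound G B (cycle c []) → Hamiltonian G
    finished⇒hamiltonian {c = c} 3≤n (cycle p l cl _) = c , 3≤n , covers p′ , unique-of p′ , l , cl
      where
      p′ : c ↭ allFin n
      p′ = subst (_↭ allFin n) (LP.++-identityʳ c) p

open Progress

-- The strategy as a function of the position, and the risk along the game.

module Playing where

  open import Data.Rational using (_≤_; _+_; _*_; _-_)
  open import Data.Rational.Solver using (module +-*-Solver)

  take-++-≤ : ∀ {A : Set} k (xs : List A) {ys} → k ℕ.≤ length xs → take k (xs ++ ys) ≡ take k xs
  take-++-≤ zero    xs       le       = refl
  take-++-≤ (suc k) (x ∷ xs) (s≤s le) = cong (x ∷_) (take-++-≤ k xs le)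

  aim : ∀ {n} → List (Edge n) → List (Edge n) → ℕ
  aim []       F = 0
  aim (e ∷ es) F = position _≟ₑ_ e F

  module _ {n : ℕ} (s b : ℕ) where

    -- Maker's state before round r, replayed from Breaker's history: in round i Maker saw the
    -- first i * b edges of Breaker.
    stateAt : ℕ → List (Edge n) → State n
    stateAt zero    B = [] , path [] (allFin n) []
    stateAt (suc r) B with expand s (take (r ℕ.* b) B) (stateAt r B)
    ... | es , st = drop 1 es , st

    -- The planned edge depends on Maker's own edges only through their number, which tells the
    -- round; the free edges serve to turn it into an index.
    strategy : Strategy n
    strategy M B = aim (proj₁ (expand s B (stateAt (length M) B))) (freeEdges M B)

    -- The replay up to Maker's move of round `r` reads only the first `r * b` picks, so picks made
    -- during the running round do not alter the state.
    stateAt-stable : ∀ r B {e} → r ℕ.* b ℕ.≤ length B → stateAt (suc r) (B ++ [ e ]) ≡ stateAt (suc r) B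
    stateAt-stable zero    B le = refl
    stateAt-stable (suc r) B le = cong₂ (λ C σ → drop 1 (proj₁ (expand s C σ)) , proj₂ (expand s C σ))
      (take-++-≤ (suc r ℕ.* b) B le) (stateAt-stable r B (ℕP.≤-trans (ℕP.m≤n+m _ b) le))

  module Play {n : ℕ} (s b l : ℕ) (1≤s : 1 ℕ.≤ s) (4s≤n : 4 ℕ.* s ℕ.≤ n) (3≤n : 3 ℕ.≤ n)
    (𝓕 : List (List (Edge n))) (unique-𝓕 : ∀ {X} → X ∈ 𝓕 → Unique X)
    (good : ∀ {B} → (∀ {X} → X ∈ 𝓕 → ¬ (∀ {e} → e ∈ X → e ∈ B)) → Strategic.Good s 1≤s 4s≤n B)
    (P : List (Edge n) → Set) (P? : ∀ G → Dec (P G)) (hamiltonian⇒P : ∀ {G} → Hamiltonian G → P G)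
    where

    open Strategic {n} s 1≤s 4s≤n

    private
      S : Strategy n
      S = strategy s b

      E : ℕ
      E = length (allEdges n)

      g : List (Edge n) → ℚ
      g G = indicator (P? G)

      -- One edge waiting through one round is charged `odds l b`, which bounds its loss because
      -- more than `l + b` edges are free when the round's picks begin.
      debts : State n → ℚ
      debts σ = ι (debt σ) * odds l b

      risk : ℕ → List (Edge n) → State n → ℚ
      risk m B σ = ΣΨ 𝓕 B (odds l (m ℕ.* b)) + debts σ

      -- The same potential for singletons, but with the end of the current round as its horizon. An
      -- edge that has to wait longer is charged again, out of the debt, in the next round.
      pendingRisk : ℕ → State n → List (Edge n) → ℚ
      pendingRisk k σ B = ΣΨ (map [_] (proj₁ σ)) B (odds l k)

      turnRisk : ℕ → ℕ → State n → List (Edge n) → ℚ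
      turnRisk m k σ B = ΣΨ 𝓕 B (odds l (k ℕ.+ m ℕ.* b)) + (pendingRisk k σ B + debts σ)

      -- m₀ is the number of rounds Maker still allows herself.
      data 𝒱 (m : ℕ) (M B : List (Edge n)) (v : ℚ) : Set where
        won  : Hamiltonian M → v ≤ 1ℚ → 𝒱 m M B v
        lost : v ≤ 0ℚ → 𝒱 m M B v
        live : ∀ m₀ σ → m₀ ℕ.≤ m → length B ≡ length M ℕ.* b → σ ≡ stateAt s b (length M) B →
               Sound (M ++ proj₁ σ) B (proj₂ σ) → (∀ {e} → e ∈ proj₁ σ → e ∈ allEdges n × e ∉ B) →
               rounds σ ℕ.≤ m₀ → length M ℕ.+ length B ℕ.+ (m₀ ℕ.* suc b ℕ.+ suc l) ℕ.≤ E →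
               v ≤ 1ℚ - risk m₀ B σ → 𝒱 m M B v

      -- Unlike before Maker's move, the planned edges need not avoid `B`: Breaker may hit one in
      -- mid-round. The loss is noticed at the end of the round.
      data 𝒲 (m k : ℕ) (M B : List (Edge n)) (v : ℚ) : Set where
        won  : Hamiltonian M → v ≤ 1ℚ → 𝒲 m k M B v
        lost : v ≤ 0ℚ → 𝒲 m k M B v
        live : ∀ m₀ r σ → m₀ ℕ.≤ m → k ℕ.≤ b → length M ≡ suc r → length B ℕ.+ k ≡ suc r ℕ.* b →
               σ ≡ stateAt s b (suc r) B →
               Sound (M ++ proj₁ σ) B (proj₂ σ) → (∀ {e} → e ∈ proj₁ σ → e ∈ allEdges n) →
               rounds σ ℕ.≤ m₀ → length M ℕ.+ length B ℕ.+ (k ℕ.+ m₀ ℕ.* suc b ℕ.+ suc l) ℕ.≤ E →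
               v ≤ 1ℚ - turnRisk m₀ k σ B → 𝒲 m k M B v

      0≤debts : ∀ σ → 0ℚ ≤ debts σ
      0≤debts σ = 0≤* (0≤ι _) (0≤odds l b)

      0≤risk : ∀ m B σ → 0ℚ ≤ risk m B σ
      0≤risk m B σ = 0≤+ (0≤ΣΨ 𝓕 B (0≤odds l _)) (0≤debts σ)

      0≤pending : ∀ k σ B → 0ℚ ≤ pendingRisk k σ B
      0≤pending k σ B = 0≤ΣΨ (map [_] (proj₁ σ)) B (0≤odds l k)

      1-‿anti : ∀ {p q} → p ≤ q → 1ℚ - q ≤ 1ℚ - p
      1-‿anti p≤q = ℚP.+-monoʳ-≤ 1ℚ (ℚP.neg-antimono-≤ p≤q)

      below-1 : ∀ {v p} → 0ℚ ≤ p → v ≤ 1ℚ - p → v ≤ 1ℚ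
      below-1 0≤p le = ℚP.≤-trans le (1-‿≤1 0≤p)

      below-0 : ∀ {v p} → 1ℚ ≤ p → v ≤ 1ℚ - p → v ≤ 0ℚ
      below-0 1≤p le = ℚP.≤-trans le (1-‿≤0 1≤p)

      win : ∀ {M : List (Edge n)} {v} → Hamiltonian M → v ≤ 1ℚ → v ≤ g M
      win {M} h = subst (_ ≤_) (sym (indicator-yes (P? M) (hamiltonian⇒P h)))

      lose-≤ : ∀ {M : List (Edge n)} {v} → v ≤ 0ℚ → v ≤ g M
      lose-≤ {M} le = ℚP.≤-trans le (0≤indicator (P? M))

      exhausted : ∀ {M B : List (Edge n)} {k} → freeEdges M B ≡ [] → ¬ (length M ℕ.+ length B ℕ.+ (k ℕ.+ suc l) ℕ.≤ E)
      exhausted {M} {B} {k} eq le = ℕP.<-irrefl refl (begin-strict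
        length M ℕ.+ length B              <⟨ ℕP.m<m+n _ (ℕP.≤-trans (s≤s z≤n) (ℕP.m≤n+m (suc l) k)) ⟩
        length M ℕ.+ length B ℕ.+ (k ℕ.+ suc l) ≤⟨ le ⟩
        E                                  ≤⟨ free-lower M B ⟩
        length (freeEdges M B) ℕ.+ (length M ℕ.+ length B) ≡⟨ cong (λ F → length F ℕ.+ (length M ℕ.+ length B)) eq ⟩
        length M ℕ.+ length B              ∎)
        where open ℕP.≤-Reasoning

      finish : ∀ {M B σ v} → rounds σ ℕ.≤ 0 → Sound (M ++ proj₁ σ) B (proj₂ σ) → v ≤ 1ℚ → v ≤ g M
      finish {σ = [] , path P U D} le _ _ with () ← subst (ℕ._≤ 0) (ℕP.+-suc (length U) (12 ℕ.* s)) le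
      finish {σ = [] , cycle c []} le sound = win (finished⇒hamiltonian 3≤n (subst (λ G → Sound G _ _) (LP.++-identityʳ _) sound))
      finish {σ = [] , cycle c (y ∷ left)} ()
      finish {σ = e ∷ es , path P U D} ()
      finish {σ = e ∷ es , cycle c left} ()

      leaf : ∀ {M B v} → 𝒱 0 M B v → v ≤ g M
      leaf (won h le) = win h le
      leaf (lost le)  = lose-≤ le
      leaf {B = B} (live zero σ _ _ _ sound _ le _ v≤) = finish le sound (below-1 (0≤risk 0 B σ) v≤)

      stuck : ∀ {m M B v} → freeEdges M B ≡ [] → 𝒱 (suc m) M B v → v ≤ g M
      stuck eq (won h le) = win h le
      stuck eq (lost le)  = lose-≤ le
      stuck {M = M} {B} eq (live m₀ σ _ _ _ _ _ _ budget _) = ⊥-elim (exhausted {M} {B} {m₀ ℕ.* suc b} eq budget)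

      full : ∀ {m k M B v} → freeEdges M B ≡ [] → 𝒲 m (suc k) M B v → 𝒱 m M B v
      full eq (won h le) = won h le
      full eq (lost le)  = lost le
      full {k = k} {M} {B} eq (live m₀ r σ _ _ _ _ _ _ _ _ budget _) = ⊥-elim (exhausted {M} {B} {suc k ℕ.+ m₀ ℕ.* suc b} eq budget)

      turn : ∀ {m M B v} → 𝒲 m 0 M B v → 𝒱 m M B v
      turn (won h le) = won h le
      turn (lost le)  = lost le
      turn {M = M} {B} (live m₀ r (es , st) m₀≤m _ lenM lenB σ≡ sound legal rounds≤ budget v≤) with Any.any? (_∈ₑ? B) es
      -- An edge that Breaker has taken contributes 1 to the pending sum, so the promised value is
      -- at most 0 and nothing remains to be shown.
      ... | yes hit = lost (below-0 (hit-risk hit) v≤)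
        where
        hit-risk : Any (_∈ B) es → 1ℚ ≤ turnRisk m₀ 0 (es , st) B
        hit-risk a with find a
        ... | e , e∈es , e∈B = ℚP.≤-trans
          (1≤ΣΨ {𝓕 = map [_] es} {B} {odds l 0} {[ e ]} (0≤odds l 0) (∈P.∈-map⁺ [_] e∈es) (λ { (here refl) → e∈B }))
          (ℚP.≤-trans (≤+ʳ (0≤debts (es , st))) (≤+ˡ (0≤ΣΨ 𝓕 B (0≤odds l _))))
      ... | no safe = live m₀ (es , st) m₀≤m
        (trans (sym (ℕP.+-identityʳ _)) (trans lenB (cong (ℕ._* b) (sym lenM))))
        (trans σ≡ (cong (λ r → stateAt s b r B) (sym lenM))) sound
        (λ i → legal i , λ j → safe (lose i j)) rounds≤ budget
        (ℚP.≤-trans v≤ (1-‿anti (ℚP.+-monoʳ-≤ (ΣΨ 𝓕 B (odds l (m₀ ℕ.* b))) (≤+ˡ (0≤pending 0 (es , st) B)))))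

      pending-fresh : ∀ (es B : List (Edge n)) → (∀ {e} → e ∈ es → e ∉ B) → ∀ q → ΣΨ (map [_] es) B q ≡ ι (length es) * q
      pending-fresh []       B fresh q = sym (trans (cong (_* q) ι-0) (ℚP.*-zeroˡ q))
      pending-fresh (e ∷ es) B fresh q = begin
        weight B q e * 1ℚ + ΣΨ (map [_] es) B q ≡⟨ cong₂ _+_ (trans (ℚP.*-identityʳ _) (weight-∉ (fresh (here refl)))) (pending-fresh es B (fresh ∘ there) q) ⟩
        q + ι (length es) * q                   ≡⟨ solve 2 (λ q x → q :+ x :* q := (con 1ℚ :+ x) :* q) refl q (ι (length es)) ⟩
        (1ℚ + ι (length es)) * q                ≡⟨ cong (_* q) (ι-suc (length es)) ⟨
        ι (suc (length es)) * q                 ∎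
        where open ≡-Reasoning
              open +-*-Solver

      claimed? : ∀ B → Dec (Any (λ X → All (_∈ B) X) 𝓕)
      claimed? B = Any.any? (All.all? (_∈ₑ? B)) 𝓕

      maker : ∀ {m M B v x xs} → freeEdges M B ≡ x ∷ xs → 𝒱 (suc m) M B v →
              𝒲 m b (M ++ [ choose x xs (S M B) ]) B v
      maker eq (won h le) = won (hamiltonian-mono ∈P.∈-++⁺ˡ h) le
      maker eq (lost le)  = lost le
      maker {M = M} {B} eq (live m₀ (pend , st) m₀≤m lenB σ≡ sound legal rounds≤ budget v≤) with claimed? B
      ... | yes a with find a
      ...   | X , X∈𝓕 , all∈B = lost (below-0 (ℚP.≤-trans
                (1≤ΣΨ (0≤odds l (m₀ ℕ.* b)) X∈𝓕 (All.lookup all∈B)) (≤+ʳ (0≤debts (pend , st)))) v≤)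
      maker {M = M} {B} eq (live m₀ (pend , st) m₀≤m lenB σ≡ sound legal rounds≤ budget v≤) | no ¬claimed
        with expand-progress (good (λ X∈𝓕 sub → ¬claimed (lose X∈𝓕 (All.tabulate sub)))) pend st sound legal
      ... | inj₁ (c , refl) = won (hamiltonian-mono ∈P.∈-++⁺ˡ
              (finished⇒hamiltonian 3≤n (subst (λ G → Sound G _ _) (LP.++-identityʳ M) sound))) (below-1 (0≤risk m₀ B (pend , st)) v≤)
      maker {m} {M} {B} {v} {x} {xs} eq (live (suc m₁) (pend , st) (s≤s m₁≤m) lenB σ≡ sound legal rounds≤ budget v≤) | no _
        | inj₂ (progress sound′ legal′ faster cheaper) =
        live m₁ (length M) σ″ m₁≤m ℕP.≤-refl (length-++-∷ʳ M t) (trans (cong (ℕ._+ b) lenB) (ℕP.+-comm _ b))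
          σ″≡ (sound-mono claim (λ i → i) sound′) (λ i → proj₁ (legal′ (∈-drop (proj₁ σ′) i)))
          (ℕP.≤-pred (ℕP.≤-trans faster rounds≤)) budget′ (ℚP.≤-trans v≤ (1-‿anti risk≤))
        where
        t = choose x xs (S M B)
        σ′ = expand s B (pend , st)
        σ″ = settle σ′
        aimed : S M B ≡ aim (proj₁ σ′) (freeEdges M B)
        aimed = cong (λ σ → aim (proj₁ (expand s B σ)) (freeEdges M B)) (sym σ≡)
        σ″≡ : σ″ ≡ stateAt s b (suc (length M)) B
        σ″≡ = cong₂ (λ C σ → settle (expand s C σ))
          (sym (trans (cong (λ k → take k B) (sym lenB)) (LP.take-all (length B) B ℕP.≤-refl))) σ≡
        ∈-drop : ∀ (es : List (Edge n)) {e} → e ∈ drop 1 es → e ∈ es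
        ∈-drop (_ ∷ es) i = there i
        hit : ∀ {e es} → proj₁ σ′ ≡ e ∷ es → e ∈ M ++ [ t ]
        hit {e} {es} es≡ with e ∈ₑ? M
        -- If Maker owns the planned edge already, the index refers to no such free edge and the
        -- actual move is arbitrary, which does no harm.
        ... | yes i = ∈P.∈-++⁺ˡ i
        ... | no e∉M = ∈P.∈-++⁺ʳ M (here (sym (begin
          choose x xs (S M B)                        ≡⟨ cong (choose x xs) (trans aimed (cong₂ (aim) es≡ eq)) ⟩
          choose x xs (position _≟ₑ_ e (x ∷ xs))     ≡⟨ choose-position _≟ₑ_ (subst (e ∈_) eq (free⁺ (proj₁ leg) e∉M (proj₂ leg))) ⟩
          e                                          ∎)))
          where
          open ≡-Reasoning
          leg : e ∈ allEdges n × e ∉ B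
          leg = legal′ (subst (e ∈_) (sym es≡) (here refl))
        claim : ∀ {e} → e ∈ M ++ proj₁ σ′ → e ∈ (M ++ [ t ]) ++ proj₁ σ″
        claim i = claim-of (proj₁ σ′) refl (∈P.∈-++⁻ M i)
          where
          claim-of : ∀ es → proj₁ σ′ ≡ es → ∀ {e} → e ∈ M ⊎ e ∈ es → e ∈ (M ++ [ t ]) ++ drop 1 es
          claim-of es       _   (inj₁ i)           = ∈P.∈-++⁺ˡ (∈P.∈-++⁺ˡ i)
          claim-of (e ∷ es) es≡ (inj₂ (here refl)) = ∈P.∈-++⁺ˡ (hit es≡)
          claim-of (e ∷ es) _   (inj₂ (there i))   = ∈P.∈-++⁺ʳ (M ++ [ t ]) i
        budget′ : length (M ++ [ t ]) ℕ.+ length B ℕ.+ (b ℕ.+ m₁ ℕ.* suc b ℕ.+ suc l) ℕ.≤ E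
        budget′ = subst (ℕ._≤ E) (trans (ℕP.+-suc (length M ℕ.+ length B) (b ℕ.+ m₁ ℕ.* suc b ℕ.+ suc l)) (cong (λ k → k ℕ.+ length B ℕ.+ (b ℕ.+ m₁ ℕ.* suc b ℕ.+ suc l)) (sym (length-++-∷ʳ M t)))) budget
        -- The main sum is literally unchanged, its remaining picks being regrouped as `b` now and
        -- `m₁ * b` later. Only the exposure of this round moves from the debt to the pending sum.
        risk≤ : turnRisk m₁ b σ″ B ≤ risk (suc m₁) B (pend , st)
        risk≤ = ℚP.+-monoʳ-≤ (ΣΨ 𝓕 B (odds l (b ℕ.+ m₁ ℕ.* b))) (begin
          pendingRisk b σ″ B + debts σ″                                ≡⟨ cong (_+ debts σ″) (pending-fresh (proj₁ σ″) B (λ i → proj₂ (legal′ (∈-drop (proj₁ σ′) i))) (odds l b)) ⟩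
          ι (length (proj₁ σ″)) * odds l b + ι (debt σ″) * odds l b    ≡⟨ ℚP.*-distribʳ-+ (odds l b) (ι (length (proj₁ σ″))) (ι (debt σ″)) ⟨
          (ι (length (proj₁ σ″)) + ι (debt σ″)) * odds l b             ≡⟨ cong (_* odds l b) (ι-+ (length (proj₁ σ″)) (debt σ″)) ⟨
          ι (length (proj₁ σ″) ℕ.+ debt σ″) * odds l b                 ≤⟨ *-monoʳ (0≤odds l b) (ι-mono cheaper) ⟩
          debts (pend , st)                                            ∎)
          where open ℚP.≤-Reasoning
      maker eq (live zero σ _ _ _ _ _ rounds≤ _ _) | no _ | inj₂ (progress _ _ faster _) with () ← ℕP.≤-trans faster rounds≤

      pick : ∀ {m k M B v x xs} → freeEdges M B ≡ x ∷ xs → 𝒲 m (suc k) M B v →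
             Σ (Edge n → ℚ) λ w → (∀ e → e ∈ x ∷ xs → 𝒲 m k M (B ++ [ e ]) (w e)) ×
               ι (suc (length xs)) * v ≤ Sum w (x ∷ xs)
      pick {v = v} {x} {xs} eq (won h le) = (λ _ → v) , (λ e i → won h le) , ℚP.≤-reflexive (sym (Sum-const v (x ∷ xs)))
      pick {v = v} {x} {xs} eq (lost le)  = (λ _ → v) , (λ e i → lost le) , ℚP.≤-reflexive (sym (Sum-const v (x ∷ xs)))
      pick {m} {k} {M} {B} {v} {x} {xs} eq (live m₀ r σ m₀≤m k<b lenM lenB σ≡ sound legal rounds≤ budget v≤) = w , child , sum≥
        where
        F = x ∷ xs
        f = ι (length F)
        w : Edge n → ℚ
        w e = 1ℚ - turnRisk m₀ k σ (B ++ [ e ])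
        k≤b : k ℕ.≤ b
        k≤b = ℕP.≤-trans (ℕP.n≤1+n k) k<b
        r*b≤B : r ℕ.* b ℕ.≤ length B
        r*b≤B = ℕP.+-cancelʳ-≤ b _ _ (subst (ℕ._≤ length B ℕ.+ b) (trans lenB (ℕP.+-comm b _)) (ℕP.+-monoʳ-≤ (length B) k<b))
        child : ∀ e → e ∈ F → 𝒲 m k M (B ++ [ e ]) (w e)
        child e _ = live m₀ r σ m₀≤m k≤b lenM
          (trans (cong (ℕ._+ k) (length-++-∷ʳ B e)) (trans (sym (ℕP.+-suc _ k)) lenB))
          (trans σ≡ (sym (stateAt-stable s b r B r*b≤B)))
          (sound-mono (λ i → i) ∈P.∈-++⁺ˡ sound) legal rounds≤
          (subst (ℕ._≤ E) (shift (length M) (length B) (length-++-∷ʳ B e)) budget) ℚP.≤-refl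
          where
          shift : ∀ a c {d} → d ≡ suc c → a ℕ.+ c ℕ.+ (suc k ℕ.+ m₀ ℕ.* suc b ℕ.+ suc l) ≡ a ℕ.+ d ℕ.+ (k ℕ.+ m₀ ℕ.* suc b ℕ.+ suc l)
          shift a c refl = trans (ℕP.+-suc (a ℕ.+ c) _) (cong (ℕ._+ (k ℕ.+ m₀ ℕ.* suc b ℕ.+ suc l)) (sym (ℕP.+-suc a c)))
        uF : Unique F
        uF = subst Unique eq (free-unique M B)
        -- The budget also reserves the edges that Maker will claim, so more than `l` free edges
        -- remain beyond all picks that Breaker still has; both potentials need this.
        room : suc k ℕ.+ m₀ ℕ.* suc b ℕ.+ suc l ℕ.≤ length F
        room = ℕP.+-cancelˡ-≤ (length M ℕ.+ length B) _ _ (ℕP.≤-trans budget (subst (E ℕ.≤_)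
          (trans (cong (λ G → length G ℕ.+ (length M ℕ.+ length B)) eq) (ℕP.+-comm (length F) _)) (free-lower M B)))
        room₁ : suc (l ℕ.+ suc (k ℕ.+ m₀ ℕ.* b)) ℕ.≤ length F
        room₁ = ℕP.≤-trans (ℕP.≤-reflexive (ℕP.+-comm (suc l) _))
          (ℕP.≤-trans (ℕP.+-monoˡ-≤ (suc l) (s≤s (ℕP.+-monoʳ-≤ k (ℕP.*-monoʳ-≤ m₀ (ℕP.n≤1+n b))))) room)
        room₂ : suc (l ℕ.+ suc k) ℕ.≤ length F
        room₂ = ℕP.≤-trans (s≤s (ℕP.+-monoʳ-≤ l (s≤s (ℕP.m≤m+n k _)))) room₁
        singletons : ∀ {X} → X ∈ map [_] (proj₁ σ) → Unique X
        singletons i with ∈P.∈-map⁻ [_] i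
        ... | _ , _ , refl = [] ∷ []
        Φ Π : Edge n → ℚ
        Φ e = ΣΨ 𝓕 (B ++ [ e ]) (odds l (k ℕ.+ m₀ ℕ.* b))
        Π e = pendingRisk k σ (B ++ [ e ])
        total : Sum (λ e → turnRisk m₀ k σ (B ++ [ e ])) F ≤ f * turnRisk m₀ (suc k) σ B
        total = begin
          Sum (λ e → Φ e + (Π e + debts σ)) F              ≡⟨ trans (Sum-+ Φ _ F) (cong (Sum Φ F +_) (trans (Sum-+ Π _ F) (cong (Sum Π F +_) (Sum-const (debts σ) F)))) ⟩
          Sum Φ F + (Sum Π F + f * debts σ)                ≤⟨ ℚP.+-mono-≤ (ΣΨ-step 𝓕 unique-𝓕 {B} l (k ℕ.+ m₀ ℕ.* b) uF room₁)
                                                                (ℚP.+-monoˡ-≤ (f * debts σ) (ΣΨ-step (map [_] (proj₁ σ)) singletons {B} l k uF room₂)) ⟩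
          f * Φ₀ + (f * Π₀ + f * debts σ)                  ≡⟨ solve 4 (λ f a b c → f :* a :+ (f :* b :+ f :* c) := f :* (a :+ (b :+ c))) refl f Φ₀ Π₀ (debts σ) ⟩
          f * turnRisk m₀ (suc k) σ B                      ∎
          where
          open ℚP.≤-Reasoning
          open +-*-Solver
          Φ₀ = ΣΨ 𝓕 B (odds l (suc k ℕ.+ m₀ ℕ.* b))
          Π₀ = pendingRisk (suc k) σ B
        neg-sum : ∀ (h : Edge n → ℚ) G → Sum (λ e → 1ℚ - h e) G ≡ ι (length G) - Sum h G
        neg-sum h []      = cong (_- 0ℚ) (sym ι-0)
        neg-sum h (y ∷ G) = trans (cong (1ℚ - h y +_) (neg-sum h G)) (trans
          (solve 3 (λ a b c → con 1ℚ :- a :+ (b :- c) := con 1ℚ :+ b :- (a :+ c)) refl (h y) (ι (length G)) (Sum h G))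
          (cong (_- Sum h (y ∷ G)) (sym (ι-suc (length G)))))
          where open +-*-Solver
        sum≥ : f * v ≤ Sum w F
        sum≥ = begin
          f * v                                       ≤⟨ *-monoˡ (0≤ι (length F)) v≤ ⟩
          f * (1ℚ - turnRisk m₀ (suc k) σ B)          ≡⟨ solve 2 (λ f t → f :* (con 1ℚ :- t) := f :- f :* t) refl f (turnRisk m₀ (suc k) σ B) ⟩
          f - f * turnRisk m₀ (suc k) σ B             ≤⟨ ℚP.+-monoʳ-≤ f (ℚP.neg-antimono-≤ total) ⟩
          f - Sum (λ e → turnRisk m₀ k σ (B ++ [ e ])) F ≡⟨ neg-sum (λ e → turnRisk m₀ k σ (B ++ [ e ])) F ⟨
          Sum w F                                     ∎
          where
          open ℚP.≤-Reasoning
          open +-*-Solver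

    -- The empty path has debt `12 * s` and no planned edges, so the initial risk is the union bound
    -- plus the insertions. The game may last longer than `m₀` rounds, since a Hamilton cycle once
    -- built is kept.
    success-bound : ∀ {m₀ m} → m₀ ℕ.≤ m → suc (n ℕ.+ 12 ℕ.* s) ℕ.≤ m₀ → m₀ ℕ.* suc b ℕ.+ suc l ℕ.≤ E →
      1ℚ - (ΣΨ 𝓕 [] (odds l (m₀ ℕ.* b)) + ι (12 ℕ.* s) * odds l b) ≤ 𝔼 (indicator ∘ P?) (play (strategy s b) b m [] [])
    success-bound {m₀} {m} m₀≤m enough budget =
      LowerBound.play-bound S b g 𝒱 𝒲 leaf stuck maker turn full pick {m = m}
        (live m₀ ([] , path [] (allFin n) []) m₀≤m refl refl
          (path (↭-reflexive (LP.++-identityʳ (allFin n))) [] z≤n (λ ())) (λ ())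
          (subst (ℕ._≤ m₀) (sym (trans (cong (ℕ._+ suc (12 ℕ.* s)) length-allFin) (ℕP.+-suc n _))) enough) budget ℚP.≤-refl)

open Playing

-- The dangerous edge sets, and decay of powers.

module Bicliques where

  open import Data.Rational using (_≤_; _<_; _*_)
  open import Data.Nat using (_^_)
  open import Data.Rational.Solver using (module +-*-Solver)

  module _ {n : ℕ} where

    biclique : List (Fin n) → List (Fin n) → List (Edge n)
    biclique = cartesianProductWith edge

    edge-injectiveʳ : ∀ {x u v : Fin n} → edge x u ≡ edge x v → u ≡ v
    edge-injectiveʳ eq with edge-injective eq
    ... | inj₁ (_ , p)    = p
    ... | inj₂ (refl , p) = p

    biclique-unique : ∀ S T → Unique S → Unique T → (∀ {x} → x ∈ S → x ∉ T) → Unique (biclique S T)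
    biclique-unique []      T _ _ _ = []
    biclique-unique (x ∷ S) T u@(_ ∷ u′) uT disj = UP.++⁺ (UP.map⁺ edge-injectiveʳ uT)
      (biclique-unique S T u′ uT (disj ∘ there)) apart
      where
      apart : ∀ {e} → ¬ (e ∈ map (edge x) T × e ∈ biclique S T)
      apart (i , j) with ∈P.∈-map⁻ (edge x) i | ∈P.∈-cartesianProductWith⁻ edge S T j
      ... | t , t∈ , refl | y , z , y∈ , z∈ , eq with edge-injective {u = x} {t} {y} {z} eq
      ...   | inj₁ (refl , _) = unique-head u y∈
      ...   | inj₂ (refl , _) = disj (here refl) z∈

    complement : List (Fin n) → List (Fin n)
    complement A = filter (λ v → ¬? (DecMem._∈?_ FinP._≟_ v A)) (allFin n)

    complement-length : ∀ A → n ℕ.≤ length (complement A) ℕ.+ length A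
    complement-length A = subst (n ℕ.≤_) (LP.length-++ (complement A)) (covering⇒length≥ cover)
      where
      cover : ∀ v → v ∈ complement A ++ A
      cover v with DecMem._∈?_ FinP._≟_ v A
      ... | yes i = ∈P.∈-++⁺ʳ (complement A) i
      ... | no v∉ = ∈P.∈-++⁺ˡ (∈P.∈-filter⁺ _ (∈P.∈-allFin v) v∉)

    module Family (s : ℕ) where

      -- Complements serve for the stars: the large side is encoded by the at most `6 * s + 1`
      -- vertices that it avoids, which keeps the number of edge sets at `n ^ O(s)`.
      sides : List (List (Fin n))
      sides = lists≤ s ++ map complement (lists≤ (6 ℕ.* s ℕ.+ 1))

      large? : ∀ (X : List (Edge n)) → Dec (Unique X × s ℕ.* s ℕ.≤ length X)
      large? X = unique? _≟ₑ_ X ×-dec (s ℕ.* s ℕ.≤? length X)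

      -- The union bound wants each member to consist of at least `s * s` distinct edges; the filter
      -- enforces this without describing which pairs of sides qualify.
      family : List (List (Edge n))
      family = filter large? (cartesianProductWith biclique (lists≤ s) sides)

      family-large : ∀ {X} → X ∈ family → Unique X × s ℕ.* s ℕ.≤ length X
      family-large i = proj₂ (∈P.∈-filter⁻ large? {xs = cartesianProductWith biclique (lists≤ s) sides} i)

      length-family : length family ℕ.≤ suc n ^ s ℕ.* (suc n ^ s ℕ.+ suc n ^ (6 ℕ.* s ℕ.+ 1))
      length-family = begin
        length family                                               ≤⟨ LP.length-filter large? (cartesianProductWith biclique (lists≤ s) sides) ⟩
        length (cartesianProductWith biclique (lists≤ s) sides)     ≡⟨ length-cartesianProductWith biclique (lists≤ s) sides ⟩
        length (lists≤ {n} s) ℕ.* length sides                      ≡⟨ cong (length (lists≤ {n} s) ℕ.*_) (trans (LP.length-++ (lists≤ s))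
                                                                         (cong (length (lists≤ {n} s) ℕ.+_) (LP.length-map complement (lists≤ (6 ℕ.* s ℕ.+ 1))))) ⟩
        length (lists≤ {n} s) ℕ.* (length (lists≤ {n} s) ℕ.+ length (lists≤ {n} (6 ℕ.* s ℕ.+ 1)))
                                                                    ≤⟨ ℕP.*-mono-≤ (length-lists≤ s) (ℕP.+-mono-≤ (length-lists≤ s) (length-lists≤ (6 ℕ.* s ℕ.+ 1))) ⟩
        suc n ^ s ℕ.* (suc n ^ s ℕ.+ suc n ^ (6 ℕ.* s ℕ.+ 1))       ∎
        where open ℕP.≤-Reasoning

      module _ (1≤s : 1 ℕ.≤ s) (4s≤n : 4 ℕ.* s ℕ.≤ n) (s²≤n : s ℕ.* s ℕ.+ (6 ℕ.* s ℕ.+ 1) ℕ.≤ n) where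

        family-good : ∀ {B} → (∀ {X} → X ∈ family → ¬ (∀ {e} → e ∈ X → e ∈ B)) → Strategic.Good s 1≤s 4s≤n B
        family-good {B} none = record { pairs = pairs ; star = star }
          where
          available : ∀ S T → S ∈ lists≤ s → T ∈ sides → Unique S → Unique T → (∀ {x} → x ∈ S → x ∉ T) →
                      s ℕ.* s ℕ.≤ length S ℕ.* length T → ∃₂ λ u v → u ∈ S × v ∈ T × edge u v ∉ B
          available S T S∈ T∈ uS uT disj large with All.all? (_∈ₑ? B) (biclique S T)
          ... | yes all = ⊥-elim (none (∈P.∈-filter⁺ large? (∈P.∈-cartesianProductWith⁺ biclique S∈ T∈)
                  (biclique-unique S T uS uT disj , subst (s ℕ.* s ℕ.≤_) (sym (length-cartesianProductWith edge S T)) large)) (All.lookup all))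
          ... | no ¬all with find (¬All⇒Any¬ (_∈ₑ? B) _ ¬all)
          ...   | e , e∈ , e∉B with ∈P.∈-cartesianProductWith⁻ edge S T e∈
          ...     | u , v , u∈ , v∈ , refl = u , v , u∈ , v∈ , e∉B

          pairs : ∀ S T → s ℕ.≤ length S → s ℕ.≤ length T → Unique S → Unique T → (∀ {x} → x ∈ S → x ∉ T) →
                  ∃₂ λ u v → u ∈ S × v ∈ T × edge u v ∉ B
          pairs S T s≤S s≤T uS uT disj with split-length s S s≤S | split-length s T s≤T
          ... | S₁ , S₂ , refl , lenS | T₁ , T₂ , refl , lenT
            with available S₁ T₁ (∈-lists≤ S₁ (ℕP.≤-reflexive lenS)) (∈P.∈-++⁺ˡ (∈-lists≤ T₁ (ℕP.≤-reflexive lenT)))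
                   (unique-++⁻ˡ S₁ uS) (unique-++⁻ˡ T₁ uT) (λ i j → disj (∈P.∈-++⁺ˡ i) (∈P.∈-++⁺ˡ j))
                   (ℕP.≤-reflexive (sym (cong₂ ℕ._*_ lenS lenT)))
          ...   | u , v , u∈ , v∈ , avail = u , v , ∈P.∈-++⁺ˡ u∈ , ∈P.∈-++⁺ˡ v∈ , avail

          star : ∀ y A → y ∈ A → length A ℕ.≤ 6 ℕ.* s ℕ.+ 1 → ∃ λ v → v ∉ A × edge y v ∉ B
          star y A y∈A small with available [ y ] (complement A) (∈-lists≤ [ y ] 1≤s)
            (∈P.∈-++⁺ʳ (lists≤ s) (∈P.∈-map⁺ complement (∈-lists≤ A small))) ([] ∷ [])
            (UP.filter⁺ _ (UP.allFin⁺ n)) (λ { (here refl) j → outside j y∈A })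
            (subst (s ℕ.* s ℕ.≤_) (sym (ℕP.+-identityʳ _)) (ℕP.+-cancelʳ-≤ (length A) _ _
              (ℕP.≤-trans (ℕP.+-monoʳ-≤ (s ℕ.* s) small) (ℕP.≤-trans s²≤n (complement-length A)))))
            where
            outside : ∀ {v} → v ∈ complement A → v ∉ A
            outside j = proj₂ (∈P.∈-filter⁻ (λ v → ¬? (DecMem._∈?_ FinP._≟_ v A)) {xs = allFin n} j)
          ... | _ , v , here refl , v∈ , avail =
            v , proj₂ (∈P.∈-filter⁻ (λ v → ¬? (DecMem._∈?_ FinP._≟_ v A)) {xs = allFin n} v∈) , avail

  ^ℚ-+ : ∀ q a b → q ^ℚ (a ℕ.+ b) ≡ q ^ℚ a * q ^ℚ b
  ^ℚ-+ q zero    b = sym (ℚP.*-identityˡ _)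
  ^ℚ-+ q (suc a) b = trans (cong (q *_) (^ℚ-+ q a b)) (sym (ℚP.*-assoc q _ _))

  0≤^ℚ : ∀ {q} k → 0ℚ ≤ q → 0ℚ ≤ q ^ℚ k
  0≤^ℚ zero    0≤q = ℚP.<⇒≤ 0<1ℚ
  0≤^ℚ (suc k) 0≤q = 0≤* 0≤q (0≤^ℚ k 0≤q)

  ^ℚ≤1 : ∀ {q} k → 0ℚ ≤ q → q ≤ 1ℚ → q ^ℚ k ≤ 1ℚ
  ^ℚ≤1 zero    0≤q q≤1 = ℚP.≤-refl
  ^ℚ≤1 {q} (suc k) 0≤q q≤1 = subst (q * q ^ℚ k ≤_) (ℚP.*-identityˡ 1ℚ) (*-mono 0≤q (ℚP.<⇒≤ 0<1ℚ) q≤1 (^ℚ≤1 k 0≤q q≤1))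

  ^ℚ-anti : ∀ {q a b} → 0ℚ ≤ q → q ≤ 1ℚ → a ℕ.≤ b → q ^ℚ b ≤ q ^ℚ a
  ^ℚ-anti {q} {a} {b} 0≤q q≤1 a≤b = subst₂ _≤_ (trans (sym (^ℚ-+ q a (b ℕ.∸ a))) (cong (q ^ℚ_) (ℕP.m+[n∸m]≡n a≤b)))
    (ℚP.*-identityʳ _) (*-monoˡ (0≤^ℚ a 0≤q) (^ℚ≤1 (b ℕ.∸ a) 0≤q q≤1))

  bernoulli : ∀ R k → R ^ suc k ℕ.+ suc k ℕ.* R ^ k ℕ.≤ suc R ^ suc k
  bernoulli R zero    = ℕP.≤-reflexive (solve 1 (λ R → R :* con 1 :+ con 1 := con 1 :+ R :* con 1) refl R)
    where open ℕS.+-*-Solver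
  bernoulli R (suc k) = begin
    R ^ suc (suc k) ℕ.+ suc (suc k) ℕ.* R ^ suc k                          ≤⟨ ℕP.m≤m+n _ (suc k ℕ.* R ^ k) ⟩
    R ^ suc (suc k) ℕ.+ suc (suc k) ℕ.* R ^ suc k ℕ.+ suc k ℕ.* R ^ k      ≡⟨ solve 3 (λ R k x → R :* (R :* x) :+ (con 2 :+ k) :* (R :* x) :+ (con 1 :+ k) :* x
                                                                                := (con 1 :+ R) :* (R :* x :+ (con 1 :+ k) :* x)) refl R k (R ^ k) ⟩
    suc R ℕ.* (R ^ suc k ℕ.+ suc k ℕ.* R ^ k)                              ≤⟨ ℕP.*-monoʳ-≤ (suc R) (bernoulli R k) ⟩
    suc R ^ suc (suc k)                                                    ∎
    where open ℕP.≤-Reasoning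
          open ℕS.+-*-Solver

  module _ (R : ℕ) {q : ℚ} (0≤q : 0ℚ ≤ q) (q≤ : ι (suc R) * q ≤ ι R) where

    private
      powers : ∀ k → ι (suc R ^ k) * q ^ℚ k ≤ ι (R ^ k)
      powers zero    = ℚP.≤-reflexive (ℚP.*-identityʳ _)
      powers (suc k) = begin
        ι (suc R ^ suc k) * (q * q ^ℚ k)         ≡⟨ cong (_* (q * q ^ℚ k)) (ι-* (suc R) (suc R ^ k)) ⟩
        ι (suc R) * ι (suc R ^ k) * (q * q ^ℚ k) ≡⟨ solve 4 (λ a b c d → a :* b :* (c :* d) := a :* c :* (b :* d)) refl (ι (suc R)) (ι (suc R ^ k)) q (q ^ℚ k) ⟩
        ι (suc R) * q * (ι (suc R ^ k) * q ^ℚ k) ≤⟨ *-mono (0≤* (0≤ι (suc R)) 0≤q) (0≤ι (R ^ k)) q≤ (powers k) ⟩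
        ι R * ι (R ^ k)                          ≡⟨ ι-* R (R ^ k) ⟨
        ι (R ^ suc k)                            ∎
        where open ℚP.≤-Reasoning
              open +-*-Solver

    -- Since `q ≤ R / (R + 1)`, this is Bernoulli's inequality: `(R + 1) ^ (R + 1)` is at least
    -- twice `R ^ (R + 1)`.
    halving : ι 2 * q ^ℚ suc R ≤ 1ℚ
    halving = *-cancelˡ positive (begin
      N * (ι 2 * q ^ℚ suc R)         ≡⟨ solve 3 (λ a b c → a :* (b :* c) := b :* (a :* c)) refl N (ι 2) (q ^ℚ suc R) ⟩
      ι 2 * (N * q ^ℚ suc R)         ≤⟨ *-monoˡ (0≤ι 2) (powers (suc R)) ⟩
      ι 2 * ι (R ^ suc R)            ≡⟨ ι-* 2 (R ^ suc R) ⟨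
      ι (2 ℕ.* R ^ suc R)            ≤⟨ ι-mono (ℕP.≤-trans double (bernoulli R R)) ⟩
      N                              ≡⟨ ℚP.*-identityʳ N ⟨
      N * 1ℚ                         ∎)
      where
      open ℚP.≤-Reasoning
      open +-*-Solver
      N = ι (suc R ^ suc R)
      positive : 0ℚ < N
      positive = ℚP.<-≤-trans (0<ι 0) (ι-mono (ℕP.m^n>0 (suc R) (suc R)))
      double : 2 ℕ.* R ^ suc R ℕ.≤ R ^ suc R ℕ.+ suc R ℕ.* R ^ R
      double = ℕP.+-monoʳ-≤ (R ^ suc R) (ℕP.≤-trans (ℕP.≤-reflexive (ℕP.+-identityʳ _)) (ℕP.m≤n+m _ (R ^ R)))

    halvings : ∀ j → ι (2 ^ j) * q ^ℚ (j ℕ.* suc R) ≤ 1ℚ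
    halvings zero    = ℚP.≤-reflexive (trans (ℚP.*-identityʳ _) ι-1)
    halvings (suc j) = begin
      ι (2 ^ suc j) * q ^ℚ (suc R ℕ.+ j ℕ.* suc R)                 ≡⟨ cong₂ _*_ (ι-* 2 (2 ^ j)) (^ℚ-+ q (suc R) (j ℕ.* suc R)) ⟩
      ι 2 * ι (2 ^ j) * (q ^ℚ suc R * q ^ℚ (j ℕ.* suc R))          ≡⟨ solve 4 (λ a b c d → a :* b :* (c :* d) := a :* c :* (b :* d)) refl (ι 2) (ι (2 ^ j)) (q ^ℚ suc R) (q ^ℚ (j ℕ.* suc R)) ⟩
      ι 2 * q ^ℚ suc R * (ι (2 ^ j) * q ^ℚ (j ℕ.* suc R))          ≤⟨ *-mono (0≤* (0≤ι 2) (0≤^ℚ (suc R) 0≤q)) (ℚP.<⇒≤ 0<1ℚ) halving (halvings j) ⟩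
      1ℚ * 1ℚ                                                      ≡⟨ ℚP.*-identityˡ 1ℚ ⟩
      1ℚ                                                           ∎
      where open ℚP.≤-Reasoning
            open +-*-Solver

  ΣΨ-initial : ∀ {n} (𝓕 : List (List (Edge n))) {q ℓ} → 0ℚ ≤ q → q ≤ 1ℚ → (∀ {X} → X ∈ 𝓕 → ℓ ℕ.≤ length X) →
               ΣΨ 𝓕 [] q ≤ ι (length 𝓕) * q ^ℚ ℓ
  ΣΨ-initial 𝓕 {q} {ℓ} 0≤q q≤1 large = ℚP.≤-trans
    (Sum-mono 𝓕 (λ X i → subst (_≤ q ^ℚ ℓ) (sym (Ψ-empty q X)) (^ℚ-anti 0≤q q≤1 (large i))))
    (ℚP.≤-reflexive (Sum-const (q ^ℚ ℓ) 𝓕))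

open Bicliques

-- Choice of the constants and bounds for large `n`.

module Estimates where

  open import Data.Rational using (_≤_; _<_; _+_; _*_; _-_; _/_)
  open import Data.Nat using (_^_; ⌊_/2⌋)
  open import Data.Rational.Solver using (module +-*-Solver)

  <2^log : ∀ n → suc n ℕ.≤ 2 ^ suc ⌊log₂ n ⌋
  <2^log n with suc n ℕ.≤? 2 ^ suc ⌊log₂ n ⌋
  ... | yes le = le
  ... | no ≰ = ⊥-elim (ℕP.<-irrefl refl (subst (ℕ._≤ ⌊log₂ n ⌋) (⌊log₂[2^n]⌋≡n (suc ⌊log₂ n ⌋)) (⌊log₂⌋-mono-≤ (ℕP.≤-pred (ℕP.≰⇒> ≰)))))

  2^log≤ : ∀ n → 1 ℕ.≤ n → 2 ^ ⌊log₂ n ⌋ ℕ.≤ n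
  2^log≤ = <-rec (λ n → 1 ℕ.≤ n → 2 ^ ⌊log₂ n ⌋ ℕ.≤ n) halve
    where
    halve : ∀ n → (∀ {m} → m ℕ.< n → 1 ℕ.≤ m → 2 ^ ⌊log₂ m ⌋ ℕ.≤ m) → 1 ℕ.≤ n → 2 ^ ⌊log₂ n ⌋ ℕ.≤ n
    halve (suc zero)    rec _ = ℕP.≤-refl
    halve (suc (suc k)) rec _ = begin
      2 ^ ⌊log₂ n ⌋                 ≤⟨ ℕP.^-monoʳ-≤ 2 (subst (⌊log₂ n ⌋ ℕ.≤_) (cong suc (sym (⌊log₂⌊n/2⌋⌋≡⌊log₂n⌋∸1 n))) (ℕP.m≤n+m∸n ⌊log₂ n ⌋ 1)) ⟩
      2 ℕ.* 2 ^ ⌊log₂ ⌊ n /2⌋ ⌋     ≤⟨ ℕP.*-monoʳ-≤ 2 (rec (ℕP.⌊n/2⌋<n (suc k)) (s≤s z≤n)) ⟩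
      2 ℕ.* ⌊ n /2⌋                 ≡⟨ cong (⌊ n /2⌋ ℕ.+_) (ℕP.+-identityʳ _) ⟩
      ⌊ n /2⌋ ℕ.+ ⌊ n /2⌋           ≤⟨ ℕP.+-monoʳ-≤ ⌊ n /2⌋ (ℕP.⌊n/2⌋≤⌈n/2⌉ n) ⟩
      ⌊ n /2⌋ ℕ.+ ℕ.⌈ n /2⌉         ≡⟨ ℕP.⌊n/2⌋+⌈n/2⌉≡n n ⟩
      n                             ∎
      where
      open ℕP.≤-Reasoning
      n = suc (suc k)

  -- Equality holds at `k = 3`. From there on the quotient of successive cubes is at most
  -- `(5 / 4) ^ 3 < 2`.
  cube≤2^ : ∀ k → suc k ℕ.* suc k ℕ.* suc k ℕ.≤ 8 ℕ.* 2 ^ k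
  cube≤2^ 0 = ℕP.m≤m+n 1 7
  cube≤2^ 1 = ℕP.m≤m+n 8 8
  cube≤2^ 2 = ℕP.m≤m+n 27 5
  cube≤2^ 3 = ℕP.m≤m+n 64 0
  cube≤2^ (suc (suc (suc (suc d)))) = begin
    (5 ℕ.+ d) ℕ.* (5 ℕ.+ d) ℕ.* (5 ℕ.+ d)                  ≤⟨ ℕP.m≤m+n _ (3 ℕ.+ 21 ℕ.* d ℕ.+ 9 ℕ.* d ℕ.* d ℕ.+ d ℕ.* d ℕ.* d) ⟩
    (5 ℕ.+ d) ℕ.* (5 ℕ.+ d) ℕ.* (5 ℕ.+ d) ℕ.+ (3 ℕ.+ 21 ℕ.* d ℕ.+ 9 ℕ.* d ℕ.* d ℕ.+ d ℕ.* d ℕ.* d)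
        ≡⟨ solve 1 (λ d → (con 5 :+ d) :* (con 5 :+ d) :* (con 5 :+ d) :+ (con 3 :+ con 21 :* d :+ con 9 :* d :* d :+ d :* d :* d)
                     := con 2 :* ((con 4 :+ d) :* (con 4 :+ d) :* (con 4 :+ d))) refl d ⟩
    2 ℕ.* ((4 ℕ.+ d) ℕ.* (4 ℕ.+ d) ℕ.* (4 ℕ.+ d))          ≤⟨ ℕP.*-monoʳ-≤ 2 (cube≤2^ (suc (suc (suc d)))) ⟩
    2 ℕ.* (8 ℕ.* 2 ^ (3 ℕ.+ d))                            ≡⟨ solve 1 (λ x → con 2 :* (con 8 :* x) := con 8 :* (con 2 :* x)) refl (2 ^ (3 ℕ.+ d)) ⟩
    8 ℕ.* 2 ^ (4 ℕ.+ d)                                    ∎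
    where open ℕP.≤-Reasoning
          open ℕS.+-*-Solver

  -- Once `8 * c ≤ 1 + log n`, the factor `8 * c` is absorbed into a third power of `1 + log n`,
  -- which is at most `8 * n`.
  log²-eventually-≤ : ∀ c n → 2 ^ (8 ℕ.* c) ℕ.≤ n → c ℕ.* (suc ⌊log₂ n ⌋ ℕ.* suc ⌊log₂ n ⌋) ℕ.≤ n
  log²-eventually-≤ c n large = ℕP.*-cancelˡ-≤ 8 (begin
    8 ℕ.* (c ℕ.* (suc k ℕ.* suc k))   ≡⟨ solve 2 (λ c x → con 8 :* (c :* x) := x :* (con 8 :* c)) refl c (suc k ℕ.* suc k) ⟩
    suc k ℕ.* suc k ℕ.* (8 ℕ.* c)     ≤⟨ ℕP.*-monoʳ-≤ (suc k ℕ.* suc k) 8c≤ ⟩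
    suc k ℕ.* suc k ℕ.* suc k         ≤⟨ cube≤2^ k ⟩
    8 ℕ.* 2 ^ k                       ≤⟨ ℕP.*-monoʳ-≤ 8 (2^log≤ n (ℕP.≤-trans (ℕP.m^n>0 2 (8 ℕ.* c)) large)) ⟩
    8 ℕ.* n                           ∎)
    where
    open ℕP.≤-Reasoning
    open ℕS.+-*-Solver
    k = ⌊log₂ n ⌋
    8c≤ : 8 ℕ.* c ℕ.≤ suc k
    8c≤ = ℕP.m≤n⇒m≤1+n (subst (ℕ._≤ k) (⌊log₂[2^n]⌋≡n (8 ℕ.* c)) (⌊log₂⌋-mono-≤ large))

  module _ (R Λ : ℕ) (1≤Λ : 1 ℕ.≤ Λ) where

    private
      -- The 10 is 7 + 2 + 1: the factor `n` and the family together cost `7 Λ s + 2 Λ + 1` binary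
      -- digits, which is at most `10 Λ s`.
      s = suc R ℕ.* (10 ℕ.* Λ)

      1≤s : 1 ℕ.≤ s
      1≤s = ℕP.*-mono-≤ {1} {suc R} {1} (s≤s z≤n) (ℕP.≤-trans 1≤Λ (ℕP.m≤n*m Λ 10))

    -- Every `suc R` edges of a set halve its weight, and `s * s = 10 Λ s * suc R`, so each set
    -- weighs at most `2 ^ (- 10 Λ s)`, enough to beat `n` times the size of the family.
    family-risk : ∀ {n p} → suc n ℕ.≤ 2 ^ Λ → 0ℚ ≤ p → p ≤ 1ℚ → ι (suc R) * p ≤ ι R →
                  ι n * ΣΨ (Family.family {n} s) [] p ≤ 1ℚ
    family-risk {n} {p} n<2^Λ 0≤p p≤1 p≤ = begin
      ι n * ΣΨ 𝓕 [] p                               ≤⟨ *-mono (0≤ι n) (0≤* (0≤ι _) (0≤^ℚ (s ℕ.* s) 0≤p)) (ι-mono (ℕP.≤-trans (ℕP.n≤1+n n) n<2^Λ))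
                                                       (ΣΨ-initial 𝓕 0≤p p≤1 (proj₂ ∘ Family.family-large s)) ⟩
      ι (2 ^ Λ) * (ι (length 𝓕) * p ^ℚ (s ℕ.* s))   ≡⟨ trans (sym (ℚP.*-assoc (ι (2 ^ Λ)) (ι (length 𝓕)) (p ^ℚ (s ℕ.* s)))) (cong (_* p ^ℚ (s ℕ.* s)) (sym (ι-* (2 ^ Λ) (length 𝓕)))) ⟩
      ι (2 ^ Λ ℕ.* length 𝓕) * p ^ℚ (s ℕ.* s)       ≤⟨ *-monoʳ (0≤^ℚ (s ℕ.* s) 0≤p) (ι-mono count) ⟩
      ι (2 ^ j) * p ^ℚ (s ℕ.* s)                    ≡⟨ cong (λ k → ι (2 ^ j) * p ^ℚ k) (solve 2 (λ r w → r :* w :* (r :* w) := w :* (r :* w) :* r) refl (suc R) (10 ℕ.* Λ)) ⟩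
      ι (2 ^ j) * p ^ℚ (j ℕ.* suc R)                ≤⟨ halvings R 0≤p p≤ j ⟩
      1ℚ                                            ∎
      where
      open ℚP.≤-Reasoning
      open ℕS.+-*-Solver
      𝓕 = Family.family {n} s
      j = 10 ℕ.* Λ ℕ.* s
      t = 6 ℕ.* s ℕ.+ 1
      base : ∀ k → suc n ^ k ℕ.≤ 2 ^ (Λ ℕ.* k)
      base k = subst (suc n ^ k ℕ.≤_) (ℕP.^-*-assoc 2 Λ k) (ℕP.^-monoˡ-≤ k n<2^Λ)
      count : 2 ^ Λ ℕ.* length 𝓕 ℕ.≤ 2 ^ j
      count = N.begin
        2 ^ Λ ℕ.* length 𝓕                                             N.≤⟨ ℕP.*-monoʳ-≤ (2 ^ Λ) (Family.length-family {n} s) ⟩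
        2 ^ Λ ℕ.* (suc n ^ s ℕ.* (suc n ^ s ℕ.+ suc n ^ t))            N.≤⟨ ℕP.*-monoʳ-≤ (2 ^ Λ) (ℕP.*-mono-≤ (base s)
                                                                              (ℕP.+-mono-≤ (ℕP.≤-trans (base s) (ℕP.^-monoʳ-≤ 2 (ℕP.*-monoʳ-≤ Λ s≤t))) (base t))) ⟩
        2 ^ Λ ℕ.* (2 ^ (Λ ℕ.* s) ℕ.* (2 ^ (Λ ℕ.* t) ℕ.+ 2 ^ (Λ ℕ.* t))) N.≡⟨ cong (λ x → 2 ^ Λ ℕ.* (2 ^ (Λ ℕ.* s) ℕ.* (2 ^ (Λ ℕ.* t) ℕ.+ x))) (ℕP.+-identityʳ (2 ^ (Λ ℕ.* t))) ⟨
        2 ^ Λ ℕ.* (2 ^ (Λ ℕ.* s) ℕ.* 2 ^ suc (Λ ℕ.* t))                N.≡⟨ cong (2 ^ Λ ℕ.*_) (ℕP.^-distribˡ-+-* 2 (Λ ℕ.* s) (suc (Λ ℕ.* t))) ⟨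
        2 ^ Λ ℕ.* 2 ^ (Λ ℕ.* s ℕ.+ suc (Λ ℕ.* t))                      N.≡⟨ ℕP.^-distribˡ-+-* 2 Λ (Λ ℕ.* s ℕ.+ suc (Λ ℕ.* t)) ⟨
        2 ^ (Λ ℕ.+ (Λ ℕ.* s ℕ.+ suc (Λ ℕ.* t)))                        N.≤⟨ ℕP.^-monoʳ-≤ 2 exponent ⟩
        2 ^ j                                                          N.∎
        where
        module N = ℕP.≤-Reasoning
        s≤t : s ℕ.≤ t
        s≤t = ℕP.≤-trans (ℕP.m≤n*m s 6) (ℕP.m≤m+n _ 1)
        exponent : Λ ℕ.+ (Λ ℕ.* s ℕ.+ suc (Λ ℕ.* t)) ℕ.≤ j
        exponent = N.begin
          Λ ℕ.+ (Λ ℕ.* s ℕ.+ suc (Λ ℕ.* t))                      N.≡⟨ solve 2 (λ Λ s → Λ :+ (Λ :* s :+ (con 1 :+ Λ :* (con 6 :* s :+ con 1))) := con 7 :* (Λ :* s) :+ (con 2 :* (Λ :* con 1) :+ con 1)) refl Λ s ⟩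
          7 ℕ.* (Λ ℕ.* s) ℕ.+ (2 ℕ.* (Λ ℕ.* 1) ℕ.+ 1)            N.≤⟨ ℕP.+-monoʳ-≤ (7 ℕ.* (Λ ℕ.* s)) (ℕP.+-mono-≤ (ℕP.*-monoʳ-≤ 2 (ℕP.*-monoʳ-≤ Λ 1≤s)) (ℕP.*-mono-≤ 1≤Λ 1≤s)) ⟩
          7 ℕ.* (Λ ℕ.* s) ℕ.+ (2 ℕ.* (Λ ℕ.* s) ℕ.+ Λ ℕ.* s)      N.≡⟨ solve 2 (λ Λ s → con 7 :* (Λ :* s) :+ (con 2 :* (Λ :* s) :+ Λ :* s) := con 10 :* Λ :* s) refl Λ s ⟩
          j                                                      N.∎

  odds-scaled : ∀ {a c l k} → a ℕ.* k ℕ.≤ c ℕ.* suc (l ℕ.+ k) → ι a * odds l k ≤ ι c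
  odds-scaled {a} {c} {l} {k} h = *-cancelˡ (0<ι (l ℕ.+ k)) (begin
    ι (suc (l ℕ.+ k)) * (ι a * odds l k) ≡⟨ solve 3 (λ x a o → x :* (a :* o) := a :* (o :* x)) refl (ι (suc (l ℕ.+ k))) (ι a) (odds l k) ⟩
    ι a * (odds l k * ι (suc (l ℕ.+ k))) ≡⟨ trans (cong (ι a *_) (odds-* l k)) (sym (ι-* a k)) ⟩
    ι (a ℕ.* k)                          ≤⟨ ι-mono h ⟩
    ι (c ℕ.* suc (l ℕ.+ k))              ≡⟨ trans (ι-* c (suc (l ℕ.+ k))) (ℚP.*-comm (ι c) _) ⟩
    ι (suc (l ℕ.+ k)) * ι c              ∎)
    where open ℚP.≤-Reasoning
          open +-*-Solver

  -- It says that `m₀ * b` is less than `R` times the number of edges unclaimed after `m₀` rounds.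
  -- As `R + 1 = 2 (q + 1)`, twice the left side is about `2 q n²`, twice the right side about
  -- `R n² = (2 q + 1) n²`; the spare `n²` absorbs the terms linear in `n`, including the `h` extra
  -- rounds.
  edges-suffice : ∀ {q b n h E} → let R = q ℕ.+ suc q ; m₀ = n ℕ.+ h in
    2 ℕ.* suc q ℕ.* b ℕ.≤ q ℕ.* n → n ℕ.* n ℕ.≤ E ℕ.+ (E ℕ.+ n) → R ℕ.* (3 ℕ.+ 4 ℕ.* h) ℕ.+ 1 ℕ.≤ n → 2 ℕ.≤ n →
    R ℕ.* (m₀ ℕ.* suc b) ℕ.+ m₀ ℕ.* b ℕ.< R ℕ.* E
  edges-suffice {q} {b} {n} {h} {E} bias≤ count large 2≤n = ℕP.*-cancelˡ-≤ 2 (ℕP.+-cancelʳ-≤ (R ℕ.* n) _ _ (begin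
    2 ℕ.* suc (R ℕ.* (m₀ ℕ.* suc b) ℕ.+ m₀ ℕ.* b) ℕ.+ R ℕ.* n
      ≡⟨ solve 4 (λ q b m n → let R = q :+ (con 1 :+ q) in con 2 :* (con 1 :+ (R :* (m :* (con 1 :+ b)) :+ m :* b)) :+ R :* n
           := con 2 :* m :* (con 2 :* (con 1 :+ q) :* b) :+ (con 2 :* R :* m :+ con 2 :+ R :* n)) refl q b m₀ n ⟩
    2 ℕ.* m₀ ℕ.* (2 ℕ.* suc q ℕ.* b) ℕ.+ (2 ℕ.* R ℕ.* m₀ ℕ.+ 2 ℕ.+ R ℕ.* n)
      ≤⟨ ℕP.+-monoˡ-≤ _ (ℕP.*-monoʳ-≤ (2 ℕ.* m₀) bias≤) ⟩
    2 ℕ.* m₀ ℕ.* (q ℕ.* n) ℕ.+ (2 ℕ.* R ℕ.* m₀ ℕ.+ 2 ℕ.+ R ℕ.* n)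
      ≡⟨ solve 3 (λ q n h → let R = q :+ (con 1 :+ q) ; m = n :+ h in
           con 2 :* m :* (q :* n) :+ (con 2 :* R :* m :+ con 2 :+ R :* n)
           := con 2 :* q :* (n :* n) :+ (con 2 :* h :* n :* q :+ (con 3 :* R :* n :+ (con 2 :* R :* h :* con 1 :+ con 2)))) refl q n h ⟩
    2 ℕ.* q ℕ.* (n ℕ.* n) ℕ.+ (2 ℕ.* h ℕ.* n ℕ.* q ℕ.+ (3 ℕ.* R ℕ.* n ℕ.+ (2 ℕ.* R ℕ.* h ℕ.* 1 ℕ.+ 2)))
      ≤⟨ ℕP.+-monoʳ-≤ (2 ℕ.* q ℕ.* (n ℕ.* n)) (ℕP.+-mono-≤ (ℕP.*-monoʳ-≤ (2 ℕ.* h ℕ.* n) (ℕP.m≤m+n q (suc q)))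
           (ℕP.+-monoʳ-≤ (3 ℕ.* R ℕ.* n) (ℕP.+-mono-≤ (ℕP.*-monoʳ-≤ (2 ℕ.* R ℕ.* h) (ℕP.≤-trans (s≤s z≤n) 2≤n)) 2≤n))) ⟩
    2 ℕ.* q ℕ.* (n ℕ.* n) ℕ.+ (2 ℕ.* h ℕ.* n ℕ.* R ℕ.+ (3 ℕ.* R ℕ.* n ℕ.+ (2 ℕ.* R ℕ.* h ℕ.* n ℕ.+ n)))
      ≡⟨ solve 4 (λ q n h R → con 2 :* q :* (n :* n) :+ (con 2 :* h :* n :* R :+ (con 3 :* R :* n :+ (con 2 :* R :* h :* n :+ n)))
           := con 2 :* q :* (n :* n) :+ n :* (R :* (con 3 :+ con 4 :* h) :+ con 1)) refl q n h R ⟩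
    2 ℕ.* q ℕ.* (n ℕ.* n) ℕ.+ n ℕ.* (R ℕ.* (3 ℕ.+ 4 ℕ.* h) ℕ.+ 1)
      ≤⟨ ℕP.+-monoʳ-≤ (2 ℕ.* q ℕ.* (n ℕ.* n)) (ℕP.*-monoʳ-≤ n large) ⟩
    2 ℕ.* q ℕ.* (n ℕ.* n) ℕ.+ n ℕ.* n
      ≡⟨ solve 2 (λ q x → con 2 :* q :* x :+ x := (q :+ (con 1 :+ q)) :* x) refl q (n ℕ.* n) ⟩
    R ℕ.* (n ℕ.* n)
      ≤⟨ ℕP.*-monoʳ-≤ R count ⟩
    R ℕ.* (E ℕ.+ (E ℕ.+ n))
      ≡⟨ solve 3 (λ R E n → R :* (E :+ (E :+ n)) := con 2 :* (R :* E) :+ R :* n) refl R E n ⟩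
    2 ℕ.* (R ℕ.* E) ℕ.+ R ℕ.* n ∎))
    where
    open ℕP.≤-Reasoning
    open ℕS.+-*-Solver
    R = q ℕ.+ suc q
    m₀ = n ℕ.+ h

  module Maker (q : ℕ) where

    R : ℕ
    R = q ℕ.+ suc q

    -- The number of vertices on either side of the bicliques that Breaker must not occupy.
    size : ℕ → ℕ
    size n = suc R ℕ.* (10 ℕ.* suc ⌊log₂ n ⌋)

    -- The `12 * s` insertion moves are `120 * suc R * (1 + log n)`, at most `240 * suc R * log n`
    -- once `log n ≥ 1`; the 1 covers the closing move.
    C : ℕ
    C = 1 ℕ.+ 240 ℕ.* suc R

    -- The three summands are the coefficients of `(1 + log n)²` that dominate `s²≤n`, `many-edges`
    -- and `small-risk`.
    constant : ℕ → ℕ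
    constant d = (100 ℕ.* suc R ℕ.* suc R ℕ.+ 60 ℕ.* suc R ℕ.+ 1) ℕ.+
                 ((7 ℕ.* R ℕ.+ 480 ℕ.* R ℕ.* suc R ℕ.+ 1) ℕ.+ (suc d ℕ.+ 120 ℕ.* suc d ℕ.* suc R ℕ.* R))

    module Large (d n : ℕ) (large : constant d ℕ.* (suc ⌊log₂ n ⌋ ℕ.* suc ⌊log₂ n ⌋) ℕ.≤ n) where

      private
        λ₂ s : ℕ
        λ₂ = ⌊log₂ n ⌋
        s = size n

        split : ∀ {a b c x} → (a ℕ.+ (b ℕ.+ c)) ℕ.* x ℕ.≤ n → a ℕ.* x ℕ.≤ n × b ℕ.* x ℕ.≤ n × c ℕ.* x ℕ.≤ n
        split {a} {b} {c} {x} le =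
          ℕP.≤-trans (ℕP.*-monoˡ-≤ x (ℕP.m≤m+n a (b ℕ.+ c))) le ,
          ℕP.≤-trans (ℕP.*-monoˡ-≤ x (ℕP.≤-trans (ℕP.m≤m+n b c) (ℕP.m≤n+m (b ℕ.+ c) a))) le ,
          ℕP.≤-trans (ℕP.*-monoˡ-≤ x (ℕP.≤-trans (ℕP.m≤n+m c b) (ℕP.m≤n+m (b ℕ.+ c) a))) le

        parts = split {100 ℕ.* suc R ℕ.* suc R ℕ.+ 60 ℕ.* suc R ℕ.+ 1} {7 ℕ.* R ℕ.+ 480 ℕ.* R ℕ.* suc R ℕ.+ 1} large

      s²≤n : s ℕ.* s ℕ.+ (6 ℕ.* s ℕ.+ 1) ℕ.≤ n
      s²≤n = ℕP.≤-trans (ℕP.m≤m+n _ (60 ℕ.* suc R ℕ.* (λ₂ ℕ.+ λ₂ ℕ.* λ₂) ℕ.+ (2 ℕ.* λ₂ ℕ.+ λ₂ ℕ.* λ₂))) (ℕP.≤-trans (ℕP.≤-reflexive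
        (solve 2 (λ r k → let s = r :* (con 10 :* (con 1 :+ k)) in
          s :* s :+ (con 6 :* s :+ con 1) :+ (con 60 :* r :* (k :+ k :* k) :+ (con 2 :* k :+ k :* k))
          := (con 100 :* r :* r :+ con 60 :* r :+ con 1) :* ((con 1 :+ k) :* (con 1 :+ k))) refl (suc R) λ₂)) (proj₁ parts))
        where open ℕS.+-*-Solver

      many-edges : R ℕ.* (3 ℕ.+ 4 ℕ.* suc (12 ℕ.* s)) ℕ.+ 1 ℕ.≤ n
      many-edges = ℕP.≤-trans (ℕP.m≤m+n _ (7 ℕ.* R ℕ.* (2 ℕ.* λ₂ ℕ.+ λ₂ ℕ.* λ₂) ℕ.+ 480 ℕ.* R ℕ.* suc R ℕ.* (λ₂ ℕ.+ λ₂ ℕ.* λ₂) ℕ.+ (2 ℕ.* λ₂ ℕ.+ λ₂ ℕ.* λ₂))) (ℕP.≤-trans (ℕP.≤-reflexive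
        (solve 3 (λ R r k → let s = r :* (con 10 :* (con 1 :+ k)) in
          R :* (con 3 :+ con 4 :* (con 1 :+ con 12 :* s)) :+ con 1 :+
            (con 7 :* R :* (con 2 :* k :+ k :* k) :+ con 480 :* R :* r :* (k :+ k :* k) :+ (con 2 :* k :+ k :* k))
          := (con 7 :* R :+ con 480 :* R :* r :+ con 1) :* ((con 1 :+ k) :* (con 1 :+ k))) refl R (suc R) λ₂)) (proj₁ (proj₂ parts)))
        where open ℕS.+-*-Solver

      small-risk : suc d ℕ.* (1 ℕ.+ 12 ℕ.* s ℕ.* R) ℕ.≤ n
      small-risk = ℕP.≤-trans (ℕP.m≤m+n _ (suc d ℕ.* (2 ℕ.* λ₂ ℕ.+ λ₂ ℕ.* λ₂) ℕ.+ 120 ℕ.* suc d ℕ.* suc R ℕ.* R ℕ.* (λ₂ ℕ.+ λ₂ ℕ.* λ₂))) (ℕP.≤-trans (ℕP.≤-reflexive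
        (solve 4 (λ D R r k → let s = r :* (con 10 :* (con 1 :+ k)) in
          D :* (con 1 :+ con 12 :* s :* R) :+ (D :* (con 2 :* k :+ k :* k) :+ con 120 :* D :* r :* R :* (k :+ k :* k))
          := (D :+ con 120 :* D :* r :* R) :* ((con 1 :+ k) :* (con 1 :+ k))) refl (suc d) R (suc R) λ₂)) (proj₂ (proj₂ parts)))
        where open ℕS.+-*-Solver

      1≤s : 1 ℕ.≤ s
      1≤s = ℕP.*-mono-≤ {1} {suc R} {1} (s≤s z≤n) (ℕP.≤-trans (s≤s z≤n) (ℕP.m≤n*m (suc λ₂) 10))

      4s≤n : 4 ℕ.* s ℕ.≤ n
      4s≤n = ℕP.≤-trans (ℕP.*-monoˡ-≤ s (ℕP.m≤m+n 4 2)) (ℕP.≤-trans (ℕP.m≤m+n (6 ℕ.* s) 1) (ℕP.≤-trans (ℕP.m≤n+m _ (s ℕ.* s)) s²≤n))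

      3≤n : 3 ℕ.≤ n
      3≤n = ℕP.≤-trans (ℕP.*-mono-≤ {3} {4} {1} (ℕP.m≤m+n 3 1) 1≤s) 4s≤n

      rounds-enough : suc (n ℕ.+ 12 ℕ.* s) ℕ.≤ n ℕ.+ C ℕ.* λ₂
      rounds-enough = ℕP.≤-trans (ℕP.≤-reflexive (sym (ℕP.+-suc n _))) (ℕP.+-monoʳ-≤ n (begin
        suc (12 ℕ.* s)                                        ≡⟨ solve 2 (λ r k → con 1 :+ con 12 :* (r :* (con 10 :* (con 1 :+ k))) := (con 1 :+ con 120 :* r) :* con 1 :+ con 120 :* r :* k) refl (suc R) λ₂ ⟩
        (1 ℕ.+ 120 ℕ.* suc R) ℕ.* 1 ℕ.+ 120 ℕ.* suc R ℕ.* λ₂  ≤⟨ ℕP.+-monoˡ-≤ _ (ℕP.*-monoʳ-≤ (1 ℕ.+ 120 ℕ.* suc R) 1≤λ₂) ⟩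
        (1 ℕ.+ 120 ℕ.* suc R) ℕ.* λ₂ ℕ.+ 120 ℕ.* suc R ℕ.* λ₂ ≡⟨ solve 2 (λ r k → (con 1 :+ con 120 :* r) :* k :+ con 120 :* r :* k := (con 1 :+ con 240 :* r) :* k) refl (suc R) λ₂ ⟩
        C ℕ.* λ₂                                              ∎))
        where
        open ℕP.≤-Reasoning
        open ℕS.+-*-Solver
        1≤λ₂ : 1 ℕ.≤ λ₂
        1≤λ₂ = ⌊log₂⌋-mono-≤ (ℕP.≤-trans (ℕP.n≤1+n 2) 3≤n)

      module _ {b : ℕ} (bias≤ : 2 ℕ.* suc q ℕ.* b ℕ.≤ q ℕ.* n)
        (P : List (Edge n) → Set) (P? : ∀ G → Dec (P G)) (hamiltonian⇒P : ∀ {G} → Hamiltonian G → P G) where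

        private
          E m₀ : ℕ
          E = length (allEdges n)
          m₀ = n ℕ.+ suc (12 ℕ.* s)

          suffice : R ℕ.* (m₀ ℕ.* suc b) ℕ.+ m₀ ℕ.* b ℕ.< R ℕ.* E
          suffice = edges-suffice {q} {b} {n} {suc (12 ℕ.* s)} bias≤ (edge-count-lower n) many-edges (ℕP.≤-trans (ℕP.n≤1+n 2) 3≤n)

          spare : Σ ℕ λ l → suc (m₀ ℕ.* suc b) ℕ.+ l ≡ E
          spare = ℕP.m≤n⇒∃[o]m+o≡n (ℕP.*-cancelˡ-< R _ _ (ℕP.≤-<-trans (ℕP.m≤m+n _ (m₀ ℕ.* b)) suffice))

          l : ℕ
          l = proj₁ spare

          budget≡ : m₀ ℕ.* suc b ℕ.+ suc l ≡ E
          budget≡ = trans (ℕP.+-suc _ l) (proj₂ spare)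

          picks≤ : m₀ ℕ.* b ℕ.≤ R ℕ.* suc l
          picks≤ = ℕP.<⇒≤ (ℕP.+-cancelˡ-< (R ℕ.* (m₀ ℕ.* suc b)) _ _ (subst (R ℕ.* (m₀ ℕ.* suc b) ℕ.+ m₀ ℕ.* b ℕ.<_)
            (trans (cong (R ℕ.*_) (sym budget≡)) (ℕP.*-distribˡ-+ R (m₀ ℕ.* suc b) (suc l))) suffice))

        rounds≤edges : suc (n ℕ.+ 12 ℕ.* s) ℕ.≤ E
        rounds≤edges = subst (ℕ._≤ E) (ℕP.+-suc n _)
          (ℕP.≤-trans (ℕP.m≤m*n m₀ (suc b)) (ℕP.≤-trans (ℕP.m≤m+n _ (suc l)) (ℕP.≤-reflexive budget≡)))

        -- Multiplied by `n`, the union bound is at most 1 and the `12 * s` exposures at most `R`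
        -- each, so the risk is of order `log n / n`.
        maker-wins-within : ∀ {m} → suc (n ℕ.+ 12 ℕ.* s) ℕ.≤ m →
          1ℚ - (ℤ.+ 1) / suc d ≤ 𝔼 (indicator ∘ P?) (play (strategy s b) b m [] [])
        maker-wins-within {m} m₀≤m = ℚP.≤-trans (ℚP.+-monoʳ-≤ 1ℚ (ℚP.neg-antimono-≤ risk≤))
          (Play.success-bound s b l 1≤s 4s≤n 3≤n (Family.family s) (proj₁ ∘ Family.family-large s)
            (Family.family-good s 1≤s 4s≤n s²≤n) P P? hamiltonian⇒P {m₀} {m} (subst (ℕ._≤ m) (sym (ℕP.+-suc n _)) m₀≤m)
            (ℕP.≤-reflexive (sym (ℕP.+-suc n _))) (ℕP.≤-reflexive budget≡))
          where
          open ℚP.≤-Reasoning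
          open +-*-Solver
          Φ Θ : ℚ
          Φ = ΣΨ (Family.family {n} s) [] (odds l (m₀ ℕ.* b))
          Θ = ι (12 ℕ.* s) * odds l b
          D = ι (suc d)
          ratio : suc R ℕ.* (m₀ ℕ.* b) ℕ.≤ R ℕ.* suc (l ℕ.+ m₀ ℕ.* b)
          ratio = subst (suc R ℕ.* (m₀ ℕ.* b) ℕ.≤_) (sym (ℕP.*-distribˡ-+ R (suc l) (m₀ ℕ.* b)))
            (ℕP.+-monoˡ-≤ (R ℕ.* (m₀ ℕ.* b)) picks≤)
          -- The plan has at least `n` rounds, and all their picks together number at most
          -- `R * suc l`; hence a single round hits a given edge with probability at most `R / n`.
          n*b≤ : n ℕ.* b ℕ.≤ R ℕ.* suc (l ℕ.+ b)
          n*b≤ = ℕP.≤-trans (ℕP.*-monoˡ-≤ b (ℕP.m≤m+n n _))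
            (ℕP.≤-trans picks≤ (ℕP.*-monoʳ-≤ R (s≤s (ℕP.m≤m+n l b))))
          0<n : 0ℚ < ι n
          0<n = ℚP.<-≤-trans (0<ι 0) (ι-mono (ℕP.≤-trans (s≤s z≤n) 3≤n))
          n*risk : ι n * (Φ + Θ) ≤ ι (1 ℕ.+ 12 ℕ.* s ℕ.* R)
          n*risk = begin
            ι n * (Φ + Θ)                              ≡⟨ solve 4 (λ n f k o → n :* (f :+ k :* o) := n :* f :+ k :* (n :* o)) refl (ι n) Φ (ι (12 ℕ.* s)) (odds l b) ⟩
            ι n * Φ + ι (12 ℕ.* s) * (ι n * odds l b)  ≤⟨ ℚP.+-mono-≤ (family-risk R (suc λ₂) (s≤s z≤n) (<2^log n) (0≤odds l _) (odds≤1 l (m₀ ℕ.* b)) (odds-scaled ratio))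
                                                            (*-monoˡ (0≤ι (12 ℕ.* s)) (odds-scaled n*b≤)) ⟩
            1ℚ + ι (12 ℕ.* s) * ι R                    ≡⟨ cong (1ℚ +_) (ι-* (12 ℕ.* s) R) ⟨
            1ℚ + ι (12 ℕ.* s ℕ.* R)                    ≡⟨ ι-suc (12 ℕ.* s ℕ.* R) ⟨
            ι (1 ℕ.+ 12 ℕ.* s ℕ.* R)                   ∎
          risk≤ : Φ + Θ ≤ (ℤ.+ 1) / suc d
          risk≤ = *-cancelˡ (0<ι d) (*-cancelˡ 0<n (begin
            ι n * (D * (Φ + Θ))                        ≡⟨ solve 3 (λ n d x → n :* (d :* x) := d :* (n :* x)) refl (ι n) D (Φ + Θ) ⟩
            D * (ι n * (Φ + Θ))                        ≤⟨ *-monoˡ (0≤ι (suc d)) n*risk ⟩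
            D * ι (1 ℕ.+ 12 ℕ.* s ℕ.* R)               ≡⟨ ι-* (suc d) _ ⟨
            ι (suc d ℕ.* (1 ℕ.+ 12 ℕ.* s ℕ.* R))       ≤⟨ ι-mono small-risk ⟩
            ι n                                        ≡⟨ ℚP.*-identityʳ (ι n) ⟨
            ι n * 1ℚ                                   ≡⟨ cong (ι n *_) (trans (sym (unit-* d)) (ℚP.*-comm ((ℤ.+ 1) / suc d) D)) ⟩
            ι n * (D * ((ℤ.+ 1) / suc d))              ∎))

open Estimates

-- The fast Hamilton cycle and the three thresholds.

open import Data.Nat using (_+_; _*_; _^_)

module _ (ε : ℚ) (0<ε : 0ℚ ℚ.< ε) where

  private
    q : ℕ
    q = proj₁ (unit-below ε 0<ε)

  clever : (n : ℕ) → Strategy n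
  clever n = strategy (Maker.size q n) (bias (ℚ.- ε) half n)

  module _ (P : ∀ {n} → List (Edge n) → Set) (P? : ∀ {n} (G : List (Edge n)) → Dec (P G))
           (hamiltonian⇒P : ∀ {n} {G : List (Edge n)} → Hamiltonian G → P G) where

    -- The number of rounds is a parameter because one strategy serves both the short game and the
    -- full one.
    maker-wins : (m : ℕ → ℕ) →
      (∀ d n (large : Maker.constant q d ℕ.* (suc ⌊log₂ n ⌋ ℕ.* suc ⌊log₂ n ⌋) ℕ.≤ n) → suc (n + 12 * Maker.size q n) ℕ.≤ m n) →
      AAS (λ n G → P G) (λ n → play (clever n) (bias (ℚ.- ε) half n) (m n) [] [])
    maker-wins m enough = aas (λ n → P?) λ δ 0<δ → let (d , unit≤δ) = unit-below δ 0<δ in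
      2 ^ (8 * Maker.constant q d) , λ n N≤n →
        let large = log²-eventually-≤ (Maker.constant q d) n N≤n in
        ℚP.≤-trans (ℚP.+-monoʳ-≤ 1ℚ (ℚP.neg-antimono-≤ unit≤δ))
          (Maker.Large.maker-wins-within q d n large (bias-upper q (proj₂ (unit-below ε 0<ε)) n) P P? hamiltonian⇒P (enough d n large))

    maker-wins-full : AAS (λ n G → P G) (λ n → fullGame (clever n) (bias (ℚ.- ε) half n))
    maker-wins-full = maker-wins (λ n → length (allEdges n)) λ d n large →
      Maker.Large.rounds≤edges q d n large (bias-upper q (proj₂ (unit-below ε 0<ε)) n) P P? hamiltonian⇒P

-- Breaker denies Maker `n ∸ 1` edges above the threshold, and Maker builds a Hamilton cycle below
-- it, so any decidable property between these two extremes has the same threshold.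
sharp-threshold : (P : ∀ {n} → List (Edge n) → Set) → (∀ {n} (G : List (Edge n)) → Dec (P G)) →
  (∀ {n} {G : List (Edge n)} → P G → n ℕ.≤ suc (length G)) →
  (∀ {n} {G : List (Edge n)} → Hamiltonian G → P G) → SharpThreshold P half
sharp-threshold P P? large hamiltonian⇒P ε 0<ε =
  breaker-wins P P? large ε 0<ε , clever ε 0<ε , maker-wins-full ε 0<ε P P? hamiltonian⇒P

theorem2 : ((ε : ℚ) → 0ℚ ℚ.< ε →
    Σ ((n : ℕ) → Strategy n) λ S → Σ ℕ λ C →
    AAS (λ n G → Hamiltonian G)
    (λ n → gameWithin (S n) (bias (ℚ.- ε) half n) (n + C * ⌊log₂ n ⌋)))
    × SharpThreshold Connected half
    × SharpThreshold MinDeg2 half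
    × SharpThreshold Hamiltonian half
theorem2 =
  (λ ε 0<ε → clever ε 0<ε , Maker.C (proj₁ (unit-below ε 0<ε)) ,
    maker-wins ε 0<ε Hamiltonian hamiltonian? (λ h → h) _
      (Maker.Large.rounds-enough (proj₁ (unit-below ε 0<ε)))) ,
  sharp-threshold Connected connected? connected⇒edges hamiltonian⇒connected ,
  sharp-threshold MinDeg2 minDeg2? (λ d → ℕP.m≤n⇒m≤1+n (minDeg2⇒edges d)) hamiltonian⇒minDeg2 ,
  sharp-threshold Hamiltonian hamiltonian? (connected⇒edges ∘ hamiltonian⇒connected) (λ h → h)
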